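{- Let $D$ be a locally special double poset on a finite set $N$ and let $\mathfrak{G}\subseteq\operatorname{Aut}(D)$. Then $(-1)^{|N|}\operatorname{sgn}\cdot S\,\Omega(D,\mathfrak{G},\mathbf{x})=\Omega(D^{*},\mathfrak{G},\mathbf{x})$, i.e. for every $\mathfrak{g}\in\mathfrak{G}$, $(-1)^{|N|}\operatorname{sgn}(\mathfrak{g})\,S\big(\Omega(D,\mathfrak{G},\mathbf{x};\mathfrak{g})\big)=\Omega(D^{*},\mathfrak{G},\mathbf{x};\mathfrak{g})$. Also $(-1)^{|N|}\operatorname{sgn}(\mathfrak{g})\,\Omega(D,\mathfrak{G},-x;\mathfrak{g})=\Omega(D^*,\mathfrak{G},x;\mathfrak{g})$ for all $\mathfrak{g}\in\mathfrak{G}$.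
   Context: Double poset $D=(N,\le_1,\le_2)$; locally special: whenever $y$ covers $x$ in $\le_1$, $x$ and $y$ are $\le_2$-comparable. $D^*$ is the double poset obtained from $D$ by reversing $\le_1$ (keeping $\le_2$); note $\operatorname{Aut}(D^*)=\operatorname{Aut}(D)$ (bijections preserving both orders). A $D$-partition is $f:N\to\{1,2,\dots\}$ with $i\le_1 j\Rightarrow f(i)\le f(j)$ and ($i<_1j$ and $j<_2 i$) $\Rightarrow f(i)<f(j)$. $\Omega(D,\mathfrak{G},\mathbf{x};\mathfrak{g})=\sum_f\prod_{v\in N}x_{f(v)}$ over $D$-partitions with $f\circ\mathfrak{g}=f$; $\Omega(D,\mathfrak{G},x;\mathfrak{g})$ is the polynomial in $x$ whose value at each positive integer $n$ is the number of such $f$ with values in $\{1,\dots,n\}$. $\operatorname{sgn}(\mathfrak{g})$ is the sign of $\mathfrak{g}$ as a permutation of $N$. $S$ is the antipode of the Hopf algebra of quasisymmetric functions: $S(M_\alpha)=(-1)^{\ell(\alpha)}\sum_{\beta\le\alpha}M_{\overleftarrow{\beta}}$, where $\ell(\alpha)$ is the number of parts, $\beta\le\alpha$ means $\alpha$ refines $\beta$, and $\overleftarrow\beta$ is $\beta$ reversed. -}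

module Defs where

open import Data.Nat as ℕ using (ℕ; zero; suc)
open import Data.Integer as ℤ using (ℤ; +_)
open import Data.Rational as ℚ using (ℚ)
open import Data.Bool using (Bool; true; false; _∧_; not; T)
open import Data.Fin as Fin using (Fin; toℕ)
open import Data.Fin.Permutation using (Permutation′; _⟨$⟩ʳ_)
open import Data.Vec as Vec using (Vec; []; _∷_; lookup)
open import Data.List as List using (List; []; _∷_; map; concatMap; _++_; filter; length; foldr; reverse; allFin)
open import Data.Bool.ListAction using (all)
open import Data.List.Properties using (≡-dec)
open import Data.Product using (_×_; _,_; proj₁)
open import Data.Sum using (_⊎_)
open import Relation.Nullary using (¬_; does)
open import Relation.Binary.PropositionalEquality using (_≡_)
open import Relation.Binary.Structures using (IsPartialOrder)
open import Function using (flip)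

BRel : ℕ → Set
BRel n = Fin n → Fin n → Bool

strict : ∀ {n} → BRel n → BRel n
strict le i j = le i j ∧ not (does (i Fin.≟ j))

IsPoset : ∀ {n} → BRel n → Set
IsPoset le = IsPartialOrder _≡_ (λ i j → T (le i j))

IsDoublePoset : ∀ {n} → BRel n → BRel n → Set
IsDoublePoset le₁ le₂ = IsPoset le₁ × IsPoset le₂

LocallySpecial : ∀ {n} → BRel n → BRel n → Set
LocallySpecial {n} le₁ le₂ =
  ∀ (x y : Fin n) → T (strict le₁ x y) →
  (∀ (z : Fin n) → ¬ (T (strict le₁ x z) × T (strict le₁ z y))) →
  T (le₂ x y) ⊎ T (le₂ y x)

-- D* : reverse ≤₁, keep ≤₂ (we only need the first order reversed)
dual₁ : ∀ {n} → BRel n → BRel n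
dual₁ le₁ = flip le₁

IsAut : ∀ {n} → BRel n → BRel n → Permutation′ n → Set
IsAut {n} le₁ le₂ g =
  ∀ (i j : Fin n) → (le₁ (g ⟨$⟩ʳ i) (g ⟨$⟩ʳ j) ≡ le₁ i j) × (le₂ (g ⟨$⟩ʳ i) (g ⟨$⟩ʳ j) ≡ le₂ i j)

allPairs : (n : ℕ) → (Fin n → Fin n → Bool) → Bool
allPairs n p = all (λ i → all (λ j → p i j) (allFin n)) (allFin n)

count : ∀ {A : Set} → (A → Bool) → List A → ℕ
count p xs = length (filter (λ x → Relation.Nullary.Decidable.Core.T? (p x)) xs)
  where import Relation.Nullary.Decidable.Core

inversions : ∀ {n} → Permutation′ n → ℕ
inversions {n} g =
  count (λ ij → does (proj₁ ij Fin.<? Data.Product.proj₂ ij) ∧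
                does ((g ⟨$⟩ʳ Data.Product.proj₂ ij) Fin.<? (g ⟨$⟩ʳ proj₁ ij)))
        (concatMap (λ i → map (λ j → (i , j)) (allFin n)) (allFin n))
  where import Data.Product

negOnePow : ℕ → ℤ
negOnePow zero = + 1
negOnePow (suc k) = ℤ.- negOnePow k

sgn : ∀ {n} → Permutation′ n → ℤ
sgn g = negOnePow (inversions g)

-- D-partitions.  A map f : N → {1,2,...}; we encode a map into {1,...,k}
-- as Fin k (value toℕ i + 1); comparisons are unaffected by the shift.

isGInvDPartition : ∀ {n} → BRel n → BRel n → Permutation′ n → (Fin n → ℕ) → Bool
isGInvDPartition {n} le₁ le₂ g f =
  allPairs n (λ i j →
     (not (le₁ i j) Data.Bool.∨ does (f i ℕ.≤? f j)) ∧
     (not (strict le₁ i j ∧ strict le₂ j i) Data.Bool.∨ does (f i ℕ.<? f j)))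
  ∧ all (λ i → does (f (g ⟨$⟩ʳ i) ℕ.≟ f i)) (allFin n)
  where import Data.Bool

allMaps : (k n : ℕ) → List (Vec (Fin k) n)
allMaps k zero = [] ∷ []
allMaps k (suc n) = concatMap (λ i → map (i ∷_) (allMaps k n)) (allFin k)

asMap : ∀ {k n} → Vec (Fin k) n → Fin n → ℕ
asMap v i = suc (toℕ (lookup v i))

orderCount : ∀ {n} → BRel n → BRel n → Permutation′ n → ℕ → ℕ
orderCount {n} le₁ le₂ g m =
  count (λ v → isGInvDPartition le₁ le₂ g (asMap v)) (allMaps m n)

-- Compositions and quasisymmetric functions of degree n in the
-- monomial basis: a formal ℤ-linear combination of M_α.

Composition : Set
Composition = List ℕ

compositions : ℕ → List Composition
compositions zero = [] ∷ []
compositions (suc m) = map (1 ∷_) (compositions m) ++ concatMap inc (compositions m)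
  where
  inc : Composition → List Composition
  inc [] = []
  inc (a ∷ as) = (suc a ∷ as) ∷ []

QSymElt : Set
QSymElt = List (ℤ × Composition)

coeff : Composition → QSymElt → ℤ
coeff γ ts = foldr (λ t acc → (if does (≡-dec ℕ._≟_ (Data.Product.proj₂ t) γ) then proj₁ t else + 0) ℤ.+ acc) (+ 0) ts
  where
  import Data.Product
  open Data.Bool using (if_then_else_)
  import Data.Bool

-- coefficient of x₁^{α₁} ⋯ x_k^{α_k} (= coefficient of M_α) in Ω(D,𝔊,𝐱;g):
-- number of g-invariant D-partitions f with values in {1,…,k}
-- and |f⁻¹(i)| = α_i for each i.
fiberSizes : ∀ {k n} → Vec (Fin k) n → List ℕ
fiberSizes {k} v = map (λ c → count (λ x → does (x Fin.≟ c)) (Vec.toList v)) (allFin k)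

monoCoeff : ∀ {n} → BRel n → BRel n → Permutation′ n → Composition → ℕ
monoCoeff {n} le₁ le₂ g α =
  count (λ v → isGInvDPartition le₁ le₂ g (asMap v) ∧ does (≡-dec ℕ._≟_ (fiberSizes v) α))
        (allMaps (length α) n)

Ω : ∀ {n} → BRel n → BRel n → Permutation′ n → QSymElt
Ω {n} le₁ le₂ g = map (λ α → (+ monoCoeff le₁ le₂ g α , α)) (compositions n)

coarse : ℕ → List ℕ → List Composition
coarse acc [] = (acc ∷ []) ∷ []
coarse acc (b ∷ rest) = map (acc ∷_) (coarse b rest) ++ coarse (acc ℕ.+ b) rest

coarsenings : Composition → List Composition
coarsenings [] = [] ∷ []
coarsenings (a ∷ rest) = coarse a rest

antipode : QSymElt → QSymElt
antipode = concatMap (λ t → map (λ β → (negOnePow (length (Data.Product.proj₂ t)) ℤ.* proj₁ t , reverse β))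
                                 (coarsenings (Data.Product.proj₂ t)))
  where import Data.Product

-- Polynomials over ℚ (coefficient lists, constant term first)

Poly : Set
Poly = List ℚ

eval : Poly → ℚ → ℚ
eval p x = foldr (λ c acc → c ℚ.+ x ℚ.* acc) ℚ.0ℚ p

ℕtoℚ : ℕ → ℚ
ℕtoℚ m = (+ m) ℚ./ 1

ℤtoℚ : ℤ → ℚ
ℤtoℚ z = z ℚ./ 1

IsOrderPoly : ∀ {n} → BRel n → BRel n → Permutation′ n → Poly → Set
IsOrderPoly le₁ le₂ g P = ∀ (m : ℕ) → 1 ℕ.≤ m → eval P (ℕtoℚ m) ≡ ℕtoℚ (orderCount le₁ le₂ g m)

{-# OPTIONS --safe #-}

-- A g-invariant D-partition is a chain of g-invariant ≤₁-down-sets ∅ = I₀ ⊆ … ⊆ N, where a step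
-- I ⊆ J is allowed iff J ∖ I contains no x <₁ y with y <₂ x.  Let ζ be the 0/1 matrix of allowed
-- steps, ζ* the same matrix for ≥₂, and ε the diagonal matrix of the signs (-1)^(orbits in I).  Then
-- ζ ε ζ* ε = 1: between distinct I ⊆ J the summands cancel in pairs, by toggling the orbit of a
-- ≤₂-maximal element of J ∖ I, and local specialness makes this toggling preserve allowed steps.
-- The antipode expands the inverse of ζ, graded by the sizes of the steps; the order polynomial at m
-- is an entry of ζᵐ, a Newton series in m, so at -m it is that entry of (ε ζ* ε)ᵐ.  Reversing the
-- values identifies partitions of (≥₁,≤₂) with those of (≤₁,≥₂), and ε(N) = (-1)ⁿ sgn g because
-- deleting a non-fixed element from its cycle changes the sign of g and keeps the number of orbits.

module Submission where

open import Defs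
open import Data.Nat as ℕ using (ℕ; zero; suc; z≤n; s≤s)
import Data.Nat.Properties as ℕₚ
open import Data.Nat.ListAction using (sum)
open import Data.Integer as ℤ using (ℤ; +_; _+_; _*_; -_; 0ℤ; 1ℤ)
import Data.Integer.Properties as ℤₚ
open import Algebra.Properties.CommutativeSemigroup ℤₚ.*-commutativeSemigroup using (x∙yz≈y∙xz)
open import Data.Integer.Tactic.RingSolver using (solve-∀)
open import Data.Rational as ℚ using (ℚ)
open import Data.Bool using (Bool; true; false; T; not; _∧_; _∨_; _xor_; if_then_else_)
import Data.Bool.Properties as Boolₚ
open import Data.Fin as Fin using (Fin; zero; suc; toℕ)
import Data.Fin.Properties as Finₚ
open import Data.Fin.Permutation using (Permutation′; _⟨$⟩ʳ_; _⟨$⟩ˡ_; inverseʳ; inverseˡ; _∘ₚ_; transpose; remove; punchIn-permute)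
open import Data.Fin.Subset using (∣_∣; ⊤; ⊥)
open import Data.Vec as Vec using (Vec; []; _∷_; lookup)
import Data.Vec.Properties as Vecₚ
open import Data.List as List using (List; []; _∷_; map; concatMap; _++_; length; reverse; allFin; tabulate)
import Data.List.Properties as Listₚ
open import Data.List.Relation.Unary.All as All using (All; []; _∷_)
import Data.List.Relation.Unary.All.Properties as Allₚ
open import Data.Product using (_×_; ∃; _,_; proj₁; proj₂)
open import Data.Sum as Sum using (_⊎_; inj₁; inj₂)
open import Data.Empty using (⊥-elim)
open import Data.Unit using (tt)
open import Function using (_∘_; flip; id; case_of_)
open import Relation.Nullary using (¬_; Dec; yes; no; does)
open import Relation.Nullary.Decidable using (_×-dec_; _→-dec_; ¬?; T?; map′)
open import Relation.Binary.PropositionalEquality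
  using (_≡_; _≢_; refl; sym; trans; cong; cong₂; subst; module ≡-Reasoning)
open ≡-Reasoning
open import Data.Fin.Induction using (po-wellFounded)
open import Induction.WellFounded using (Acc; acc)
import Relation.Binary.Construct.Flip.EqAndOrd as FlipOrder
open import Relation.Binary.Structures using (IsPartialOrder)
open import Function.Bundles using (Equivalence)
open import Data.Bool.ListAction using (all)
open import Data.List.Membership.Propositional.Properties using (∈-allFin)
open import Relation.Binary.Definitions as Tri using (Tri)
open import Data.Fin.Subset.Properties using (∣p∣≤n)
open import Data.Rational using (0ℚ; 1ℚ)
import Data.Rational.Properties as ℚₚ
import Data.Rational.Unnormalised as ℚᵘ
import Data.Rational.Unnormalised.Properties as ℚᵘₚ
open import Data.Rational.Solver using (module +-*-Solver)
open import Data.Nat.ListAction.Properties using (sum-↭)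
open import Data.List.Relation.Binary.Permutation.Propositional using (↭-sym)
open import Data.List.Relation.Binary.Permutation.Propositional.Properties using (↭-reverse; All-resp-↭)

-- Local specialness speaks of covers only, while being a down-set concerns all comparable pairs. A
-- failure of the toggled set to be a down-set is therefore first moved to a cover. There one
-- orientation of `≤₂` contradicts the maximality of the toggled element, and the other is an
-- inversion in a step already known to be allowed; this is why one factor takes `≤₂` and the other
-- `≥₂`. Whole orbits can be toggled because `g` preserves `≤₂`: the orbit of a maximal element
-- consists of maximal elements. The orbit depends on `I` and `J` alone, so toggling is symmetric
-- difference with a fixed set, a permutation of all subsets that negates every summand. The sum
-- equals its negative, and no explicit pairing is built. For this `ε` must be multiplicative on
-- arbitrary subsets, so it counts members of a fixed set `R`, one from each orbit, instead of
-- orbits. The antipode uses that `ε ζ* ε` is a right inverse of `ζ`. Values at negative arguments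
-- use that it is a left inverse, which comes from the same argument with `≤₂` reversed.

-- Finite sums and Iverson brackets

∑ : ∀ {A : Set} → List A → (A → ℤ) → ℤ
∑ []       f = 0ℤ
∑ (x ∷ xs) f = f x + ∑ xs f

∑-cong-All : ∀ {A : Set} {xs : List A} {f g : A → ℤ} → All (λ x → f x ≡ g x) xs → ∑ xs f ≡ ∑ xs g
∑-cong-All []       = refl
∑-cong-All (e ∷ es) = cong₂ _+_ e (∑-cong-All es)

∑-cong : ∀ {A : Set} (xs : List A) {f g : A → ℤ} → (∀ x → f x ≡ g x) → ∑ xs f ≡ ∑ xs g
∑-cong xs e = ∑-cong-All (All.universal e xs)

∑-zero : ∀ {A : Set} (xs : List A) → ∑ xs (λ _ → 0ℤ) ≡ 0ℤ
∑-zero []       = refl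
∑-zero (x ∷ xs) = trans (ℤₚ.+-identityˡ _) (∑-zero xs)

∑-≡0 : ∀ {A : Set} (xs : List A) {f : A → ℤ} → (∀ x → f x ≡ 0ℤ) → ∑ xs f ≡ 0ℤ
∑-≡0 xs e = trans (∑-cong xs e) (∑-zero xs)

∑-distrib-+ : ∀ {A : Set} (xs : List A) (f g : A → ℤ) → ∑ xs (λ x → f x + g x) ≡ ∑ xs f + ∑ xs g
∑-distrib-+ []       f g = refl
∑-distrib-+ (x ∷ xs) f g rewrite ∑-distrib-+ xs f g = interchange (f x) (g x) (∑ xs f) (∑ xs g)
  where
  interchange : ∀ a b c d → a + b + (c + d) ≡ a + c + (b + d)
  interchange = solve-∀

*-distribˡ-∑ : ∀ {A : Set} (xs : List A) c (f : A → ℤ) → c * ∑ xs f ≡ ∑ xs (λ x → c * f x)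
*-distribˡ-∑ []       c f = ℤₚ.*-zeroʳ c
*-distribˡ-∑ (x ∷ xs) c f =
  trans (ℤₚ.*-distribˡ-+ c (f x) (∑ xs f)) (cong (_+_ (c * f x)) (*-distribˡ-∑ xs c f))

*-distribʳ-∑ : ∀ {A : Set} (xs : List A) c (f : A → ℤ) → ∑ xs f * c ≡ ∑ xs (λ x → f x * c)
*-distribʳ-∑ xs c f = begin
  ∑ xs f * c              ≡⟨ ℤₚ.*-comm (∑ xs f) c ⟩
  c * ∑ xs f              ≡⟨ *-distribˡ-∑ xs c f ⟩
  ∑ xs (λ x → c * f x)    ≡⟨ ∑-cong xs (λ x → ℤₚ.*-comm c (f x)) ⟩
  ∑ xs (λ x → f x * c)    ∎

neg-distrib-∑ : ∀ {A : Set} (xs : List A) (f : A → ℤ) → - ∑ xs f ≡ ∑ xs (λ x → - f x)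
neg-distrib-∑ []       f = refl
neg-distrib-∑ (x ∷ xs) f = trans (ℤₚ.neg-distrib-+ (f x) (∑ xs f)) (cong (_+_ (- f x)) (neg-distrib-∑ xs f))

∑-swap : ∀ {A B : Set} (xs : List A) (ys : List B) (f : A → B → ℤ) →
         ∑ xs (λ x → ∑ ys (f x)) ≡ ∑ ys (λ y → ∑ xs (λ x → f x y))
∑-swap []       ys f = sym (∑-zero ys)
∑-swap (x ∷ xs) ys f =
  trans (cong (_+_ (∑ ys (f x))) (∑-swap xs ys f)) (sym (∑-distrib-+ ys (f x) (λ y → ∑ xs (λ x → f x y))))

∑-++ : ∀ {A : Set} (xs ys : List A) (f : A → ℤ) → ∑ (xs ++ ys) f ≡ ∑ xs f + ∑ ys f
∑-++ []       ys f = sym (ℤₚ.+-identityˡ _)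
∑-++ (x ∷ xs) ys f = trans (cong (_+_ (f x)) (∑-++ xs ys f)) (sym (ℤₚ.+-assoc (f x) (∑ xs f) (∑ ys f)))

∑-map : ∀ {A B : Set} (h : A → B) xs (f : B → ℤ) → ∑ (map h xs) f ≡ ∑ xs (f ∘ h)
∑-map h []       f = refl
∑-map h (x ∷ xs) f = cong (_+_ (f (h x))) (∑-map h xs f)

∑-concatMap : ∀ {A B : Set} (h : A → List B) xs (f : B → ℤ) →
              ∑ (concatMap h xs) f ≡ ∑ xs (λ x → ∑ (h x) f)
∑-concatMap h []       f = refl
∑-concatMap h (x ∷ xs) f = trans (∑-++ (h x) (concatMap h xs) f) (cong (_+_ (∑ (h x) f)) (∑-concatMap h xs f))

∑-allFin-suc : ∀ n (f : Fin (suc n) → ℤ) → ∑ (allFin (suc n)) f ≡ f zero + ∑ (allFin n) (f ∘ suc)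
∑-allFin-suc n f = cong (_+_ (f zero)) (begin
  ∑ (tabulate suc) f          ≡⟨ cong (λ l → ∑ l f) (sym (Listₚ.map-tabulate id suc)) ⟩
  ∑ (map suc (allFin n)) f    ≡⟨ ∑-map suc (allFin n) f ⟩
  ∑ (allFin n) (f ∘ suc)      ∎)

χ : ∀ {P : Set} → Dec P → ℤ
χ d = if does d then 1ℤ else 0ℤ

χ-true : ∀ {P : Set} (d : Dec P) → P → χ d ≡ 1ℤ
χ-true (yes _) p = refl
χ-true (no ¬p) p = ⊥-elim (¬p p)

χ-false : ∀ {P : Set} (d : Dec P) → ¬ P → χ d ≡ 0ℤ
χ-false (yes p) ¬p = ⊥-elim (¬p p)
χ-false (no _)  ¬p = refl

χ-⇔ : ∀ {P Q : Set} (d : Dec P) (e : Dec Q) → (P → Q) → (Q → P) → χ d ≡ χ e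
χ-⇔ (yes p) e f g = sym (χ-true e (f p))
χ-⇔ (no ¬p) e f g = sym (χ-false e (¬p ∘ g))

χ-× : ∀ {P Q : Set} (d : Dec P) (e : Dec Q) → χ (d ×-dec e) ≡ χ d * χ e
χ-× (yes _) e = sym (ℤₚ.*-identityˡ (χ e))
χ-× (no _)  e = refl

χ-*-cong : ∀ {P : Set} (d : Dec P) {x y : ℤ} → (P → x ≡ y) → χ d * x ≡ χ d * y
χ-*-cong (yes p) e = cong (1ℤ *_) (e p)
χ-*-cong (no _)  e = refl

+count≡∑ : ∀ {A : Set} (p : A → Bool) xs → + count p xs ≡ ∑ xs (λ x → χ (T? (p x)))
+count≡∑ p []       = refl
+count≡∑ p (x ∷ xs) with p x
... | true  = trans (ℤₚ.pos-+ 1 (count p xs)) (cong (_+_ (1ℤ)) (+count≡∑ p xs))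
... | false = trans (+count≡∑ p xs) (sym (ℤₚ.+-identityˡ _))

-- Subsets of Fin n

subsets : ∀ n → List (Vec Bool n)
subsets zero    = [] ∷ []
subsets (suc n) = map (true ∷_) (subsets n) ++ map (false ∷_) (subsets n)

_≟ˢ_ : ∀ {n} (I J : Vec Bool n) → Dec (I ≡ J)
_≟ˢ_ = Vecₚ.≡-dec Boolₚ._≟_

infix 4 _∈_ _⊆_ _⊆?_ _≟ˢ_

_∈_ : ∀ {n} → Fin n → Vec Bool n → Set
x ∈ I = T (lookup I x)

_⊆_ : ∀ {n} → Vec Bool n → Vec Bool n → Set
I ⊆ J = ∀ x → x ∈ I → x ∈ J

_⊆?_ : ∀ {n} (I J : Vec Bool n) → Dec (I ⊆ J)
I ⊆? J = Finₚ.all? (λ x → T? (lookup I x) →-dec T? (lookup J x))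

_⊕_ : ∀ {n} → Vec Bool n → Vec Bool n → Vec Bool n
_⊕_ = Vec.zipWith _xor_

∑-subsets-suc : ∀ n (F : Vec Bool (suc n) → ℤ) →
                ∑ (subsets (suc n)) F ≡ ∑ (subsets n) (F ∘ (true ∷_)) + ∑ (subsets n) (F ∘ (false ∷_))
∑-subsets-suc n F =
  trans (∑-++ (map (true ∷_) (subsets n)) _ F)
        (cong₂ _+_ (∑-map (true ∷_) (subsets n) F) (∑-map (false ∷_) (subsets n) F))

-- In each coordinate, symmetric difference with `O` either keeps or exchanges the two halves of the
-- sum.
∑-⊕ : ∀ {n} (O : Vec Bool n) (F : Vec Bool n → ℤ) → ∑ (subsets n) (F ∘ (_⊕ O)) ≡ ∑ (subsets n) F
∑-⊕ []          F = refl
∑-⊕ {suc n} (b ∷ O) F = begin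
  ∑ (subsets (suc n)) (F ∘ (_⊕ (b ∷ O)))
    ≡⟨ ∑-subsets-suc n _ ⟩
  ∑ (subsets n) (λ I → F ((true xor b) ∷ (I ⊕ O))) + ∑ (subsets n) (λ I → F ((false xor b) ∷ (I ⊕ O)))
    ≡⟨ cong₂ _+_ (∑-⊕ O (F ∘ ((true xor b) ∷_))) (∑-⊕ O (F ∘ ((false xor b) ∷_))) ⟩
  ∑ (subsets n) (F ∘ ((true xor b) ∷_)) + ∑ (subsets n) (F ∘ ((false xor b) ∷_))
    ≡⟨ reorder b ⟩
  ∑ (subsets n) (F ∘ (true ∷_)) + ∑ (subsets n) (F ∘ (false ∷_))
    ≡⟨ sym (∑-subsets-suc n F) ⟩
  ∑ (subsets (suc n)) F ∎
  where
  reorder : ∀ b → ∑ (subsets n) (F ∘ ((true xor b) ∷_)) + ∑ (subsets n) (F ∘ ((false xor b) ∷_))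
                ≡ ∑ (subsets n) (F ∘ (true ∷_)) + ∑ (subsets n) (F ∘ (false ∷_))
  reorder true  = ℤₚ.+-comm (∑ (subsets n) (F ∘ (false ∷_))) _
  reorder false = refl

∑-δ : ∀ {n} (I : Vec Bool n) (F : Vec Bool n → ℤ) → ∑ (subsets n) (λ K → χ (K ≟ˢ I) * F K) ≡ F I
∑-δ [] F = trans (ℤₚ.+-identityʳ _) (ℤₚ.*-identityˡ (F []))
∑-δ {suc n} (b ∷ I) F = trans (∑-subsets-suc n _) (split b)
  where
  same : ∀ c → ∑ (subsets n) (λ K → χ (c ∷ K ≟ˢ c ∷ I) * F (c ∷ K)) ≡ F (c ∷ I)
  same c = trans
    (∑-cong (subsets n) (λ K → cong (_* F (c ∷ K))
      (χ-⇔ (c ∷ K ≟ˢ c ∷ I) (K ≟ˢ I) (proj₂ ∘ Vecₚ.∷-injective) (cong (c ∷_)))))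
    (∑-δ I (F ∘ (c ∷_)))
  other : ∀ c d → c ≢ d → ∑ (subsets n) (λ K → χ (c ∷ K ≟ˢ d ∷ I) * F (c ∷ K)) ≡ 0ℤ
  other c d c≢d = ∑-≡0 (subsets n) (λ K → cong (_* F (c ∷ K))
    (χ-false (c ∷ K ≟ˢ d ∷ I) (c≢d ∘ proj₁ ∘ Vecₚ.∷-injective)))
  split : ∀ b → ∑ (subsets n) (λ K → χ (true ∷ K ≟ˢ b ∷ I) * F (true ∷ K))
              + ∑ (subsets n) (λ K → χ (false ∷ K ≟ˢ b ∷ I) * F (false ∷ K)) ≡ F (b ∷ I)
  split true  = trans (cong₂ _+_ (same true) (other false true (λ ()))) (ℤₚ.+-identityʳ _)
  split false = trans (cong₂ _+_ (other true false (λ ())) (same false)) (ℤₚ.+-identityˡ _)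

⊆-tail : ∀ {n} {a b} {I J : Vec Bool n} → (a ∷ I) ⊆ (b ∷ J) → I ⊆ J
⊆-tail s x = s (suc x)

⊆-cons : ∀ {n} {a b} {I J : Vec Bool n} → (T a → T b) → I ⊆ J → (a ∷ I) ⊆ (b ∷ J)
⊆-cons h s zero    = h
⊆-cons h s (suc x) = s x

⊆-antisym : ∀ {n} {I J : Vec Bool n} → I ⊆ J → J ⊆ I → I ≡ J
⊆-antisym {I = []} {[]} p q = refl
⊆-antisym {I = true  ∷ I} {true  ∷ J} p q = cong (true ∷_) (⊆-antisym (⊆-tail p) (⊆-tail q))
⊆-antisym {I = false ∷ I} {false ∷ J} p q = cong (false ∷_) (⊆-antisym (⊆-tail p) (⊆-tail q))
⊆-antisym {I = true  ∷ I} {false ∷ J} p q = ⊥-elim (p zero tt)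
⊆-antisym {I = false ∷ I} {true  ∷ J} p q = ⊥-elim (q zero tt)

⊆⇒∣∣≤ : ∀ {n} (I J : Vec Bool n) → I ⊆ J → ∣ I ∣ ℕ.≤ ∣ J ∣
⊆⇒∣∣≤ []          []          s = z≤n
⊆⇒∣∣≤ (true  ∷ I) (true  ∷ J) s = s≤s (⊆⇒∣∣≤ I J (⊆-tail s))
⊆⇒∣∣≤ (true  ∷ I) (false ∷ J) s = ⊥-elim (s zero tt)
⊆⇒∣∣≤ (false ∷ I) (true  ∷ J) s = ℕₚ.m≤n⇒m≤1+n (⊆⇒∣∣≤ I J (⊆-tail s))
⊆⇒∣∣≤ (false ∷ I) (false ∷ J) s = ⊆⇒∣∣≤ I J (⊆-tail s)

⊆∧∣∣≡⇒≡ : ∀ {n} (I J : Vec Bool n) → I ⊆ J → ∣ I ∣ ≡ ∣ J ∣ → I ≡ J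
⊆∧∣∣≡⇒≡ []          []          s e = refl
⊆∧∣∣≡⇒≡ (true  ∷ I) (true  ∷ J) s e = cong (true ∷_) (⊆∧∣∣≡⇒≡ I J (⊆-tail s) (ℕₚ.suc-injective e))
⊆∧∣∣≡⇒≡ (true  ∷ I) (false ∷ J) s e = ⊥-elim (s zero tt)
⊆∧∣∣≡⇒≡ (false ∷ I) (true  ∷ J) s e =
  ⊥-elim (ℕₚ.1+n≰n (ℕₚ.≤-trans (ℕₚ.≤-reflexive (sym e)) (⊆⇒∣∣≤ I J (⊆-tail s))))
⊆∧∣∣≡⇒≡ (false ∷ I) (false ∷ J) s e = cong (false ∷_) (⊆∧∣∣≡⇒≡ I J (⊆-tail s) e)

-- Compositions

IsComposition : ℕ → Composition → Set
IsComposition n γ = All (1 ℕ.≤_) γ × sum γ ≡ n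

isComposition? : ∀ n γ → Dec (IsComposition n γ)
isComposition? n γ = All.all? (1 ℕ.≤?_) γ ×-dec (sum γ ℕ.≟ n)

1∷-isComposition : ∀ {n γ} → IsComposition n γ → IsComposition (suc n) (1 ∷ γ)
1∷-isComposition (p , e) = s≤s z≤n ∷ p , cong suc e

suc-isComposition : ∀ {n a γ} → IsComposition n (a ∷ γ) → IsComposition (suc n) (suc a ∷ γ)
suc-isComposition (_ ∷ p , e) = s≤s z≤n ∷ p , cong suc e

compositions-sound : ∀ n → All (IsComposition n) (compositions n)
compositions-sound zero    = ([] , refl) ∷ []
compositions-sound (suc m) =
  Allₚ.++⁺ (Allₚ.map⁺ (All.map 1∷-isComposition (compositions-sound m)))
           (Allₚ.concat⁺ (Allₚ.map⁺ (All.map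
             (λ { {[]} _ → [] ; {a ∷ γ} c → suc-isComposition c ∷ [] }) (compositions-sound m))))

coarse-sound : ∀ a l → 1 ℕ.≤ a → All (1 ℕ.≤_) l → All (IsComposition (a ℕ.+ sum l)) (coarse a l)
coarse-sound a []      h p        = (h ∷ [] , refl) ∷ []
coarse-sound a (b ∷ l) h (hb ∷ p) = Allₚ.++⁺
  (Allₚ.map⁺ (All.map (λ { (q , e) → h ∷ q , cong (a ℕ.+_) e }) (coarse-sound b l hb p)))
  (subst (λ s → All (IsComposition s) (coarse (a ℕ.+ b) l)) (ℕₚ.+-assoc a b (sum l))
    (coarse-sound (a ℕ.+ b) l (ℕₚ.≤-trans h (ℕₚ.m≤m+n a b)) p))

coarsenings-sound : ∀ {n} α → IsComposition n α → All (IsComposition n) (coarsenings α)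
coarsenings-sound []      c             = c ∷ []
coarsenings-sound (a ∷ α) (h ∷ p , refl) = coarse-sound a α h p

-- A composition of `suc m` either starts with a part 1 or comes from a composition of `m` by
-- increasing its first part; `bumpHead F` is the summand of the second kind. The empty composition
-- has no part to increase, hence the value 0.
bumpHead : (Composition → ℤ) → Composition → ℤ
bumpHead F []      = 0ℤ
bumpHead F (a ∷ α) = F (suc a ∷ α)

∑-compositions-suc : ∀ m (F : Composition → ℤ) →
  ∑ (compositions (suc m)) F ≡ ∑ (compositions m) (F ∘ (1 ∷_)) + ∑ (compositions m) (bumpHead F)
∑-compositions-suc m F = trans (∑-++ (map (1 ∷_) (compositions m)) _ F)
  (cong₂ _+_ (∑-map (1 ∷_) (compositions m) F)
             (trans (∑-concatMap _ (compositions m) F)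
                    (∑-cong (compositions m) (λ { [] → refl ; (a ∷ α) → ℤₚ.+-identityʳ _ }))))

∑-coarse-suc : ∀ a l f → ∑ (coarse (suc a) l) f ≡ ∑ (coarse a l) (bumpHead f)
∑-coarse-suc a []      f = refl
∑-coarse-suc a (b ∷ l) f = begin
  ∑ (map (suc a ∷_) (coarse b l) ++ coarse (suc (a ℕ.+ b)) l) f
    ≡⟨ ∑-++ (map (suc a ∷_) (coarse b l)) _ f ⟩
  ∑ (map (suc a ∷_) (coarse b l)) f + ∑ (coarse (suc (a ℕ.+ b)) l) f
    ≡⟨ cong₂ _+_ (trans (∑-map (suc a ∷_) (coarse b l) f) (sym (∑-map (a ∷_) (coarse b l) (bumpHead f))))
                 (∑-coarse-suc (a ℕ.+ b) l f) ⟩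
  ∑ (map (a ∷_) (coarse b l)) (bumpHead f) + ∑ (coarse (a ℕ.+ b) l) (bumpHead f)
    ≡⟨ sym (∑-++ (map (a ∷_) (coarse b l)) _ (bumpHead f)) ⟩
  ∑ (map (a ∷_) (coarse b l) ++ coarse (a ℕ.+ b) l) (bumpHead f) ∎

-- A coarsening of `1 ∷ α` keeps the leading 1 as a part or merges it into the first part of a
-- coarsening of `α`.
∑-coarsenings-1∷ : ∀ α f →
  ∑ (coarsenings (1 ∷ α)) f ≡ ∑ (coarsenings α) (f ∘ (1 ∷_)) + ∑ (coarsenings α) (bumpHead f)
∑-coarsenings-1∷ []      f = sym (ℤₚ.+-identityʳ _)
∑-coarsenings-1∷ (b ∷ α) f = trans (∑-++ (map (1 ∷_) (coarse b α)) _ f)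
  (cong₂ _+_ (∑-map (1 ∷_) (coarse b α) f) (∑-coarse-suc b α f))

_≟ᶜ_ : (α β : Composition) → Dec (α ≡ β)
_≟ᶜ_ = Listₚ.≡-dec ℕ._≟_

infix 4 _≟ᶜ_

-- For positive parts this is 1 if `α` refines `γ` and 0 otherwise. The form as a sum over
-- coarsenings is the one in which the coefficients of the antipode arise.
refinements : Composition → Composition → ℤ
refinements α γ = ∑ (coarsenings α) (λ β → χ (β ≟ᶜ γ))

∷-injectiveˡ≢ : ∀ {a b : ℕ} {α β : Composition} → a ≢ b → a ∷ α ≢ b ∷ β
∷-injectiveˡ≢ a≢b refl = a≢b refl

χ-∷ : ∀ a β γ → χ (a ∷ β ≟ᶜ a ∷ γ) ≡ χ (β ≟ᶜ γ)
χ-∷ a β γ = χ-⇔ (a ∷ β ≟ᶜ a ∷ γ) (β ≟ᶜ γ) Listₚ.∷-injectiveʳ (cong (a ∷_))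

χ-∷-≢ : ∀ {a b} β γ → a ≢ b → χ (a ∷ β ≟ᶜ b ∷ γ) ≡ 0ℤ
χ-∷-≢ {a} {b} β γ a≢b = χ-false (a ∷ β ≟ᶜ b ∷ γ) (∷-injectiveˡ≢ a≢b)

bumpHead-1 : ∀ {n} β γ → IsComposition n β → bumpHead (λ β → χ (β ≟ᶜ 1 ∷ γ)) β ≡ 0ℤ
bumpHead-1 []          γ c           = refl
bumpHead-1 (suc b ∷ β) γ (s≤s h ∷ _ , _) = χ-∷-≢ {suc (suc b)} {1} β γ (λ ())

bumpHead-suc : ∀ c β γ → bumpHead (λ β → χ (β ≟ᶜ suc (suc c) ∷ γ)) β ≡ χ (β ≟ᶜ suc c ∷ γ)
bumpHead-suc c []      γ = refl
bumpHead-suc c (b ∷ β) γ =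
  χ-⇔ (suc b ∷ β ≟ᶜ suc (suc c) ∷ γ) (b ∷ β ≟ᶜ suc c ∷ γ) (λ { refl → refl }) (λ { refl → refl })

-- This and the next three lemmas take one unit off the first part of both compositions. If the
-- coarser one starts with 1, the finer one must start with 1 too; otherwise the rest of the coarser
-- first part remains to be refined.
refinements-1∷-1∷ : ∀ {n} α γ → IsComposition n α → refinements (1 ∷ α) (1 ∷ γ) ≡ refinements α γ
refinements-1∷-1∷ α γ c = begin
  refinements (1 ∷ α) (1 ∷ γ)
    ≡⟨ ∑-coarsenings-1∷ α _ ⟩
  ∑ (coarsenings α) (λ β → χ (1 ∷ β ≟ᶜ 1 ∷ γ)) + ∑ (coarsenings α) (bumpHead (λ β → χ (β ≟ᶜ 1 ∷ γ)))
    ≡⟨ cong₂ _+_ (∑-cong (coarsenings α) (λ β → χ-∷ 1 β γ))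
                 (trans (∑-cong-All (All.map (λ {β} → bumpHead-1 β γ) (coarsenings-sound α c)))
                        (∑-zero (coarsenings α))) ⟩
  refinements α γ + 0ℤ
    ≡⟨ ℤₚ.+-identityʳ _ ⟩
  refinements α γ ∎

refinements-suc∷-1∷ : ∀ {n} a α γ → IsComposition n (a ∷ α) → refinements (suc a ∷ α) (1 ∷ γ) ≡ 0ℤ
refinements-suc∷-1∷ a α γ c = begin
  refinements (suc a ∷ α) (1 ∷ γ)
    ≡⟨ ∑-coarse-suc a α _ ⟩
  ∑ (coarse a α) (bumpHead (λ β → χ (β ≟ᶜ 1 ∷ γ)))
    ≡⟨ ∑-cong-All (All.map (λ {β} → bumpHead-1 β γ) (coarsenings-sound (a ∷ α) c)) ⟩
  ∑ (coarse a α) (λ _ → 0ℤ)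
    ≡⟨ ∑-zero (coarse a α) ⟩
  0ℤ ∎

refinements-1∷-suc∷ : ∀ c α γ → refinements (1 ∷ α) (suc (suc c) ∷ γ) ≡ refinements α (suc c ∷ γ)
refinements-1∷-suc∷ c α γ = begin
  refinements (1 ∷ α) (suc (suc c) ∷ γ)
    ≡⟨ ∑-coarsenings-1∷ α _ ⟩
  ∑ (coarsenings α) (λ β → χ (1 ∷ β ≟ᶜ suc (suc c) ∷ γ))
    + ∑ (coarsenings α) (bumpHead (λ β → χ (β ≟ᶜ suc (suc c) ∷ γ)))
    ≡⟨ cong₂ _+_ (∑-≡0 (coarsenings α) (λ β → χ-∷-≢ {1} {suc (suc c)} β γ (λ ())))
                 (∑-cong (coarsenings α) (λ β → bumpHead-suc c β γ)) ⟩
  0ℤ + refinements α (suc c ∷ γ)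
    ≡⟨ ℤₚ.+-identityˡ _ ⟩
  refinements α (suc c ∷ γ) ∎

refinements-suc∷-suc∷ : ∀ c a α γ →
  refinements (suc a ∷ α) (suc (suc c) ∷ γ) ≡ refinements (a ∷ α) (suc c ∷ γ)
refinements-suc∷-suc∷ c a α γ =
  trans (∑-coarse-suc a α _) (∑-cong (coarse a α) (λ β → bumpHead-suc c β γ))

∑ᶜ-refinements : ℕ → Composition → (Composition → ℤ) → ℤ
∑ᶜ-refinements m γ F = ∑ (compositions m) (λ α → refinements α γ * F α)

-- A refinement of c ∷ γ is a composition of c followed by a refinement of γ.
∑-refinements-∷ : ∀ c m γ F →
  ∑ᶜ-refinements (suc c ℕ.+ m) (suc c ∷ γ) F
    ≡ ∑ (compositions (suc c)) (λ α′ → ∑ᶜ-refinements m γ (λ α → F (α′ ++ α)))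
∑-refinements-∷ zero m γ F = begin
  ∑ᶜ-refinements (suc m) (1 ∷ γ) F
    ≡⟨ ∑-compositions-suc m _ ⟩
  ∑ (compositions m) (λ α → refinements (1 ∷ α) (1 ∷ γ) * F (1 ∷ α))
    + ∑ (compositions m) (bumpHead (λ α → refinements α (1 ∷ γ) * F α))
    ≡⟨ cong₂ _+_
         (∑-cong-All (All.map (λ {α} c → cong (_* F (1 ∷ α)) (refinements-1∷-1∷ α γ c)) (compositions-sound m)))
         (trans (∑-cong-All (All.map
                  (λ { {[]} _ → refl ; {a ∷ α} c → cong (_* F (suc a ∷ α)) (refinements-suc∷-1∷ a α γ c) })
                  (compositions-sound m)))
                (∑-zero (compositions m))) ⟩
  ∑ᶜ-refinements m γ (λ α → F (1 ∷ α)) + 0ℤ ∎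
∑-refinements-∷ (suc c) m γ F = begin
  ∑ᶜ-refinements (suc (suc c ℕ.+ m)) (suc (suc c) ∷ γ) F
    ≡⟨ ∑-compositions-suc (suc c ℕ.+ m) _ ⟩
  ∑ cs (λ α → refinements (1 ∷ α) (suc (suc c) ∷ γ) * F (1 ∷ α))
    + ∑ cs (bumpHead (λ α → refinements α (suc (suc c) ∷ γ) * F α))
    ≡⟨ cong₂ _+_
         (∑-cong cs (λ α → cong (_* F (1 ∷ α)) (refinements-1∷-suc∷ c α γ)))
         (∑-cong cs (λ { [] → refl ; (a ∷ α) → cong (_* F (suc a ∷ α)) (refinements-suc∷-suc∷ c a α γ) })) ⟩
  ∑ cs (λ α → refinements α (suc c ∷ γ) * F (1 ∷ α))
    + ∑ cs (λ α → refinements α (suc c ∷ γ) * bumpHead F α)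
    ≡⟨ merge cs (λ α → refinements α (suc c ∷ γ)) _ _ ⟩
  ∑ᶜ-refinements (suc c ℕ.+ m) (suc c ∷ γ) (λ α → F (1 ∷ α) + bumpHead F α)
    -- The induction on `c` runs over all `F` at once: taking off the first unit replaces `F` by the
    -- sum of its two continuations.
    ≡⟨ ∑-refinements-∷ c m γ _ ⟩
  ∑ (compositions (suc c)) (λ α′ → ∑ᶜ-refinements m γ (λ α → F (1 ∷ α′ ++ α) + bumpHead F (α′ ++ α)))
    ≡⟨ ∑-cong (compositions (suc c)) (λ α′ → sym (merge (compositions m) (λ α → refinements α γ) _ _)) ⟩
  ∑ (compositions (suc c)) (λ α′ → ∑ᶜ-refinements m γ (λ α → F (1 ∷ α′ ++ α))
                                 + ∑ᶜ-refinements m γ (λ α → bumpHead F (α′ ++ α)))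
    ≡⟨ ∑-distrib-+ (compositions (suc c)) _ _ ⟩
  ∑ (compositions (suc c)) (λ α′ → ∑ᶜ-refinements m γ (λ α → F (1 ∷ α′ ++ α)))
    + ∑ (compositions (suc c)) (λ α′ → ∑ᶜ-refinements m γ (λ α → bumpHead F (α′ ++ α)))
    -- A composition of `suc c` is nonempty, so increasing the head of `α′ ++ α` is increasing the
    -- head of `α′`.
    ≡⟨ cong (_+_ (∑ (compositions (suc c)) (λ α′ → ∑ᶜ-refinements m γ (λ α → F (1 ∷ α′ ++ α)))))
            (∑-cong-All (All.map (λ { {[]} (_ , ()) ; {a ∷ α} _ → refl }) (compositions-sound (suc c)))) ⟩
  ∑ (compositions (suc c)) (λ α′ → ∑ᶜ-refinements m γ (λ α → F (1 ∷ α′ ++ α)))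
    + ∑ (compositions (suc c)) (bumpHead (λ α′ → ∑ᶜ-refinements m γ (λ α → F (α′ ++ α))))
    ≡⟨ sym (∑-compositions-suc (suc c) _) ⟩
  ∑ (compositions (suc (suc c))) (λ α′ → ∑ᶜ-refinements m γ (λ α → F (α′ ++ α))) ∎
  where
  cs = compositions (suc c ℕ.+ m)
  merge : ∀ (xs : List Composition) (r f g : Composition → ℤ) →
    ∑ xs (λ α → r α * f α) + ∑ xs (λ α → r α * g α) ≡ ∑ xs (λ α → r α * (f α + g α))
  merge xs r f g = trans (sym (∑-distrib-+ xs _ _))
                         (∑-cong xs (λ α → sym (ℤₚ.*-distribˡ-+ (r α) (f α) (g α))))

∑-refinements-¬composition : ∀ m γ F → ¬ IsComposition m γ → ∑ᶜ-refinements m γ F ≡ 0ℤ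
∑-refinements-¬composition m γ F ¬c = trans
  (∑-cong-All (All.map (λ {α} c → cong (_* F α) (trans
    (∑-cong-All (All.map (λ {β} d → χ-false (β ≟ᶜ γ) (λ { refl → ¬c d })) (coarsenings-sound α c)))
    (∑-zero (coarsenings α)))) (compositions-sound m)))
  (∑-zero (compositions m))

∑-compositions-¬composition : ∀ m γ (F : Composition → ℤ) → ¬ IsComposition m γ →
  ∑ (compositions m) (λ α → χ (α ≟ᶜ γ) * F α) ≡ 0ℤ
∑-compositions-¬composition m γ F ¬c = trans
  (∑-cong-All (All.map (λ {α} c → cong (_* F α) (χ-false (α ≟ᶜ γ) (λ { refl → ¬c c }))) (compositions-sound m)))
  (∑-zero (compositions m))

∑-compositions-δ : ∀ m γ (F : Composition → ℤ) → IsComposition m γ →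
  ∑ (compositions m) (λ α → χ (α ≟ᶜ γ) * F α) ≡ F γ
∑-compositions-δ zero []      F c = trans (ℤₚ.+-identityʳ _) (ℤₚ.*-identityˡ (F []))
∑-compositions-δ zero (suc c ∷ γ) F (_ , ())
∑-compositions-δ zero (zero ∷ γ) F (() ∷ _ , _)
∑-compositions-δ (suc m) (1 ∷ γ) F (_ ∷ p , e) = begin
  ∑ (compositions (suc m)) (λ α → χ (α ≟ᶜ 1 ∷ γ) * F α)
    ≡⟨ ∑-compositions-suc m _ ⟩
  ∑ (compositions m) (λ α → χ (1 ∷ α ≟ᶜ 1 ∷ γ) * F (1 ∷ α))
    + ∑ (compositions m) (bumpHead (λ α → χ (α ≟ᶜ 1 ∷ γ) * F α))
    ≡⟨ cong₂ _+_
         (∑-cong (compositions m) (λ α → cong (_* F (1 ∷ α)) (χ-∷ 1 α γ)))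
         (trans (∑-cong-All (All.map
                  (λ { {[]} _ → refl ; {a ∷ α} c → cong (_* F (suc a ∷ α)) (bumpHead-1 (a ∷ α) γ c) })
                  (compositions-sound m)))
                (∑-zero (compositions m))) ⟩
  ∑ (compositions m) (λ α → χ (α ≟ᶜ γ) * F (1 ∷ α)) + 0ℤ
    ≡⟨ ℤₚ.+-identityʳ _ ⟩
  ∑ (compositions m) (λ α → χ (α ≟ᶜ γ) * F (1 ∷ α))
    ≡⟨ ∑-compositions-δ m γ (F ∘ (1 ∷_)) (p , ℕₚ.suc-injective e) ⟩
  F (1 ∷ γ) ∎
∑-compositions-δ (suc m) (suc (suc c) ∷ γ) F (_ ∷ p , e) = begin
  ∑ (compositions (suc m)) (λ α → χ (α ≟ᶜ suc (suc c) ∷ γ) * F α)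
    ≡⟨ ∑-compositions-suc m _ ⟩
  ∑ (compositions m) (λ α → χ (1 ∷ α ≟ᶜ suc (suc c) ∷ γ) * F (1 ∷ α))
    + ∑ (compositions m) (bumpHead (λ α → χ (α ≟ᶜ suc (suc c) ∷ γ) * F α))
    ≡⟨ cong₂ _+_
         (∑-≡0 (compositions m) (λ α → cong (_* F (1 ∷ α)) (χ-∷-≢ {1} {suc (suc c)} α γ (λ ()))))
         (∑-cong (compositions m) (λ { [] → refl
                                     ; (a ∷ α) → cong (_* F (suc a ∷ α)) (bumpHead-suc c (a ∷ α) γ) })) ⟩
  0ℤ + ∑ (compositions m) (λ α → χ (α ≟ᶜ suc c ∷ γ) * bumpHead F α)
    ≡⟨ ℤₚ.+-identityˡ _ ⟩
  ∑ (compositions m) (λ α → χ (α ≟ᶜ suc c ∷ γ) * bumpHead F α)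
    ≡⟨ ∑-compositions-δ m (suc c ∷ γ) (bumpHead F) (s≤s z≤n ∷ p , ℕₚ.suc-injective e) ⟩
  F (suc (suc c) ∷ γ) ∎

antidiagonal : ℕ → List (ℕ × ℕ)
antidiagonal zero    = (0 , 0) ∷ []
antidiagonal (suc m) = (0 , suc m) ∷ map (λ (a , b) → suc a , b) (antidiagonal m)

antidiagonal-sound : ∀ m → All (λ (a , b) → a ℕ.+ b ≡ m) (antidiagonal m)
antidiagonal-sound zero    = refl ∷ []
antidiagonal-sound (suc m) = refl ∷ Allₚ.map⁺ (All.map (cong suc) (antidiagonal-sound m))

-- The recursion by units does not isolate a first part; this form does, as needed to split off the
-- first step of a chain.
∑-compositions-head : ∀ m (G : Composition → ℤ) →
  ∑ (compositions (suc m)) G ≡ ∑ (antidiagonal m) (λ (a , b) → ∑ (compositions b) (λ α → G (suc a ∷ α)))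
∑-compositions-head zero G = sym (ℤₚ.+-identityʳ _)
∑-compositions-head (suc m) G = trans (∑-compositions-suc (suc m) G)
  (cong (_+_ (∑ (compositions (suc m)) (G ∘ (1 ∷_))))
    (trans (∑-compositions-head m (bumpHead G)) (sym (∑-map _ (antidiagonal m) _))))

∑-antidiagonal-δ : ∀ m a₀ b₀ →
  ∑ (antidiagonal m) (λ (a , b) → χ (a₀ ℕ.≟ a) * χ (b₀ ℕ.≟ b)) ≡ χ (a₀ ℕ.+ b₀ ℕ.≟ m)
∑-antidiagonal-δ zero zero zero = refl
∑-antidiagonal-δ zero zero (suc b₀) = refl
∑-antidiagonal-δ zero (suc a₀) b₀ = refl
∑-antidiagonal-δ (suc m) zero b₀ = trans
  (cong₂ _+_ (ℤₚ.*-identityˡ (χ (b₀ ℕ.≟ suc m))) (trans (∑-map _ (antidiagonal m) _) (∑-zero (antidiagonal m))))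
  (ℤₚ.+-identityʳ _)
∑-antidiagonal-δ (suc m) (suc a₀) b₀ = trans (ℤₚ.+-identityˡ _) (trans (∑-map _ (antidiagonal m) _)
  (trans (∑-cong (antidiagonal m) (λ (a , b) → cong (_* χ (b₀ ℕ.≟ b))
           (χ-⇔ (suc a₀ ℕ.≟ suc a) (a₀ ℕ.≟ a) ℕₚ.suc-injective (cong suc))))
         (trans (∑-antidiagonal-δ m a₀ b₀)
                (χ-⇔ (a₀ ℕ.+ b₀ ℕ.≟ m) (suc a₀ ℕ.+ b₀ ℕ.≟ suc m) (cong suc) ℕₚ.suc-injective))))

-- Signs of subsets, orbits and covers

-- The sign is -1 to the size of the intersection of `R` and `K`. With one element of every orbit in
-- `R`, it is the parity of the number of orbits in an invariant `K`; other `K` get a sign as well,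
-- but steps never reach them.
ε : ∀ {n} → Vec Bool n → Vec Bool n → ℤ
ε []      []      = 1ℤ
ε (r ∷ R) (k ∷ K) = (if r ∧ k then - 1ℤ else 1ℤ) * ε R K

-- Intersecting with `R` commutes with symmetric difference, and sizes add modulo 2. No disjointness
-- of `K` and `O` is assumed, so adding and deleting an orbit are the same case.
ε-⊕ : ∀ {n} (R K O : Vec Bool n) → ε R (K ⊕ O) ≡ ε R K * ε R O
ε-⊕ []      []      []      = refl
ε-⊕ (r ∷ R) (k ∷ K) (o ∷ O) = begin
  s (k xor o) * ε R (K ⊕ O)          ≡⟨ cong₂ _*_ (factor r k o) (ε-⊕ R K O) ⟩
  s k * s o * (ε R K * ε R O)        ≡⟨ shuffle (s k) (s o) (ε R K) (ε R O) ⟩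
  s k * ε R K * (s o * ε R O)        ∎
  where
  s : Bool → ℤ
  s b = if r ∧ b then - 1ℤ else 1ℤ
  factor : ∀ r k o → (if r ∧ (k xor o) then - 1ℤ else 1ℤ)
                   ≡ (if r ∧ k then - 1ℤ else 1ℤ) * (if r ∧ o then - 1ℤ else 1ℤ)
  factor false _     _     = refl
  factor true  false false = refl
  factor true  false true  = refl
  factor true  true  false = refl
  factor true  true  true  = refl
  shuffle : ∀ a b c d → a * b * (c * d) ≡ a * c * (b * d)
  shuffle = solve-∀

ε-square : ∀ {n} (R K : Vec Bool n) → ε R K * ε R K ≡ 1ℤ
ε-square []      []      = refl
ε-square (r ∷ R) (k ∷ K) = begin
  s * ε R K * (s * ε R K)    ≡⟨ shuffle s (ε R K) ⟩
  s * s * (ε R K * ε R K)    ≡⟨ cong₂ _*_ (unit (r ∧ k)) (ε-square R K) ⟩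
  1ℤ                         ∎
  where
  s = if r ∧ k then - 1ℤ else 1ℤ
  shuffle : ∀ a b → a * b * (a * b) ≡ a * a * (b * b)
  shuffle = solve-∀
  unit : ∀ b → (if b then - 1ℤ else 1ℤ) * (if b then - 1ℤ else 1ℤ) ≡ 1ℤ
  unit true  = refl
  unit false = refl

ε-⊥ : ∀ {n} (R : Vec Bool n) → ε R ⊥ ≡ 1ℤ
ε-⊥ []          = refl
ε-⊥ (true  ∷ R) = trans (ℤₚ.*-identityˡ _) (ε-⊥ R)
ε-⊥ (false ∷ R) = trans (ℤₚ.*-identityˡ _) (ε-⊥ R)

permutation-injective : ∀ {n} (g : Permutation′ n) {x y} → g ⟨$⟩ʳ x ≡ g ⟨$⟩ʳ y → x ≡ y
permutation-injective g {x} {y} e = trans (sym (inverseˡ g)) (trans (cong (g ⟨$⟩ˡ_) e) (inverseˡ g))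

-- Minimality is stated as an induction principle over predicates closed under `g` in both
-- directions, which avoids powers of `g`.
record IsOrbit {n} (g : Permutation′ n) (m : Fin n) (O : Vec Bool n) : Set₁ where
  field
    point     : m ∈ O
    invariant : ∀ x → lookup O (g ⟨$⟩ʳ x) ≡ lookup O x
    least     : ∀ (P : Fin n → Set) → (∀ x → P x → P (g ⟨$⟩ʳ x)) → (∀ x → P (g ⟨$⟩ʳ x) → P x) →
                P m → ∀ x → x ∈ O → P x

strict⇒ : ∀ {n} (le : BRel n) {x y} → T (strict le x y) → T (le x y) × x ≢ y
strict⇒ le {x} {y} h with le x y | x Fin.≟ y
... | true | no x≢y = tt , x≢y

⇒strict : ∀ {n} (le : BRel n) {x y} → T (le x y) → x ≢ y → T (strict le x y)
⇒strict le {x} {y} h x≢y with le x y | x Fin.≟ y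
... | true | no _    = tt
... | true | yes x≡y = x≢y x≡y

flip-IsPoset : ∀ {n} {le : BRel n} → IsPoset le → IsPoset (flip le)
flip-IsPoset = FlipOrder.isPartialOrder

strict-flip : ∀ {n} (le : BRel n) {x y} → T (strict (flip le) x y) → T (strict le y x)
strict-flip le h = let (p , ne) = strict⇒ (flip le) h in ⇒strict le p (ne ∘ sym)

minimal : ∀ {n} {le : BRel n} → IsPoset le → (P : Fin n → Set) → (∀ x → Dec (P x)) →
          ∀ a → P a → ∃ λ m → P m × (∀ z → P z → T (le z m) → z ≡ m)
minimal {le = le} po P P? a Pa = descend a Pa (po-wellFounded po a)
  where
  descend : ∀ a → P a → Acc (λ x y → T (le x y) × ¬ (x ≡ y)) a →
            ∃ λ m → P m × (∀ z → P z → T (le z m) → z ≡ m)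
  descend a Pa (acc rs) with Finₚ.any? (λ z → P? z ×-dec (T? (le z a) ×-dec ¬? (z Fin.≟ a)))
  ... | yes (z , Pz , z<a) = descend z Pz (rs z<a)
  ... | no none = a , Pa , λ z Pz z≤a → case z Fin.≟ a of λ
        { (yes z≡a) → z≡a ; (no z≢a) → ⊥-elim (none (z , Pz , z≤a , z≢a)) }

Cover : ∀ {n} → BRel n → Fin n → Fin n → Set
Cover le x y = T (strict le x y) × (∀ z → ¬ (T (strict le x z) × T (strict le z y)))

module _ {n} {le : BRel n} (po : IsPoset le) where
  private module PO = IsPartialOrder po

  -- A minimal element among those strictly above `x` and at most `y` covers `x`. This produces the
  -- covers to which local specialness applies.
  coverAbove : ∀ x y → T (strict le x y) → ∃ λ z → Cover le x z × T (le z y)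
  coverAbove x y x<y =
    let (z , (x<z , z≤y) , least) =
          minimal po (λ z → T (strict le x z) × T (le z y)) (λ z → T? _ ×-dec T? _) y (x<y , PO.refl)
    in z , (x<z , λ w (x<w , w<z) → let (w≤z , w≢z) = strict⇒ le w<z in
                  w≢z (least w (x<w , PO.trans w≤z z≤y) w≤z)) , z≤y

  coverBelow : ∀ x y → T (strict le x y) → ∃ λ z → Cover le z y × T (le x z)
  coverBelow x y x<y =
    let (z , (z<y , x≤z) , greatest) =
          minimal (flip-IsPoset po) (λ z → T (strict le z y) × T (le x z)) (λ z → T? _ ×-dec T? _) x (x<y , PO.refl)
    in z , (z<y , λ w (z<w , w<y) → let (z≤w , z≢w) = strict⇒ le z<w in
                  z≢w (sym (greatest w (w<y , PO.trans x≤z z≤w) z≤w))) , x≤z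

∈-⊕ : ∀ {n} (K O : Vec Bool n) x → lookup (K ⊕ O) x ≡ lookup K x xor lookup O x
∈-⊕ K O x = Vecₚ.lookup-zipWith _xor_ x K O

⊕-involutive : ∀ {n} (K O : Vec Bool n) → (K ⊕ O) ⊕ O ≡ K
⊕-involutive []      []      = refl
⊕-involutive (k ∷ K) (o ∷ O) = cong₂ _∷_ (cancel k o) (⊕-involutive K O)
  where
  cancel : ∀ k o → (k xor o) xor o ≡ k
  cancel false false = refl
  cancel false true  = refl
  cancel true  false = refl
  cancel true  true  = refl

⊕-inside : ∀ {n} {K O : Vec Bool n} {x} → x ∈ K → ¬ x ∈ O → x ∈ (K ⊕ O)
⊕-inside {K = K} {O} {x} p q rewrite ∈-⊕ K O x with lookup K x | lookup O x
... | true | false = tt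
... | true | true  = q tt

⊕-removed : ∀ {n} {K O : Vec Bool n} {x} → x ∈ K → x ∈ O → ¬ x ∈ (K ⊕ O)
⊕-removed {K = K} {O} {x} p q r rewrite ∈-⊕ K O x with lookup K x | lookup O x
⊕-removed p q () | true | true

⊕-outside : ∀ {n} {K O : Vec Bool n} {x} → ¬ x ∈ K → ¬ x ∈ O → ¬ x ∈ (K ⊕ O)
⊕-outside {K = K} {O} {x} p q r rewrite ∈-⊕ K O x with lookup K x | lookup O x
... | true  | _     = p tt
... | false | true  = q tt

-- Invariant down-sets and allowed steps

module Steps {n} (le₁ : BRel n) (g : Permutation′ n) where

  record Good (I : Vec Bool n) : Set where
    field
      invariant : ∀ x → lookup I (g ⟨$⟩ʳ x) ≡ lookup I x
      downward  : ∀ x y → T (le₁ x y) → y ∈ I → x ∈ I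

  -- J ∖ I may be one fibre of a g-invariant (≤₁,≤₂)-partition whose smaller fibres have union I.
  record Step (le₂ : BRel n) (I J : Vec Bool n) : Set where
    field
      sub         : I ⊆ J
      source      : Good I
      target      : Good J
      noInversion : ∀ x y → ¬ x ∈ I → y ∈ J → T (strict le₁ x y) → ¬ T (strict le₂ y x)

  abstract
    good? : ∀ I → Dec (Good I)
    good? I = map′ (λ (a , b) → record { invariant = a ; downward = b })
                   (λ G → Good.invariant G , Good.downward G)
                   (Finₚ.all? (λ x → lookup I (g ⟨$⟩ʳ x) Boolₚ.≟ lookup I x)
                    ×-dec Finₚ.all? (λ x → Finₚ.all? (λ y →
                      T? (le₁ x y) →-dec T? (lookup I y) →-dec T? (lookup I x))))

    step? : ∀ le₂ I J → Dec (Step le₂ I J)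
    step? le₂ I J = map′
      (λ (a , b , c , d) → record { sub = a ; source = b ; target = c ; noInversion = d })
      (λ S → Step.sub S , Step.source S , Step.target S , Step.noInversion S)
      ((I ⊆? J) ×-dec good? I ×-dec good? J ×-dec
        Finₚ.all? (λ x → Finₚ.all? (λ y →
          ¬? (T? (lookup I x)) →-dec T? (lookup J y) →-dec
          T? (strict le₁ x y) →-dec ¬? (T? (strict le₂ y x)))))

  ζ : BRel n → Vec Bool n → Vec Bool n → ℤ
  ζ le₂ I J = χ (step? le₂ I J)

-- A sum negated by a permutation of its index set vanishes because the integers have no 2-torsion.
x≡-x⇒x≡0 : ∀ {x : ℤ} → x ≡ - x → x ≡ 0ℤ
x≡-x⇒x≡0 {+ zero} _ = refl
x≡-x⇒x≡0 {+ suc x} ()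
x≡-x⇒x≡0 {ℤ.-[1+ x ]} ()

-- Cancellation by toggling an orbit

module Convolution {n} (le₁ le₂ : BRel n) (g : Permutation′ n)
  (po₁ : IsPoset le₁) (po₂ : IsPoset le₂) (special : LocallySpecial le₁ le₂) (aut : IsAut le₁ le₂ g)
  (R : Vec Bool n) (orbit : ∀ m → ∃ λ O → IsOrbit g m O × ε R O ≡ - 1ℤ)
  where
  open Steps le₁ g

  Maximal : Vec Bool n → Vec Bool n → Fin n → Set
  Maximal I J m = ¬ m ∈ I × m ∈ J × (∀ z → ¬ z ∈ I → z ∈ J → T (le₂ m z) → m ≡ z)

  ∃-maximal : ∀ I J → I ⊆ J → I ≢ J → ∃ (Maximal I J)
  ∃-maximal I J I⊆J I≢J with Finₚ.any? (λ x → ¬? (T? (lookup I x)) ×-dec T? (lookup J x))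
  ... | no none = ⊥-elim (I≢J (⊆-antisym I⊆J λ x x∈J → case T? (lookup I x) of λ
          { (yes x∈I) → x∈I ; (no x∉I) → ⊥-elim (none (x , x∉I , x∈J)) }))
  ... | yes (a , Pa) =
    let (m , (m∉I , m∈J) , greatest) =
          minimal (flip-IsPoset po₂) (λ x → ¬ x ∈ I × x ∈ J)
                  (λ x → ¬? (T? (lookup I x)) ×-dec T? (lookup J x)) a Pa
    in m , m∉I , m∈J , λ z z∉I z∈J m≤z → sym (greatest z (z∉I , z∈J) m≤z)

  module Toggle {I J} (goodI : Good I) (goodJ : Good J) {m} (max : Maximal I J m)
                {O} (isOrbit : IsOrbit g m O) where
    private
      module O = IsOrbit isOrbit
      module I = Good goodI
      module J = Good goodJ

    maximal-g : ∀ x → Maximal I J x → Maximal I J (g ⟨$⟩ʳ x)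
    maximal-g x (x∉I , x∈J , mx) =
      (λ gx∈I → x∉I (subst T (I.invariant x) gx∈I)) , subst T (sym (J.invariant x)) x∈J ,
      λ z z∉I z∈J gx≤z →
        let w = g ⟨$⟩ˡ z ; gw≡z = inverseʳ g {z} in
        trans (cong (g ⟨$⟩ʳ_)
          (mx w (λ w∈I → z∉I (subst (_∈ I) gw≡z (subst T (sym (I.invariant w)) w∈I)))
                (subst T (J.invariant w) (subst (_∈ J) (sym gw≡z) z∈J))
                (subst T (proj₂ (aut x w)) (subst (λ z → T (le₂ (g ⟨$⟩ʳ x) z)) (sym gw≡z) gx≤z))))
          gw≡z

    maximal-g⁻¹ : ∀ x → Maximal I J (g ⟨$⟩ʳ x) → Maximal I J x
    maximal-g⁻¹ x (gx∉I , gx∈J , mx) =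
      (λ x∈I → gx∉I (subst T (sym (I.invariant x)) x∈I)) , subst T (J.invariant x) gx∈J ,
      λ z z∉I z∈J x≤z → permutation-injective g
        (mx (g ⟨$⟩ʳ z) (λ gz∈I → z∉I (subst T (I.invariant z) gz∈I)) (subst T (sym (J.invariant z)) z∈J)
            (subst T (sym (proj₂ (aut x z))) x≤z))

    -- `g` preserves `≤₂`, `I` and `J`, so maximality passes from `m` along its orbit in both
    -- directions.
    O-maximal : ∀ x → x ∈ O → Maximal I J x
    O-maximal = O.least (Maximal I J) maximal-g maximal-g⁻¹ max

    no-strictly-above : ∀ x y → x ∈ O → ¬ y ∈ I → y ∈ J → ¬ T (strict le₂ x y)
    no-strictly-above x y x∈O y∉I y∈J x<y = let (x≤y , x≢y) = strict⇒ le₂ x<y in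
      x≢y (proj₂ (proj₂ (O-maximal x x∈O)) y y∉I y∈J x≤y)

    Between : Vec Bool n → Set
    Between K = Step le₂ I K × Step (flip le₂) K J

    module _ {K} (IK : Step le₂ I K) (KJ : Step (flip le₂) K J) where
      private
        module IK = Step IK
        module KJ = Step KJ
        module K  = Good IK.target

      ⊕-invariant : ∀ x → lookup (K ⊕ O) (g ⟨$⟩ʳ x) ≡ lookup (K ⊕ O) x
      ⊕-invariant x = begin
        lookup (K ⊕ O) (g ⟨$⟩ʳ x)                         ≡⟨ ∈-⊕ K O _ ⟩
        lookup K (g ⟨$⟩ʳ x) xor lookup O (g ⟨$⟩ʳ x)       ≡⟨ cong₂ _xor_ (K.invariant x) (O.invariant x) ⟩
        lookup K x xor lookup O x                         ≡⟨ sym (∈-⊕ K O x) ⟩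
        lookup (K ⊕ O) x                                  ∎

      -- Only the down-set property is delicate. If `x` in `O` lies below `y` in the remaining set,
      -- a cover `z` of `x` with `z` below `y` lies in `K` and outside `I`. Then `x ≤₂ z`
      -- contradicts the maximality of `x`, and `z ≤₂ x` is an inversion in the step from `I` to
      -- `K`. The second step gains only the elements of `O`, and being maximal they cannot be the
      -- lower element of an inversion for `≥₂`.
      delete : (∀ x → x ∈ O → x ∈ K) → Between (K ⊕ O)
      delete O⊆K = record
        { sub = λ x x∈I → ⊕-inside {K = K} (IK.sub x x∈I) (λ x∈O → proj₁ (O-maximal x x∈O) x∈I)
        ; source = goodI ; target = goodK′
        ; noInversion = λ x y x∉I y∈K′ → IK.noInversion x y x∉I (K′⊆K y y∈K′) } , record
        { sub = λ x x∈K′ → KJ.sub x (K′⊆K x x∈K′)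
        ; source = goodK′ ; target = goodJ
        ; noInversion = noInversion′ }
        where
        K′⊆K : (K ⊕ O) ⊆ K
        K′⊆K x x∈K′ with T? (lookup K x)
        ... | yes x∈K = x∈K
        ... | no x∉K  = ⊥-elim (⊕-outside {K = K} {O} x∉K (x∉K ∘ O⊆K x) x∈K′)
        notO : ∀ x → x ∈ (K ⊕ O) → ¬ x ∈ O
        notO x x∈K′ x∈O = ⊕-removed {K = K} {O} (O⊆K x x∈O) x∈O x∈K′
        downward′ : ∀ x y → T (le₁ x y) → y ∈ (K ⊕ O) → x ∈ (K ⊕ O)
        downward′ x y x≤y y∈K′ with T? (lookup O x)
        ... | no x∉O  = ⊕-inside {K = K} (K.downward x y x≤y (K′⊆K y y∈K′)) x∉O
        ... | yes x∈O = ⊥-elim (comparable (special x z x<z cover))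
          where
          x<y = ⇒strict le₁ x≤y (λ { refl → notO y y∈K′ x∈O })
          above = coverAbove po₁ x y x<y
          z = proj₁ above
          x<z = proj₁ (proj₁ (proj₂ above))
          cover = proj₂ (proj₁ (proj₂ above))
          x≢z = proj₂ (strict⇒ le₁ x<z)
          z∈K = K.downward z y (proj₂ (proj₂ above)) (K′⊆K y y∈K′)
          x∉I = proj₁ (O-maximal x x∈O)
          z∉I = λ z∈I → x∉I (I.downward x z (proj₁ (strict⇒ le₁ x<z)) z∈I)
          comparable : ¬ (T (le₂ x z) ⊎ T (le₂ z x))
          comparable (inj₁ x≤z) = no-strictly-above x z x∈O z∉I (KJ.sub z z∈K) (⇒strict le₂ x≤z x≢z)
          comparable (inj₂ z≤x) = IK.noInversion x z x∉I z∈K x<z (⇒strict le₂ z≤x (x≢z ∘ sym))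
        goodK′ : Good (K ⊕ O)
        goodK′ = record { invariant = ⊕-invariant ; downward = downward′ }
        noInversion′ : ∀ x y → ¬ x ∈ (K ⊕ O) → y ∈ J → T (strict le₁ x y) → ¬ T (strict (flip le₂) y x)
        noInversion′ x y x∉K′ y∈J x<y y<x with T? (lookup O x)
        ... | no x∉O  = KJ.noInversion x y (λ x∈K → x∉K′ (⊕-inside {K = K} x∈K x∉O)) y∈J x<y y<x
        ... | yes x∈O = no-strictly-above x y x∈O
                          (λ y∈I → proj₁ (O-maximal x x∈O) (I.downward x y (proj₁ (strict⇒ le₁ x<y)) y∈I))
                          y∈J (strict-flip le₂ y<x)

      -- Dual to `delete`: if `x` outside `K` lies below `y` in `O`, take `z` above `x` that is
      -- covered by `y`; it is outside `K`. Now `z ≤₂ y` is an inversion for `≥₂` in the step from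
      -- `K` to `J`, and `y ≤₂ z` contradicts the maximality of `y`.
      insert : (∀ x → x ∈ O → ¬ x ∈ K) → Between (K ⊕ O)
      insert O∩K = record
        { sub = λ x x∈I → K⊆K′ x (IK.sub x x∈I)
        ; source = goodI ; target = goodK′
        ; noInversion = noInversion′ } , record
        { sub = λ x x∈K′ → case member x x∈K′ of λ
            { (inj₁ x∈K) → KJ.sub x x∈K ; (inj₂ x∈O) → proj₁ (proj₂ (O-maximal x x∈O)) }
        ; source = goodK′ ; target = goodJ
        ; noInversion = λ x y x∉K′ → KJ.noInversion x y (x∉K′ ∘ K⊆K′ x) }
        where
        member : ∀ x → x ∈ (K ⊕ O) → x ∈ K ⊎ x ∈ O
        member x x∈K′ with T? (lookup K x) | T? (lookup O x)
        ... | yes x∈K | _       = inj₁ x∈K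
        ... | no x∉K  | yes x∈O = inj₂ x∈O
        ... | no x∉K  | no x∉O  = ⊥-elim (⊕-outside {K = K} {O} x∉K x∉O x∈K′)
        K⊆K′ : K ⊆ (K ⊕ O)
        K⊆K′ x x∈K = ⊕-inside {K = K} x∈K (λ x∈O → O∩K x x∈O x∈K)
        downward′ : ∀ x y → T (le₁ x y) → y ∈ (K ⊕ O) → x ∈ (K ⊕ O)
        downward′ x y x≤y y∈K′ with member y y∈K′ | T? (lookup K x) | x Fin.≟ y
        ... | inj₁ y∈K | _       | _        = K⊆K′ x (K.downward x y x≤y y∈K)
        ... | inj₂ y∈O | yes x∈K | _        = K⊆K′ x x∈K
        ... | inj₂ y∈O | no x∉K  | yes refl = y∈K′
        ... | inj₂ y∈O | no x∉K  | no x≢y   = ⊥-elim (comparable (special z y z<y cover))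
          where
          below = coverBelow po₁ x y (⇒strict le₁ x≤y x≢y)
          z = proj₁ below
          z<y = proj₁ (proj₁ (proj₂ below))
          cover = proj₂ (proj₁ (proj₂ below))
          z≢y = proj₂ (strict⇒ le₁ z<y)
          y∈J = proj₁ (proj₂ (O-maximal y y∈O))
          z∉K = λ z∈K → x∉K (K.downward x z (proj₂ (proj₂ below)) z∈K)
          comparable : ¬ (T (le₂ z y) ⊎ T (le₂ y z))
          comparable (inj₁ z≤y) =
            KJ.noInversion z y z∉K y∈J z<y (⇒strict (flip le₂) z≤y (z≢y ∘ sym))
          comparable (inj₂ y≤z) =
            no-strictly-above y z y∈O (z∉K ∘ IK.sub z) (J.downward z y (proj₁ (strict⇒ le₁ z<y)) y∈J)
              (⇒strict le₂ y≤z (z≢y ∘ sym))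
        goodK′ : Good (K ⊕ O)
        goodK′ = record { invariant = ⊕-invariant ; downward = downward′ }
        noInversion′ : ∀ x y → ¬ x ∈ I → y ∈ (K ⊕ O) → T (strict le₁ x y) → ¬ T (strict le₂ y x)
        noInversion′ x y x∉I y∈K′ x<y y<x with member y y∈K′
        ... | inj₁ y∈K = IK.noInversion x y x∉I y∈K x<y y<x
        ... | inj₂ y∈O = no-strictly-above y x y∈O x∉I
                           (J.downward x y (proj₁ (strict⇒ le₁ x<y)) (proj₁ (proj₂ (O-maximal y y∈O)))) y<x

      -- Since `K` is invariant, it contains all of `O` or nothing of it, and `m` decides which.
      toggle : Between (K ⊕ O)
      toggle with T? (lookup K m)
      ... | yes m∈K = delete (O.least (_∈ K) (λ x → subst T (sym (K.invariant x)))
                                             (λ x → subst T (K.invariant x)) m∈K)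
      ... | no m∉K  = insert (O.least (λ x → ¬ x ∈ K) (λ x x∉K → x∉K ∘ subst T (K.invariant x))
                                                      (λ x gx∉K → gx∉K ∘ subst T (sym (K.invariant x))) m∉K)

    between? : ∀ K → Dec (Between K)
    between? K = step? le₂ I K ×-dec step? (flip le₂) K J

    χ-toggle : ∀ K → χ (between? (K ⊕ O)) ≡ χ (between? K)
    χ-toggle K = χ-⇔ (between? (K ⊕ O)) (between? K)
      (λ (a , b) → subst Between (⊕-involutive K O) (toggle a b)) (λ (a , b) → toggle a b)

  -- For good `I` inside good `J` the set `O` is chosen before `K`, so `K ↦ K ⊕ O` permutes all
  -- subsets. It preserves the two brackets and negates the sign. In the remaining cases no `K`
  -- admits both steps.
  ζ*εζ≡0 : ∀ I J → I ≢ J → ∑ (subsets n) (λ K → ε R K * (ζ le₂ I K * ζ (flip le₂) K J)) ≡ 0ℤ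
  ζ*εζ≡0 I J I≢J with good? I ×-dec good? J ×-dec (I ⊆? J)
  ... | no ¬p = ∑-≡0 (subsets n) (λ K → trans
          (cong (ε R K *_) (trans (sym (χ-× (step? le₂ I K) (step? (flip le₂) K J)))
            (χ-false (step? le₂ I K ×-dec step? (flip le₂) K J)
              (λ (a , b) → ¬p (Step.source a , Step.target b , λ x → Step.sub b x ∘ Step.sub a x)))))
          (ℤₚ.*-zeroʳ (ε R K)))
  ... | yes (goodI , goodJ , I⊆J) = x≡-x⇒x≡0 (begin
    ∑ (subsets n) f                              ≡⟨ sym (∑-⊕ O f) ⟩
    ∑ (subsets n) (f ∘ (_⊕ O))                   ≡⟨ ∑-cong (subsets n) f-⊕ ⟩
    ∑ (subsets n) (λ K → - f K)                  ≡⟨ sym (neg-distrib-∑ (subsets n) f) ⟩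
    - ∑ (subsets n) f                            ∎)
    where
    maximal = ∃-maximal I J I⊆J I≢J
    O = proj₁ (orbit (proj₁ maximal))
    open Toggle goodI goodJ (proj₂ maximal) (proj₁ (proj₂ (orbit (proj₁ maximal))))
    f : Vec Bool n → ℤ
    f K = ε R K * (ζ le₂ I K * ζ (flip le₂) K J)
    f-⊕ : ∀ K → f (K ⊕ O) ≡ - f K
    f-⊕ K = begin
      ε R (K ⊕ O) * (ζ le₂ I (K ⊕ O) * ζ (flip le₂) (K ⊕ O) J)
        ≡⟨ cong₂ _*_ (trans (ε-⊕ R K O) (cong (ε R K *_) (proj₂ (proj₂ (orbit (proj₁ maximal))))))
                     (trans (sym (χ-× (step? le₂ I (K ⊕ O)) (step? (flip le₂) (K ⊕ O) J)))
                       (trans (χ-toggle K) (χ-× (step? le₂ I K) (step? (flip le₂) K J)))) ⟩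
      ε R K * - 1ℤ * (ζ le₂ I K * ζ (flip le₂) K J)
        ≡⟨ move (ε R K) _ ⟩
      - f K ∎
      where
      move : ∀ a b → a * - 1ℤ * b ≡ - (a * b)
      move = solve-∀

-- Chains of steps with prescribed sizes

negOnePow-+ : ∀ a b → negOnePow (a ℕ.+ b) ≡ negOnePow a * negOnePow b
negOnePow-+ zero    b = sym (ℤₚ.*-identityˡ _)
negOnePow-+ (suc a) b = trans (cong -_ (negOnePow-+ a b)) (ℤₚ.neg-distribˡ-* (negOnePow a) (negOnePow b))

full : ∀ {n} → Vec Bool n → ℤ
full J = χ (J ≟ˢ ⊤)

module Chains {n} (le₁ : BRel n) (g : Permutation′ n) where
  open Steps le₁ g public

  sizedζ : BRel n → ℕ → Vec Bool n → Vec Bool n → ℤ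
  sizedζ le₂ a I J = χ (∣ J ∣ ℕ.≟ ∣ I ∣ ℕ.+ a) * ζ le₂ I J

  -- The sum of F over the ends of the chains of steps from I whose increments have sizes α.
  chain : BRel n → Composition → (Vec Bool n → ℤ) → Vec Bool n → ℤ
  chain le₂ []      F I = F I
  chain le₂ (a ∷ α) F I = ∑ (subsets n) (λ J → sizedζ le₂ a I J * chain le₂ α F J)

  -- The strictly increasing steps. On rows of good sets this is `ζ - 1`; elsewhere the diagonal
  -- entry of `ζ` is 0, since a step has good ends, and `ζ-split` therefore assumes `Good I`.
  η : BRel n → Vec Bool n → Vec Bool n → ℤ
  η le₂ I J = χ (¬? (J ≟ˢ I)) * ζ le₂ I J

  step-refl : ∀ {le₂ I} → Good I → Step le₂ I I
  step-refl G = record { sub = λ x p → p ; source = G ; target = G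
    ; noInversion = λ x y x∉I y∈I x<y _ → x∉I (Good.downward G x y (proj₁ (strict⇒ le₁ x<y)) y∈I) }

  ζ-split : ∀ le₂ {I} → Good I → ∀ J → ζ le₂ I J ≡ χ (J ≟ˢ I) + η le₂ I J
  ζ-split le₂ {I} G J with J ≟ˢ I
  ... | yes refl = χ-true (step? le₂ I I) (step-refl G)
  ... | no _     = sym (trans (ℤₚ.+-identityˡ _) (ℤₚ.*-identityˡ (ζ le₂ I J)))

  ∑-ζ-split : ∀ le₂ {I} → Good I → ∀ F →
    ∑ (subsets n) (λ J → ζ le₂ I J * F J) ≡ F I + ∑ (subsets n) (λ J → η le₂ I J * F J)
  ∑-ζ-split le₂ {I} G F = begin
    ∑ (subsets n) (λ J → ζ le₂ I J * F J)
      ≡⟨ ∑-cong (subsets n) (λ J → trans (cong (_* F J) (ζ-split le₂ G J)) (ℤₚ.*-distribʳ-+ (F J) (χ (J ≟ˢ I)) _)) ⟩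
    ∑ (subsets n) (λ J → χ (J ≟ˢ I) * F J + η le₂ I J * F J)
      ≡⟨ ∑-distrib-+ (subsets n) _ _ ⟩
    ∑ (subsets n) (λ J → χ (J ≟ˢ I) * F J) + ∑ (subsets n) (λ J → η le₂ I J * F J)
      ≡⟨ cong (λ z → z + ∑ (subsets n) (λ J → η le₂ I J * F J)) (∑-δ I F) ⟩
    F I + ∑ (subsets n) (λ J → η le₂ I J * F J) ∎

  -- Steps end in good sets, so identities known for good sets only may be used under the sum.
  sizedζ-cong : ∀ le₂ a {I J x y} → (Good J → x ≡ y) → sizedζ le₂ a I J * x ≡ sizedζ le₂ a I J * y
  sizedζ-cong le₂ a {I} {J} {x} {y} e = begin
    c * ζ le₂ I J * x      ≡⟨ ℤₚ.*-assoc c (ζ le₂ I J) x ⟩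
    c * (ζ le₂ I J * x)    ≡⟨ cong (c *_) (χ-*-cong (step? le₂ I J) (e ∘ Step.target)) ⟩
    c * (ζ le₂ I J * y)    ≡⟨ sym (ℤₚ.*-assoc c (ζ le₂ I J) y) ⟩
    c * ζ le₂ I J * y      ∎
    where c = χ (∣ J ∣ ℕ.≟ ∣ I ∣ ℕ.+ a)

  sizedζ-zero : ∀ le₂ {I} → Good I → ∀ J → sizedζ le₂ 0 I J ≡ χ (J ≟ˢ I)
  sizedζ-zero le₂ {I} G J = trans
    (sym (χ-× (∣ J ∣ ℕ.≟ ∣ I ∣ ℕ.+ 0) (step? le₂ I J)))
    (χ-⇔ ((∣ J ∣ ℕ.≟ ∣ I ∣ ℕ.+ 0) ×-dec step? le₂ I J) (J ≟ˢ I)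
      (λ (e , S) → sym (⊆∧∣∣≡⇒≡ I J (Step.sub S) (trans (sym (ℕₚ.+-identityʳ _)) (sym e))))
      (λ { refl → sym (ℕₚ.+-identityʳ _) , step-refl G }))

  chain-cong : ∀ le₂ α {F G : Vec Bool n → ℤ} → (∀ J → Good J → F J ≡ G J) →
               ∀ I → Good I → chain le₂ α F I ≡ chain le₂ α G I
  chain-cong le₂ []      e I G = e I G
  chain-cong le₂ (a ∷ α) e I _ = ∑-cong (subsets n) (λ J → sizedζ-cong le₂ a (chain-cong le₂ α e J))

  chain-++ : ∀ le₂ α β F I → chain le₂ (α ++ β) F I ≡ chain le₂ α (chain le₂ β F) I
  chain-++ le₂ []      β F I = refl
  chain-++ le₂ (a ∷ α) β F I = ∑-cong (subsets n) (λ J → cong (sizedζ le₂ a I J *_) (chain-++ le₂ α β F J))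

  chain-∑ : ∀ {A : Set} le₂ α (xs : List A) (w : A → ℤ) (F : A → Vec Bool n → ℤ) I →
    chain le₂ α (λ J → ∑ xs (λ x → w x * F x J)) I ≡ ∑ xs (λ x → w x * chain le₂ α (F x) I)
  chain-∑ le₂ []      xs w F I = refl
  chain-∑ le₂ (a ∷ α) xs w F I = begin
    ∑ (subsets n) (λ J → s J * chain le₂ α (λ K → ∑ xs (λ x → w x * F x K)) J)
      ≡⟨ ∑-cong (subsets n) (λ J → trans (cong (s J *_) (chain-∑ le₂ α xs w F J)) (*-distribˡ-∑ xs (s J) _)) ⟩
    ∑ (subsets n) (λ J → ∑ xs (λ x → s J * (w x * chain le₂ α (F x) J)))
      ≡⟨ ∑-swap (subsets n) xs _ ⟩
    ∑ xs (λ x → ∑ (subsets n) (λ J → s J * (w x * chain le₂ α (F x) J)))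
      ≡⟨ ∑-cong xs (λ x → trans (∑-cong (subsets n) (λ J → x∙yz≈y∙xz (s J) (w x) _)) (sym (*-distribˡ-∑ (subsets n) (w x) _))) ⟩
    ∑ xs (λ x → w x * ∑ (subsets n) (λ J → s J * chain le₂ α (F x) J)) ∎
    where
    s = sizedζ le₂ a I

  chain-scale : ∀ le₂ α c F {G : Vec Bool n → ℤ} → (∀ J → G J ≡ c * F J) → ∀ I →
                chain le₂ α G I ≡ c * chain le₂ α F I
  chain-scale le₂ []      c F e I = e I
  chain-scale le₂ (a ∷ α) c F e I = trans
    (∑-cong (subsets n) (λ J → trans (cong (sizedζ le₂ a I J *_) (chain-scale le₂ α c F e J))
                                     (x∙yz≈y∙xz (sizedζ le₂ a I J) c (chain le₂ α F J))))
    (sym (*-distribˡ-∑ (subsets n) c (λ J → sizedζ le₂ a I J * chain le₂ α F J)))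

-- The inverse of `ζ`, as a whole and by sizes

module Inversion {n} (le₁ le₂ : BRel n) (g : Permutation′ n) (R : Vec Bool n)
  (convolution : ∀ I J → I ≢ J →
    ∑ (subsets n) (λ K → ε R K * (Steps.ζ le₁ g le₂ I K * Steps.ζ le₁ g (flip le₂) K J)) ≡ 0ℤ)
  where
  open Chains le₁ g
  private
    Ss = subsets n
    ζ₊ = ζ le₂
    ζ₋ = ζ (flip le₂)

  convolution-diagonal : ∀ {I} → Good I → ∑ Ss (λ K → ε R K * (ζ₊ I K * ζ₋ K I)) ≡ ε R I
  convolution-diagonal {I} G = trans
    (∑-cong Ss (λ K → trans
      (cong (ε R K *_) (trans (sym (χ-× (step? le₂ I K) (step? (flip le₂) K I)))
        (χ-⇔ (step? le₂ I K ×-dec step? (flip le₂) K I) (K ≟ˢ I)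
          (λ (a , b) → ⊆-antisym (Step.sub b) (Step.sub a))
          (λ { refl → step-refl G , step-refl G }))))
      (ℤₚ.*-comm (ε R K) _)))
    (∑-δ I (ε R))

  -- The matrix identity `ζ ε ζ* = ε` applied to the vector `F`: off the diagonal it is the
  -- convolution hypothesis, and on the diagonal only `K = I` lies between `I` and `I`.
  ζ-inverse : ∀ I → Good I → (F : Vec Bool n → ℤ) →
    ∑ Ss (λ K → ζ₊ I K * (ε R K * ∑ Ss (λ J → ζ₋ K J * F J))) ≡ ε R I * F I
  ζ-inverse I G F = begin
    ∑ Ss (λ K → ζ₊ I K * (ε R K * ∑ Ss (λ J → ζ₋ K J * F J)))
      ≡⟨ ∑-cong Ss merge ⟩
    ∑ Ss (λ K → ∑ Ss (λ J → ε R K * (ζ₊ I K * ζ₋ K J) * F J))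
      ≡⟨ ∑-swap Ss Ss _ ⟩
    ∑ Ss (λ J → ∑ Ss (λ K → ε R K * (ζ₊ I K * ζ₋ K J) * F J))
      ≡⟨ ∑-cong Ss (λ J → trans (sym (*-distribʳ-∑ Ss (F J) (λ K → ε R K * (ζ₊ I K * ζ₋ K J)))) (evaluate J (J ≟ˢ I))) ⟩
    ∑ Ss (λ J → χ (J ≟ˢ I) * (ε R I * F J))
      ≡⟨ ∑-δ I (λ J → ε R I * F J) ⟩
    ε R I * F I ∎
    where
    regroup : ∀ a b c d → a * b * (c * d) ≡ b * (a * c) * d
    regroup = solve-∀
    merge : ∀ K → ζ₊ I K * (ε R K * ∑ Ss (λ J → ζ₋ K J * F J)) ≡ ∑ Ss (λ J → ε R K * (ζ₊ I K * ζ₋ K J) * F J)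
    merge K = begin
      ζ₊ I K * (ε R K * ∑ Ss (λ J → ζ₋ K J * F J))
        ≡⟨ sym (ℤₚ.*-assoc (ζ₊ I K) (ε R K) (∑ Ss (λ J → ζ₋ K J * F J))) ⟩
      ζ₊ I K * ε R K * ∑ Ss (λ J → ζ₋ K J * F J)
        ≡⟨ *-distribˡ-∑ Ss (ζ₊ I K * ε R K) (λ J → ζ₋ K J * F J) ⟩
      ∑ Ss (λ J → ζ₊ I K * ε R K * (ζ₋ K J * F J))
        ≡⟨ ∑-cong Ss (λ J → regroup (ζ₊ I K) (ε R K) (ζ₋ K J) (F J)) ⟩
      ∑ Ss (λ J → ε R K * (ζ₊ I K * ζ₋ K J) * F J) ∎
    evaluate : ∀ J (d : Dec (J ≡ I)) →
      ∑ Ss (λ K → ε R K * (ζ₊ I K * ζ₋ K J)) * F J ≡ χ d * (ε R I * F J)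
    evaluate J (yes refl) = trans (cong (_* F J) (convolution-diagonal G)) (sym (ℤₚ.*-identityˡ _))
    evaluate J (no J≢I)   = cong (_* F J) (convolution I J (J≢I ∘ sym))

  -- The part of total size `b` of the geometric series `1 - η + η² - …` applied to `F`; the number
  -- of parts of `α` is the exponent of `η`. Its counterpart `inverseStep` is the part of size `b`
  -- of `ε ζ* ε`.
  signedSum : ℕ → (Vec Bool n → ℤ) → Vec Bool n → ℤ
  signedSum b F I = ∑ (compositions b) (λ α → negOnePow (length α) * chain le₂ α F I)

  inverseStep : ℕ → (Vec Bool n → ℤ) → Vec Bool n → ℤ
  inverseStep b F I = ε R I * ∑ Ss (λ J → sizedζ (flip le₂) b I J * (ε R J * F J))

  -- Given `I`, `K` and `J`, at most one pair of sizes fits, and one fits exactly when the total is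
  -- right and the first size is positive. The `suc a` excludes `K = I` and thereby turns `ζ` into
  -- `η`.
  sizes-split : ∀ m I K J →
    ∑ (antidiagonal m) (λ (a , b) → sizedζ le₂ (suc a) I K * sizedζ (flip le₂) b K J)
      ≡ χ (∣ J ∣ ℕ.≟ ∣ I ∣ ℕ.+ suc m) * (η le₂ I K * ζ₋ K J)
  sizes-split m I K J with step? le₂ I K | step? (flip le₂) K J
  ... | no _  | d = trans
          (∑-≡0 (antidiagonal m) (λ (a , b) →
            cong (_* (χ (∣ J ∣ ℕ.≟ ∣ K ∣ ℕ.+ b) * χ d)) (ℤₚ.*-zeroʳ (χ (∣ K ∣ ℕ.≟ ∣ I ∣ ℕ.+ suc a)))))
          (sym (trans (cong (c *_) (cong (_* χ d) (ℤₚ.*-zeroʳ (χ (¬? (K ≟ˢ I)))))) (ℤₚ.*-zeroʳ c)))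
    where c = χ (∣ J ∣ ℕ.≟ ∣ I ∣ ℕ.+ suc m)
  ... | yes p | no _  = trans
          (∑-≡0 (antidiagonal m) (λ (a , b) →
            let s = χ (∣ K ∣ ℕ.≟ ∣ I ∣ ℕ.+ suc a) * 1ℤ in
            trans (cong (s *_) (ℤₚ.*-zeroʳ (χ (∣ J ∣ ℕ.≟ ∣ K ∣ ℕ.+ b)))) (ℤₚ.*-zeroʳ s)))
          (sym (trans (cong (c *_) (ℤₚ.*-zeroʳ (χ (¬? (K ≟ˢ I)) * 1ℤ))) (ℤₚ.*-zeroʳ c)))
    where c = χ (∣ J ∣ ℕ.≟ ∣ I ∣ ℕ.+ suc m)
  ... | yes p | yes q = trans
          (∑-cong (antidiagonal m) (λ (a , b) → cong₂ _*_
            (ℤₚ.*-identityʳ (χ (∣ K ∣ ℕ.≟ ∣ I ∣ ℕ.+ suc a))) (ℤₚ.*-identityʳ (χ (∣ J ∣ ℕ.≟ ∣ K ∣ ℕ.+ b)))))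
          (trans (count-sizes (K ≟ˢ I))
            (cong (χ (∣ J ∣ ℕ.≟ ∣ I ∣ ℕ.+ suc m) *_)
              (sym (trans (ℤₚ.*-identityʳ (χ (¬? (K ≟ˢ I)) * 1ℤ)) (ℤₚ.*-identityʳ (χ (¬? (K ≟ˢ I))))))))
    where
    count-sizes : (d : Dec (K ≡ I)) →
      ∑ (antidiagonal m) (λ (a , b) → χ (∣ K ∣ ℕ.≟ ∣ I ∣ ℕ.+ suc a) * χ (∣ J ∣ ℕ.≟ ∣ K ∣ ℕ.+ b))
        ≡ χ (∣ J ∣ ℕ.≟ ∣ I ∣ ℕ.+ suc m) * χ (¬? d)
    count-sizes (yes refl) = trans
      (∑-≡0 (antidiagonal m) (λ (a , b) → cong (_* χ (∣ J ∣ ℕ.≟ ∣ K ∣ ℕ.+ b))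
        (χ-false (∣ K ∣ ℕ.≟ ∣ K ∣ ℕ.+ suc a) (λ e → ℕₚ.m≢1+m+n ∣ K ∣ (trans e (ℕₚ.+-suc ∣ K ∣ a))))))
      (sym (ℤₚ.*-zeroʳ (χ (∣ J ∣ ℕ.≟ ∣ K ∣ ℕ.+ suc m))))
    count-sizes (no K≢I) = begin
      ∑ (antidiagonal m) (λ (a , b) → χ (∣ K ∣ ℕ.≟ ∣ I ∣ ℕ.+ suc a) * χ (∣ J ∣ ℕ.≟ ∣ K ∣ ℕ.+ b))
        ≡⟨ ∑-cong (antidiagonal m) (λ (a , b) → cong₂ _*_
             (χ-⇔ (∣ K ∣ ℕ.≟ ∣ I ∣ ℕ.+ suc a) (a₀ ℕ.≟ a)
               (λ e → ℕₚ.suc-injective (ℕₚ.+-cancelˡ-≡ ∣ I ∣ _ _ (trans (sym eK) e)))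
               (λ { refl → eK }))
             (χ-⇔ (∣ J ∣ ℕ.≟ ∣ K ∣ ℕ.+ b) (b₀ ℕ.≟ b)
               (λ e → ℕₚ.+-cancelˡ-≡ ∣ K ∣ _ _ (trans (sym eJ) e))
               (λ { refl → eJ }))) ⟩
      ∑ (antidiagonal m) (λ (a , b) → χ (a₀ ℕ.≟ a) * χ (b₀ ℕ.≟ b))
        ≡⟨ ∑-antidiagonal-δ m a₀ b₀ ⟩
      χ (a₀ ℕ.+ b₀ ℕ.≟ m)
        ≡⟨ χ-⇔ (a₀ ℕ.+ b₀ ℕ.≟ m) (∣ J ∣ ℕ.≟ ∣ I ∣ ℕ.+ suc m)
             (λ { refl → total })
             (λ e → ℕₚ.suc-injective (ℕₚ.+-cancelˡ-≡ ∣ I ∣ _ _ (trans (sym total) e))) ⟩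
      χ (∣ J ∣ ℕ.≟ ∣ I ∣ ℕ.+ suc m)
        ≡⟨ sym (ℤₚ.*-identityʳ _) ⟩
      χ (∣ J ∣ ℕ.≟ ∣ I ∣ ℕ.+ suc m) * 1ℤ ∎
      where
      I<K = ℕₚ.≤∧≢⇒< (⊆⇒∣∣≤ I K (Step.sub p)) (K≢I ∘ sym ∘ ⊆∧∣∣≡⇒≡ I K (Step.sub p))
      a₀ = ∣ K ∣ ℕ.∸ suc ∣ I ∣
      b₀ = ∣ J ∣ ℕ.∸ ∣ K ∣
      eK : ∣ K ∣ ≡ ∣ I ∣ ℕ.+ suc a₀
      eK = trans (sym (ℕₚ.m+[n∸m]≡n I<K)) (sym (ℕₚ.+-suc ∣ I ∣ a₀))
      eJ : ∣ J ∣ ≡ ∣ K ∣ ℕ.+ b₀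
      eJ = sym (ℕₚ.m+[n∸m]≡n (⊆⇒∣∣≤ K J (Step.sub q)))
      total : ∣ J ∣ ≡ ∣ I ∣ ℕ.+ suc (a₀ ℕ.+ b₀)
      total = trans eJ (trans (cong (ℕ._+ b₀) eK) (ℕₚ.+-assoc ∣ I ∣ (suc a₀) b₀))

  -- The vanishing convolution with its summand `K = I` moved to the other side.
  η-convolution : ∀ {I J} → Good I → I ≢ J →
    ∑ Ss (λ K → η le₂ I K * (ε R K * ζ₋ K J)) ≡ - (ε R I * ζ₋ I J)
  η-convolution {I} {J} G I≢J = begin
    h                          ≡⟨ isolate (ε R I * ζ₋ I J) h ⟩
    (e + h) + - e              ≡⟨ cong (_+ - e) (sym (∑-ζ-split le₂ G (λ K → ε R K * ζ₋ K J))) ⟩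
    ∑ Ss (λ K → ζ₊ I K * (ε R K * ζ₋ K J)) + - e
      ≡⟨ cong (_+ - e) (trans (∑-cong Ss (λ K → x∙yz≈y∙xz (ζ₊ I K) (ε R K) (ζ₋ K J))) (convolution I J I≢J)) ⟩
    0ℤ + - e                   ≡⟨ ℤₚ.+-identityˡ _ ⟩
    - e                        ∎
    where
    e = ε R I * ζ₋ I J
    h = ∑ Ss (λ K → η le₂ I K * (ε R K * ζ₋ K J))
    isolate : ∀ e h → h ≡ (e + h) + - e
    isolate = solve-∀

  -- Both sides satisfy the recursion `X = 1 - η X`: on the left by splitting off the first step,
  -- which changes the sign, and on the right by `η-convolution`. The first step has positive size
  -- and may leave any smaller one, so the induction is strong, with `N` as its bound.
  signedSum≡inverseStep : ∀ b F I → Good I → signedSum b F I ≡ inverseStep b F I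
  signedSum≡inverseStep b F = bounded b b ℕₚ.≤-refl
    where
    bounded : ∀ N b → b ℕ.≤ N → ∀ I → Good I → signedSum b F I ≡ inverseStep b F I
    bounded N zero _ I G = begin
      1ℤ * F I + 0ℤ
        ≡⟨ trans (ℤₚ.+-identityʳ _) (cong (_* F I) (sym (ε-square R I))) ⟩
      ε R I * ε R I * F I
        ≡⟨ ℤₚ.*-assoc (ε R I) (ε R I) (F I) ⟩
      ε R I * (ε R I * F I)
        ≡⟨ cong (ε R I *_) (sym (∑-δ I (λ J → ε R J * F J))) ⟩
      ε R I * ∑ Ss (λ J → χ (J ≟ˢ I) * (ε R J * F J))
        ≡⟨ cong (ε R I *_) (∑-cong Ss (λ J → cong (_* (ε R J * F J)) (sym (sizedζ-zero (flip le₂) G J)))) ⟩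
      inverseStep zero F I ∎
    bounded (suc N) (suc m) (s≤s m≤N) I G = begin
      signedSum (suc m) F I
        ≡⟨ ∑-compositions-head m _ ⟩
      ∑ ad (λ (a , b) → ∑ (compositions b) (λ α →
        - negOnePow (length α) * ∑ Ss (λ K → sizedζ le₂ (suc a) I K * chain le₂ α F K)))
        ≡⟨ ∑-cong-All (All.map (λ {ab} e → first-step (proj₁ ab) (proj₂ ab) e) (antidiagonal-sound m)) ⟩
      ∑ ad (λ (a , b) → ∑ Ss (λ K → ∑ Ss (λ J → t a b K J)))
        ≡⟨ ∑-swap ad Ss _ ⟩
      ∑ Ss (λ K → ∑ ad (λ (a , b) → ∑ Ss (λ J → t a b K J)))
        ≡⟨ ∑-cong Ss (λ K → ∑-swap ad Ss _) ⟩
      ∑ Ss (λ K → ∑ Ss (λ J → ∑ ad (λ (a , b) → t a b K J)))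
        ≡⟨ ∑-cong Ss (λ K → ∑-cong Ss (λ J → trans (sym (*-distribʳ-∑ ad (w K J)
               (λ (a , b) → sizedζ le₂ (suc a) I K * sizedζ (flip le₂) b K J)))
             (cong (_* w K J) (sizes-split m I K J)))) ⟩
      ∑ Ss (λ K → ∑ Ss (λ J → c J * (η le₂ I K * ζ₋ K J) * w K J))
        ≡⟨ ∑-swap Ss Ss _ ⟩
      ∑ Ss (λ J → ∑ Ss (λ K → c J * (η le₂ I K * ζ₋ K J) * w K J))
        ≡⟨ ∑-cong Ss collect ⟩
      ∑ Ss (λ J → ε R I * (sizedζ (flip le₂) (suc m) I J * (ε R J * F J)))
        ≡⟨ sym (*-distribˡ-∑ Ss (ε R I) _) ⟩
      inverseStep (suc m) F I ∎
      where
      ad = antidiagonal m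
      c : Vec Bool n → ℤ
      c J = χ (∣ J ∣ ℕ.≟ ∣ I ∣ ℕ.+ suc m)
      w : Vec Bool n → Vec Bool n → ℤ
      w K J = - (ε R K * (ε R J * F J))
      t : ℕ → ℕ → Vec Bool n → Vec Bool n → ℤ
      t a b K J = sizedζ le₂ (suc a) I K * sizedζ (flip le₂) b K J * w K J

      first-step : ∀ a b → a ℕ.+ b ≡ m →
        ∑ (compositions b) (λ α → - negOnePow (length α) * ∑ Ss (λ K → sizedζ le₂ (suc a) I K * chain le₂ α F K))
          ≡ ∑ Ss (λ K → ∑ Ss (λ J → t a b K J))
      first-step a b refl = begin
        ∑ (compositions b) (λ α → - negOnePow (length α) * ∑ Ss (λ K → sizedζ le₂ (suc a) I K * chain le₂ α F K))
          ≡⟨ ∑-cong (compositions b) (λ α → *-distribˡ-∑ Ss (- negOnePow (length α)) _) ⟩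
        ∑ (compositions b) (λ α → ∑ Ss (λ K → - negOnePow (length α) * (sizedζ le₂ (suc a) I K * chain le₂ α F K)))
          ≡⟨ ∑-swap (compositions b) Ss _ ⟩
        ∑ Ss (λ K → ∑ (compositions b) (λ α → - negOnePow (length α) * (sizedζ le₂ (suc a) I K * chain le₂ α F K)))
          ≡⟨ ∑-cong Ss (λ K → trans
               (∑-cong (compositions b) (λ α → move (negOnePow (length α)) (sizedζ le₂ (suc a) I K) _))
               (sym (*-distribˡ-∑ (compositions b) (- sizedζ le₂ (suc a) I K) _))) ⟩
        ∑ Ss (λ K → - sizedζ le₂ (suc a) I K * signedSum b F K)
          ≡⟨ ∑-cong Ss (λ K → trans (sym (ℤₚ.neg-distribˡ-* (sizedζ le₂ (suc a) I K) _)) (trans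
               (cong -_ (sizedζ-cong le₂ (suc a) (bounded N b (ℕₚ.≤-trans (ℕₚ.m≤n+m b a) m≤N) K)))
               (expand (sizedζ le₂ (suc a) I K) (ε R K) _))) ⟩
        ∑ Ss (λ K → - (sizedζ le₂ (suc a) I K * ε R K) * ∑ Ss (λ J → sizedζ (flip le₂) b K J * (ε R J * F J)))
          ≡⟨ ∑-cong Ss (λ K → trans (*-distribˡ-∑ Ss (- (sizedζ le₂ (suc a) I K * ε R K)) _)
               (∑-cong Ss (λ J → regroup (sizedζ le₂ (suc a) I K) (ε R K) (sizedζ (flip le₂) b K J) (ε R J * F J)))) ⟩
        ∑ Ss (λ K → ∑ Ss (λ J → t a b K J)) ∎
        where
        move : ∀ x y z → - x * (y * z) ≡ - y * (x * z)
        move = solve-∀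
        expand : ∀ x y z → - (x * (y * z)) ≡ - (x * y) * z
        expand = solve-∀
        regroup : ∀ x y z u → - (x * y) * (z * u) ≡ x * z * - (y * u)
        regroup = solve-∀

      collect : ∀ J → ∑ Ss (λ K → c J * (η le₂ I K * ζ₋ K J) * w K J)
                    ≡ ε R I * (sizedζ (flip le₂) (suc m) I J * (ε R J * F J))
      collect J = begin
        ∑ Ss (λ K → c J * (η le₂ I K * ζ₋ K J) * w K J)
          ≡⟨ ∑-cong Ss (λ K → factor (c J) (η le₂ I K) (ζ₋ K J) (ε R K) (ε R J * F J)) ⟩
        ∑ Ss (λ K → c J * - (ε R J * F J) * (η le₂ I K * (ε R K * ζ₋ K J)))
          ≡⟨ sym (*-distribˡ-∑ Ss (c J * - (ε R J * F J)) _) ⟩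
        c J * - (ε R J * F J) * ∑ Ss (λ K → η le₂ I K * (ε R K * ζ₋ K J))
          ≡⟨ ℤₚ.*-assoc (c J) (- (ε R J * F J)) _ ⟩
        c J * (- (ε R J * F J) * ∑ Ss (λ K → η le₂ I K * (ε R K * ζ₋ K J)))
          -- The bracket `c J` forces `J` to be larger than `I`, so the off-diagonal identity
          -- applies.
          ≡⟨ χ-*-cong (∣ J ∣ ℕ.≟ ∣ I ∣ ℕ.+ suc m) (λ e → cong (- (ε R J * F J) *_)
               (η-convolution G (λ { refl → ℕₚ.m≢1+m+n ∣ I ∣ (trans e (ℕₚ.+-suc ∣ I ∣ m)) }))) ⟩
        c J * (- (ε R J * F J) * - (ε R I * ζ₋ I J))
          ≡⟨ finish (c J) (ε R J * F J) (ε R I) (ζ₋ I J) ⟩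
        ε R I * (c J * ζ₋ I J * (ε R J * F J)) ∎
        where
        factor : ∀ c h z e f → c * (h * z) * - (e * f) ≡ c * - f * (h * (e * z))
        factor = solve-∀
        finish : ∀ c f e z → c * (- f * - (e * z)) ≡ e * (c * z * f)
        finish = solve-∀

  -- A refinement of `γ` is a sequence of compositions of its parts. Each part contributes one
  -- factor `ε ζ* ε` of its size; the signs between neighbouring factors cancel, and only those at
  -- the two ends remain.
  signedSum-refinements : ∀ m γ → IsComposition m γ → ∀ F I → Good I →
    ∑ᶜ-refinements m γ (λ α → negOnePow (length α) * chain le₂ α F I)
      ≡ ε R I * chain (flip le₂) γ (λ J → ε R J * F J) I
  signedSum-refinements .0 [] (_ , refl) F I G = begin
    1ℤ * (1ℤ * F I) + 0ℤ       ≡⟨ trans (ℤₚ.+-identityʳ _) (ℤₚ.*-identityˡ (1ℤ * F I)) ⟩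
    1ℤ * F I                   ≡⟨ cong (_* F I) (sym (ε-square R I)) ⟩
    ε R I * ε R I * F I        ≡⟨ ℤₚ.*-assoc (ε R I) (ε R I) (F I) ⟩
    ε R I * (ε R I * F I)      ∎
  signedSum-refinements _ (zero ∷ γ) (() ∷ _ , _) F I G
  signedSum-refinements .(suc c ℕ.+ sum γ) (suc c ∷ γ) (_ ∷ p , refl) F I G = begin
    ∑ᶜ-refinements (suc c ℕ.+ m) (suc c ∷ γ) (λ α → negOnePow (length α) * chain le₂ α F I)
      ≡⟨ ∑-refinements-∷ c m γ _ ⟩
    ∑ (compositions (suc c)) (λ α′ → ∑ᶜ-refinements m γ (λ α →
      negOnePow (length (α′ ++ α)) * chain le₂ (α′ ++ α) F I))
      ≡⟨ ∑-cong (compositions (suc c)) tail-sum ⟩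
    signedSum (suc c) (λ K → ε R K * G′ K) I
      ≡⟨ signedSum≡inverseStep (suc c) _ I G ⟩
    ε R I * ∑ Ss (λ J → sizedζ (flip le₂) (suc c) I J * (ε R J * (ε R J * G′ J)))
      ≡⟨ cong (ε R I *_) (∑-cong Ss (λ J → cong (sizedζ (flip le₂) (suc c) I J *_)
           (trans (sym (ℤₚ.*-assoc (ε R J) (ε R J) (G′ J)))
                  (trans (cong (_* G′ J) (ε-square R J)) (ℤₚ.*-identityˡ (G′ J)))))) ⟩
    ε R I * chain (flip le₂) (suc c ∷ γ) (λ J → ε R J * F J) I ∎
    where
    m = sum γ
    G′ = chain (flip le₂) γ (λ J → ε R J * F J)
    tail-sum : ∀ α′ → ∑ᶜ-refinements m γ (λ α → negOnePow (length (α′ ++ α)) * chain le₂ (α′ ++ α) F I)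
                    ≡ negOnePow (length α′) * chain le₂ α′ (λ K → ε R K * G′ K) I
    tail-sum α′ = begin
      ∑ (compositions m) (λ α → refinements α γ * (negOnePow (length (α′ ++ α)) * chain le₂ (α′ ++ α) F I))
        ≡⟨ ∑-cong (compositions m) (λ α → trans
             (cong (refinements α γ *_) (cong₂ _*_
               (trans (cong negOnePow (Listₚ.length-++ α′)) (negOnePow-+ (length α′) (length α)))
               (chain-++ le₂ α′ α F I)))
             (regroup (refinements α γ) (negOnePow (length α′)) (negOnePow (length α)) _)) ⟩
      ∑ (compositions m) (λ α → negOnePow (length α′) *
        (refinements α γ * negOnePow (length α) * chain le₂ α′ (chain le₂ α F) I))
        ≡⟨ sym (*-distribˡ-∑ (compositions m) (negOnePow (length α′)) _) ⟩
      negOnePow (length α′) *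
        ∑ (compositions m) (λ α → refinements α γ * negOnePow (length α) * chain le₂ α′ (chain le₂ α F) I)
        ≡⟨ cong (negOnePow (length α′) *_) (sym (chain-∑ le₂ α′ (compositions m)
             (λ α → refinements α γ * negOnePow (length α)) (λ α → chain le₂ α F) I)) ⟩
      negOnePow (length α′) * chain le₂ α′ (λ K →
        ∑ (compositions m) (λ α → refinements α γ * negOnePow (length α) * chain le₂ α F K)) I
        ≡⟨ cong (negOnePow (length α′) *_) (chain-cong le₂ α′ (λ K GK → trans
             (∑-cong (compositions m) (λ α → ℤₚ.*-assoc (refinements α γ) (negOnePow (length α)) _))
             (signedSum-refinements m γ (p , refl) F K GK)) I G) ⟩
      negOnePow (length α′) * chain le₂ α′ (λ K → ε R K * G′ K) I ∎
      where
      regroup : ∀ a b c d → a * (b * c * d) ≡ b * (a * c * d)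
      regroup = solve-∀

-- Partitions as chains of subsets

-- The vectors over {0,…,k} whose zeros are exactly the elements of I.
fillings : ∀ {n} → ℕ → Vec Bool n → List (Vec ℕ n)
fillings k []          = [] ∷ []
fillings k (true  ∷ I) = map (0 ∷_) (fillings k I)
fillings k (false ∷ I) = concatMap (λ c → map (suc (toℕ c) ∷_) (fillings k I)) (allFin k)

ZerosAt : ∀ {n} → Vec Bool n → Vec ℕ n → Set
ZerosAt I u = ∀ x → (lookup u x ≡ 0 → x ∈ I) × (x ∈ I → lookup u x ≡ 0)

fillings-sound : ∀ {n} k (I : Vec Bool n) → All (ZerosAt I) (fillings k I)
fillings-sound k []          = (λ ()) ∷ []
fillings-sound k (true  ∷ I) = Allₚ.map⁺ (All.map
  (λ z → λ { zero → (λ _ → tt) , (λ _ → refl) ; (suc x) → z x }) (fillings-sound k I))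
fillings-sound k (false ∷ I) = Allₚ.concat⁺ (Allₚ.map⁺ (All.universal (λ c → Allₚ.map⁺ (All.map
  (λ z → λ { zero → (λ ()) , (λ ()) ; (suc x) → z x }) (fillings-sound k I))) (allFin k)))

-- Prepends a smallest fibre, taken out of the zeros of u: its elements get the value 1.
expand : ∀ {n} → Vec Bool n → Vec ℕ n → Vec ℕ n
expand = Vec.zipWith (λ b x → if b then 0 else suc x)

∑-allMaps : ∀ k n (F : Vec ℕ n → ℤ) →
  ∑ (allMaps k n) (F ∘ Vec.map (suc ∘ toℕ)) ≡ ∑ (fillings k ⊥) F
∑-allMaps k zero    F = refl
∑-allMaps k (suc n) F = begin
  ∑ (allMaps k (suc n)) (F ∘ Vec.map (suc ∘ toℕ))
    ≡⟨ ∑-concatMap _ (allFin k) _ ⟩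
  ∑ (allFin k) (λ c → ∑ (map (c ∷_) (allMaps k n)) (F ∘ Vec.map (suc ∘ toℕ)))
    ≡⟨ ∑-cong (allFin k) (λ c → begin
         ∑ (map (c ∷_) (allMaps k n)) (F ∘ Vec.map (suc ∘ toℕ))
           ≡⟨ ∑-map (c ∷_) (allMaps k n) _ ⟩
         ∑ (allMaps k n) (λ v → F (suc (toℕ c) ∷ Vec.map (suc ∘ toℕ) v))
           ≡⟨ ∑-allMaps k n (λ u → F (suc (toℕ c) ∷ u)) ⟩
         ∑ (fillings k ⊥) (λ u → F (suc (toℕ c) ∷ u))
           ≡⟨ sym (∑-map (suc (toℕ c) ∷_) (fillings k ⊥) F) ⟩
         ∑ (map (suc (toℕ c) ∷_) (fillings k ⊥)) F ∎) ⟩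
  ∑ (allFin k) (λ c → ∑ (map (suc (toℕ c) ∷_) (fillings k ⊥)) F)
    ≡⟨ sym (∑-concatMap _ (allFin k) F) ⟩
  ∑ (fillings k (⊥ {suc n})) F ∎

∑-fillings-zero : ∀ {n} (I : Vec Bool n) (F : Vec ℕ n → ℤ) →
  ∑ (fillings 0 I) F ≡ χ (I ≟ˢ ⊤) * F (Vec.replicate n 0)
∑-fillings-zero []          F = trans (ℤₚ.+-identityʳ _) (sym (ℤₚ.*-identityˡ (F [])))
∑-fillings-zero {suc n} (true ∷ I) F = begin
  ∑ (map (0 ∷_) (fillings 0 I)) F                  ≡⟨ ∑-map (0 ∷_) (fillings 0 I) F ⟩
  ∑ (fillings 0 I) (F ∘ (0 ∷_))                    ≡⟨ ∑-fillings-zero I (F ∘ (0 ∷_)) ⟩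
  χ (I ≟ˢ ⊤) * F (Vec.replicate (suc n) 0)         ≡⟨ cong (_* F (Vec.replicate (suc n) 0))
      (χ-⇔ (I ≟ˢ ⊤) (true ∷ I ≟ˢ ⊤) (cong (true ∷_)) (proj₂ ∘ Vecₚ.∷-injective)) ⟩
  χ (true ∷ I ≟ˢ ⊤) * F (Vec.replicate (suc n) 0)  ∎
∑-fillings-zero {suc n} (false ∷ I) F =
  sym (cong (_* F (Vec.replicate (suc n) 0)) (χ-false (false ∷ I ≟ˢ ⊤) (λ ())))

-- `J` collects the positions with value 0 or 1. Lowering every positive value by one leaves a
-- filling with zeros exactly at `J`, and `expand I` recovers the original.
∑-fillings-suc : ∀ {n} k (I : Vec Bool n) (F : Vec ℕ n → ℤ) →
  ∑ (fillings (suc k) I) F ≡ ∑ (subsets n) (λ J → χ (I ⊆? J) * ∑ (fillings k J) (F ∘ expand I))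
∑-fillings-suc k [] F = sym (trans (ℤₚ.+-identityʳ _) (ℤₚ.*-identityˡ _))
∑-fillings-suc {suc n} k (true ∷ I) F = begin
  ∑ (map (0 ∷_) (fillings (suc k) I)) F
    ≡⟨ ∑-map (0 ∷_) (fillings (suc k) I) F ⟩
  ∑ (fillings (suc k) I) (F ∘ (0 ∷_))
    ≡⟨ ∑-fillings-suc k I (F ∘ (0 ∷_)) ⟩
  ∑ (subsets n) (λ J → χ (I ⊆? J) * ∑ (fillings k J) (λ u → F (0 ∷ expand I u)))
    ≡⟨ ∑-cong (subsets n) (λ J → cong₂ _*_
         (χ-⇔ (I ⊆? J) (true ∷ I ⊆? true ∷ J) (⊆-cons id) ⊆-tail)
         (sym (∑-map (0 ∷_) (fillings k J) _))) ⟩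
  ∑ (subsets n) (λ J → χ (true ∷ I ⊆? true ∷ J) * ∑ (fillings k (true ∷ J)) (F ∘ expand (true ∷ I)))
    ≡⟨ trans (sym (ℤₚ.+-identityʳ _)) (cong (_+_ (∑ (subsets n) (λ J →
         χ (true ∷ I ⊆? true ∷ J) * ∑ (fillings k (true ∷ J)) (F ∘ expand (true ∷ I)))))
         (sym (∑-≡0 (subsets n) (λ J → cong (_* ∑ (fillings k (false ∷ J)) (F ∘ expand (true ∷ I)))
           (χ-false (true ∷ I ⊆? false ∷ J) (λ s → s zero tt)))))) ⟩
  ∑ (subsets n) (λ J → χ (true ∷ I ⊆? true ∷ J) * ∑ (fillings k (true ∷ J)) (F ∘ expand (true ∷ I)))
    + ∑ (subsets n) (λ J → χ (true ∷ I ⊆? false ∷ J) * ∑ (fillings k (false ∷ J)) (F ∘ expand (true ∷ I)))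
    ≡⟨ sym (∑-subsets-suc n _) ⟩
  ∑ (subsets (suc n)) (λ J → χ (true ∷ I ⊆? J) * ∑ (fillings k J) (F ∘ expand (true ∷ I))) ∎
∑-fillings-suc {suc n} k (false ∷ I) F = begin
  ∑ (fillings (suc k) (false ∷ I)) F
    ≡⟨ ∑-concatMap (λ c → map (suc (toℕ c) ∷_) (fillings (suc k) I)) (allFin (suc k)) F ⟩
  ∑ (allFin (suc k)) (λ c → ∑ (map (suc (toℕ c) ∷_) (fillings (suc k) I)) F)
    ≡⟨ ∑-cong (allFin (suc k)) {g = s ∘ toℕ} (λ c → trans (∑-map (suc (toℕ c) ∷_) (fillings (suc k) I) F)
         (∑-fillings-suc k I (λ u → F (suc (toℕ c) ∷ u)))) ⟩
  ∑ (allFin (suc k)) (s ∘ toℕ)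
    ≡⟨ ∑-allFin-suc k (s ∘ toℕ) ⟩
  s 0 + ∑ (allFin k) (λ c → s (suc (toℕ c)))
    ≡⟨ cong₂ _+_
         (∑-cong (subsets n) (λ J → cong₂ _*_
           (χ-⇔ (I ⊆? J) (false ∷ I ⊆? true ∷ J) (⊆-cons (λ ())) ⊆-tail)
           (sym (∑-map (0 ∷_) (fillings k J) _))))
         (trans (∑-swap (allFin k) (subsets n) _) (∑-cong (subsets n) (λ J → trans
           (sym (*-distribˡ-∑ (allFin k) (w J) (λ c → ∑ (fillings k J) (λ u → F (suc (suc (toℕ c)) ∷ expand I u)))))
           (cong₂ _*_
             (χ-⇔ (I ⊆? J) (false ∷ I ⊆? false ∷ J) (⊆-cons (λ ())) ⊆-tail)
             (sym (trans (∑-concatMap _ (allFin k) (F ∘ expand (false ∷ I)))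
               (∑-cong (allFin k) (λ c → ∑-map (suc (toℕ c) ∷_) (fillings k J) _)))))))) ⟩
  ∑ (subsets n) (λ J → χ (false ∷ I ⊆? true ∷ J) * ∑ (fillings k (true ∷ J)) (F ∘ expand (false ∷ I)))
    + ∑ (subsets n) (λ J → χ (false ∷ I ⊆? false ∷ J) * ∑ (fillings k (false ∷ J)) (F ∘ expand (false ∷ I)))
    ≡⟨ sym (∑-subsets-suc n _) ⟩
  ∑ (subsets (suc n)) (λ J → χ (false ∷ I ⊆? J) * ∑ (fillings k J) (F ∘ expand (false ∷ I))) ∎
  where
  w : Vec Bool n → ℤ
  w J = χ (I ⊆? J)
  s : ℕ → ℤ
  s c = ∑ (subsets n) (λ J → w J * ∑ (fillings k J) (λ u → F (suc c ∷ expand I u)))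

-- Counting starts at the value 1, because zeros mark the elements whose fibres have been removed.
valueCounts : ∀ {n} → ℕ → Vec ℕ n → List ℕ
valueCounts k u = map (λ c → Vec.count (ℕ._≟ suc (toℕ c)) u) (allFin k)

map-allFin-suc : ∀ {A : Set} n (f : Fin (suc n) → A) →
                 map f (allFin (suc n)) ≡ f zero ∷ map (f ∘ suc) (allFin n)
map-allFin-suc n f = cong (f zero ∷_)
  (trans (Listₚ.map-tabulate suc f) (sym (Listₚ.map-tabulate id (f ∘ suc))))

fiberSizes≡valueCounts : ∀ {k n} (v : Vec (Fin k) n) → fiberSizes v ≡ valueCounts k (Vec.map (suc ∘ toℕ) v)
fiberSizes≡valueCounts {k} v = Listₚ.map-cong (λ c → same c v) (allFin k)
  where
  same : ∀ {n} c (v : Vec (Fin k) n) →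
    count (λ x → does (x Fin.≟ c)) (Vec.toList v) ≡ Vec.count (ℕ._≟ suc (toℕ c)) (Vec.map (suc ∘ toℕ) v)
  same c [] = refl
  same c (x ∷ v) with x Fin.≟ c | toℕ x ℕ.≡ᵇ toℕ c in eq
  ... | yes _    | true  = cong suc (same c v)
  ... | no _     | false = same c v
  ... | yes refl | false = ⊥-elim (subst T eq (ℕₚ.≡⇒≡ᵇ (toℕ c) (toℕ c) refl))
  ... | no x≢c   | true  =
          ⊥-elim (x≢c (Finₚ.toℕ-injective (ℕₚ.≡ᵇ⇒≡ (toℕ x) (toℕ c) (subst T (sym eq) tt))))

ZerosAt-tail : ∀ {n b x} {J : Vec Bool n} {u} → ZerosAt (b ∷ J) (x ∷ u) → ZerosAt J u
ZerosAt-tail z y = z (suc y)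

-- The positions that receive the value 1 are those of `J` outside `I`, so the first fibre has the
-- size of the first step.
count-one-expand : ∀ {n} (I J : Vec Bool n) u → I ⊆ J → ZerosAt J u →
                   ∣ I ∣ ℕ.+ Vec.count (ℕ._≟ 1) (expand I u) ≡ ∣ J ∣
count-one-expand []          []          []          s z = refl
count-one-expand (true  ∷ I) (true  ∷ J) (x ∷ u)     s z =
  cong suc (count-one-expand I J u (⊆-tail s) (ZerosAt-tail z))
count-one-expand (true  ∷ I) (false ∷ J) (x ∷ u)     s z = ⊥-elim (s zero tt)
count-one-expand (false ∷ I) (true  ∷ J) (zero  ∷ u) s z =
  trans (ℕₚ.+-suc ∣ I ∣ _) (cong suc (count-one-expand I J u (⊆-tail s) (ZerosAt-tail z)))
count-one-expand (false ∷ I) (true  ∷ J) (suc x ∷ u) s z = case proj₂ (z zero) tt of λ ()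
count-one-expand (false ∷ I) (false ∷ J) (zero  ∷ u) s z = ⊥-elim (proj₁ (z zero) refl)
count-one-expand (false ∷ I) (false ∷ J) (suc x ∷ u) s z =
  count-one-expand I J u (⊆-tail s) (ZerosAt-tail z)

count-suc-expand : ∀ {n} c (I J : Vec Bool n) u → I ⊆ J → ZerosAt J u →
                   Vec.count (ℕ._≟ suc (suc c)) (expand I u) ≡ Vec.count (ℕ._≟ suc c) u
count-suc-expand c []          []      []      s z = refl
count-suc-expand c (false ∷ I) (b ∷ J) (x ∷ u) s z with x ℕ.≡ᵇ suc c
... | true  = cong suc (count-suc-expand c I J u (⊆-tail s) (ZerosAt-tail z))
... | false = count-suc-expand c I J u (⊆-tail s) (ZerosAt-tail z)
count-suc-expand c (true ∷ I) (b ∷ J) (x ∷ u) s z with x | proj₂ (z zero) (s zero tt)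
... | zero | refl = count-suc-expand c I J u (⊆-tail s) (ZerosAt-tail z)

valueCounts-expand : ∀ {n} k (I J : Vec Bool n) u → I ⊆ J → ZerosAt J u →
  valueCounts (suc k) (expand I u) ≡ Vec.count (ℕ._≟ 1) (expand I u) ∷ valueCounts k u
valueCounts-expand k I J u s z = trans
  (map-allFin-suc k (λ c → Vec.count (ℕ._≟ suc (toℕ c)) (expand I u)))
  (cong (Vec.count (ℕ._≟ 1) (expand I u) ∷_)
    (Listₚ.map-cong (λ c → count-suc-expand (toℕ c) I J u s z) (allFin k)))

T-not-∨⇒ : ∀ {P : Set} b (d : Dec P) → T (not b ∨ does d) → T b → P
T-not-∨⇒ true (yes p) _ _ = p

⇒T-not-∨ : ∀ {P : Set} b (d : Dec P) → (T b → P) → T (not b ∨ does d)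
⇒T-not-∨ false d       f = tt
⇒T-not-∨ true  (yes p) f = tt
⇒T-not-∨ true  (no ¬p) f = ¬p (f tt)

T-does⇒ : ∀ {P : Set} (d : Dec P) → T (does d) → P
T-does⇒ (yes p) _ = p

⇒T-does : ∀ {P : Set} (d : Dec P) → P → T (does d)
⇒T-does (yes p) _ = tt
⇒T-does (no ¬p) p = ¬p p

T-∧⇒ : ∀ {a b} → T (a ∧ b) → T a × T b
T-∧⇒ = Boolₚ.T-∧ .Equivalence.to

⇒T-∧ : ∀ {a b} → T a → T b → T (a ∧ b)
⇒T-∧ p q = Boolₚ.T-∧ .Equivalence.from (p , q)

all-allFin⇒ : ∀ {n} (p : Fin n → Bool) → T (all p (allFin n)) → ∀ i → T (p i)
all-allFin⇒ {n} p h i = All.lookup (Allₚ.all⁺ p (allFin n) h) (∈-allFin i)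

⇒all-allFin : ∀ {n} (p : Fin n → Bool) → (∀ i → T (p i)) → T (all p (allFin n))
⇒all-allFin {n} p h = Allₚ.all⁻ p (All.universal h (allFin n))

-- Partitions counted by powers of `ζ` and by chains

module Partitions {n} (le₁ : BRel n) (g : Permutation′ n) where
  open Chains le₁ g

  -- The value 0 stands for the union of fibres already removed, inside which nothing is required.
  record Partition (le₂ : BRel n) (f : Fin n → ℕ) : Set where
    field
      invariant : ∀ x → f (g ⟨$⟩ʳ x) ≡ f x
      monotone  : ∀ x y → T (le₁ x y) → f x ℕ.≤ f y
      strictly  : ∀ x y → T (strict le₁ x y) → T (strict le₂ y x) → 1 ℕ.≤ f x → f x ℕ.< f y

  abstract
    partition? : ∀ le₂ f → Dec (Partition le₂ f)
    partition? le₂ f = map′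
      (λ (a , b , c) → record { invariant = a ; monotone = b ; strictly = c })
      (λ P → Partition.invariant P , Partition.monotone P , Partition.strictly P)
      (Finₚ.all? (λ x → f (g ⟨$⟩ʳ x) ℕ.≟ f x)
       ×-dec Finₚ.all? (λ x → Finₚ.all? (λ y → T? (le₁ x y) →-dec (f x ℕ.≤? f y)))
       ×-dec Finₚ.all? (λ x → Finₚ.all? (λ y →
         T? (strict le₁ x y) →-dec T? (strict le₂ y x) →-dec (1 ℕ.≤? f x) →-dec (f x ℕ.<? f y))))

  -- Positivity of `f` supplies the premise `1 ≤ f x` of `strictly`, so the relaxed notion agrees
  -- with the original one when no fibre has been removed yet.
  χ-isGInvDPartition : ∀ le₂ (v : Vec ℕ n) f → (∀ x → lookup v x ≡ f x) → (∀ x → 1 ℕ.≤ f x) →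
    χ (T? (isGInvDPartition le₁ le₂ g f)) ≡ χ (partition? le₂ (lookup v))
  χ-isGInvDPartition le₂ v f e pos = χ-⇔ (T? (isGInvDPartition le₁ le₂ g f)) (partition? le₂ (lookup v)) to from
    where
    cond : Fin n → Fin n → Bool
    cond i j = (not (le₁ i j) ∨ does (f i ℕ.≤? f j)) ∧
               (not (strict le₁ i j ∧ strict le₂ j i) ∨ does (f i ℕ.<? f j))
    to : T (isGInvDPartition le₁ le₂ g f) → Partition le₂ (lookup v)
    to h = record
      { invariant = λ x → trans (e (g ⟨$⟩ʳ x)) (trans
          (T-does⇒ (f (g ⟨$⟩ʳ x) ℕ.≟ f x) (all-allFin⇒ (λ i → does (f (g ⟨$⟩ʳ i) ℕ.≟ f i)) (proj₂ (T-∧⇒ h)) x))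
          (sym (e x)))
      ; monotone = λ x y x≤y → lift ℕ._≤_
          (T-not-∨⇒ (le₁ x y) (f x ℕ.≤? f y) (proj₁ (T-∧⇒ (conds x y))) x≤y)
      ; strictly = λ x y x<y y<x _ → lift ℕ._<_
          (T-not-∨⇒ (strict le₁ x y ∧ strict le₂ y x) (f x ℕ.<? f y)
            (proj₂ (T-∧⇒ {not (le₁ x y) ∨ does (f x ℕ.≤? f y)} (conds x y))) (⇒T-∧ x<y y<x)) }
      where
      conds : ∀ x y → T (cond x y)
      conds x y = all-allFin⇒ (cond x)
        (all-allFin⇒ (λ i → all (cond i) (allFin n)) (proj₁ (T-∧⇒ h)) x) y
      lift : (_~_ : ℕ → ℕ → Set) → ∀ {x y} → f x ~ f y → lookup v x ~ lookup v y
      lift _~_ {x} {y} r rewrite e x | e y = r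
    from : Partition le₂ (lookup v) → T (isGInvDPartition le₁ le₂ g f)
    from P = ⇒T-∧
      (⇒all-allFin _ (λ x → ⇒all-allFin (cond x) (λ y → ⇒T-∧
        (⇒T-not-∨ (le₁ x y) (f x ℕ.≤? f y) (λ x≤y → lower ℕ._≤_ (Partition.monotone P x y x≤y)))
        (⇒T-not-∨ (strict le₁ x y ∧ strict le₂ y x) (f x ℕ.<? f y) (λ h → lower ℕ._<_
          (Partition.strictly P x y (proj₁ (T-∧⇒ h)) (proj₂ (T-∧⇒ {strict le₁ x y} h))
            (subst (1 ℕ.≤_) (sym (e x)) (pos x))))))))
      (⇒all-allFin _ (λ x → ⇒T-does (f (g ⟨$⟩ʳ x) ℕ.≟ f x)
        (trans (sym (e (g ⟨$⟩ʳ x))) (trans (Partition.invariant P x) (e x)))))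
      where
      lower : (_~_ : ℕ → ℕ → Set) → ∀ {x y} → lookup v x ~ lookup v y → f x ~ f y
      lower _~_ {x} {y} r rewrite e x | e y = r

  module _ {le₂ : BRel n} {I J : Vec Bool n} {u : Vec ℕ n} (goodI : Good I) (I⊆J : I ⊆ J) (zeros : ZerosAt J u) where
    private
      module I = Good goodI
      e = expand I u

    expand-in : ∀ x → x ∈ I → lookup e x ≡ 0
    expand-in x x∈I rewrite Vecₚ.lookup-zipWith (λ b x → if b then 0 else suc x) x I u with lookup I x
    ... | true = refl

    expand-out : ∀ x → ¬ x ∈ I → lookup e x ≡ suc (lookup u x)
    expand-out x x∉I rewrite Vecₚ.lookup-zipWith (λ b x → if b then 0 else suc x) x I u with lookup I x
    ... | false = refl
    ... | true  = ⊥-elim (x∉I tt)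

    zero-in : ∀ x → x ∈ I → lookup u x ≡ 0
    zero-in x x∈I = proj₂ (zeros x) (I⊆J x x∈I)

    out-up : ∀ x y → T (strict le₁ x y) → ¬ x ∈ I → ¬ y ∈ I
    out-up x y x<y x∉I y∈I = x∉I (I.downward x y (proj₁ (strict⇒ le₁ x<y)) y∈I)

    out-g : ∀ x → ¬ x ∈ I → ¬ (g ⟨$⟩ʳ x) ∈ I
    out-g x x∉I gx∈I = x∉I (subst T (I.invariant x) gx∈I)

    expand-1≤ : ∀ x → 1 ℕ.≤ lookup e x → ¬ x ∈ I
    expand-1≤ x h x∈I with subst (1 ℕ.≤_) (expand-in x x∈I) h
    ... | ()

    Bool-ext : ∀ {a b} → (T a → T b) → (T b → T a) → a ≡ b
    Bool-ext {false} {false} f h = refl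
    Bool-ext {true}  {true}  f h = refl
    Bool-ext {false} {true}  f h = ⊥-elim (h tt)
    Bool-ext {true}  {false} f h = ⊥-elim (f tt)

    -- `J` is the zero set of the invariant monotone function `u`, hence good. Outside `I` the
    -- strict inequalities of `expand I u` descend to `u`, so an inversion with both ends in `J`
    -- would require 0 < 0.
    partition-expand⇒ : Partition le₂ (lookup e) → Step le₂ I J × Partition le₂ (lookup u)
    partition-expand⇒ P = record
      { sub = I⊆J ; source = goodI
      ; target = record
        { invariant = λ x → Bool-ext
            (λ gx∈J → proj₁ (zeros x) (trans (sym (u-inv x)) (proj₂ (zeros _) gx∈J)))
            (λ x∈J → proj₁ (zeros (g ⟨$⟩ʳ x)) (trans (u-inv x) (proj₂ (zeros x) x∈J)))
        ; downward = λ x y x≤y y∈J → proj₁ (zeros x) (ℕₚ.n≤0⇒n≡0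
            (subst (lookup u x ℕ.≤_) (proj₂ (zeros y) y∈J) (u-mono x y x≤y))) }
      ; noInversion = λ x y x∉I y∈J x<y y<x → ℕₚ.1+n≰n (ℕₚ.≤-trans
          (u-strict x y x∉I x<y y<x) (ℕₚ.≤-trans (ℕₚ.≤-reflexive (proj₂ (zeros y) y∈J)) z≤n)) } , record
      { invariant = u-inv
      ; monotone = u-mono
      ; strictly = λ x y x<y y<x 1≤ux → u-strict x y
          (λ x∈I → ℕₚ.1+n≰n (subst (1 ℕ.≤_) (zero-in x x∈I) 1≤ux)) x<y y<x }
      where
      module P = Partition P
      u-inv : ∀ x → lookup u (g ⟨$⟩ʳ x) ≡ lookup u x
      u-inv x with T? (lookup I x)
      ... | yes x∈I = trans (zero-in _ (subst T (sym (I.invariant x)) x∈I)) (sym (zero-in x x∈I))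
      ... | no x∉I  = ℕₚ.suc-injective
              (trans (sym (expand-out _ (out-g x x∉I))) (trans (P.invariant x) (expand-out x x∉I)))
      u-mono : ∀ x y → T (le₁ x y) → lookup u x ℕ.≤ lookup u y
      u-mono x y x≤y with T? (lookup I x)
      ... | yes x∈I = subst (ℕ._≤ lookup u y) (sym (zero-in x x∈I)) z≤n
      ... | no x∉I  = ℕₚ.≤-pred (subst (ℕ._≤ suc (lookup u y)) (expand-out x x∉I)
              (subst (lookup e x ℕ.≤_) (expand-out y (x∉I ∘ I.downward x y x≤y)) (P.monotone x y x≤y)))
      u-strict : ∀ x y → ¬ x ∈ I → T (strict le₁ x y) → T (strict le₂ y x) → lookup u x ℕ.< lookup u y
      u-strict x y x∉I x<y y<x = ℕₚ.≤-pred (subst (λ k → suc k ℕ.≤ suc (lookup u y)) (expand-out x x∉I)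
        (subst (lookup e x ℕ.<_) (expand-out y (out-up x y x<y x∉I))
          (P.strictly x y x<y y<x (subst (1 ℕ.≤_) (sym (expand-out x x∉I)) (s≤s z≤n)))))

    -- For an inversion with `u x` positive, strictness comes from `u`. If `u x` is 0, then `x` is
    -- in the new fibre, and `noInversion` keeps `y` out of `J`, so `u y` is positive.
    ⇒partition-expand : Step le₂ I J → Partition le₂ (lookup u) → Partition le₂ (lookup e)
    ⇒partition-expand S P = record
      { invariant = e-inv
      ; monotone = e-mono
      ; strictly = λ x y x<y y<x 1≤ex → let x∉I = expand-1≤ x 1≤ex in
          subst (ℕ._< lookup e y) (sym (expand-out x x∉I))
            (subst (suc (lookup u x) ℕ.<_) (sym (expand-out y (out-up x y x<y x∉I)))
              (s≤s (u-strict x y x∉I x<y y<x))) }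
      where
      module P = Partition P
      e-inv : ∀ x → lookup e (g ⟨$⟩ʳ x) ≡ lookup e x
      e-inv x with T? (lookup I x)
      ... | yes x∈I = trans (expand-in _ (subst T (sym (I.invariant x)) x∈I)) (sym (expand-in x x∈I))
      ... | no x∉I  = trans (expand-out _ (out-g x x∉I)) (trans (cong suc (P.invariant x)) (sym (expand-out x x∉I)))
      e-mono : ∀ x y → T (le₁ x y) → lookup e x ℕ.≤ lookup e y
      e-mono x y x≤y with T? (lookup I x)
      ... | yes x∈I = subst (ℕ._≤ lookup e y) (sym (expand-in x x∈I)) z≤n
      ... | no x∉I  = subst (ℕ._≤ lookup e y) (sym (expand-out x x∉I))
              (subst (suc (lookup u x) ℕ.≤_) (sym (expand-out y (x∉I ∘ I.downward x y x≤y)))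
                (s≤s (P.monotone x y x≤y)))
      u-strict : ∀ x y → ¬ x ∈ I → T (strict le₁ x y) → T (strict le₂ y x) → lookup u x ℕ.< lookup u y
      u-strict x y x∉I x<y y<x with lookup u x ℕ.≟ 0
      ... | yes ux≡0 = subst (ℕ._< lookup u y) (sym ux≡0) (ℕₚ.n≢0⇒n>0
              (λ uy≡0 → Step.noInversion S x y x∉I (proj₁ (zeros y) uy≡0) x<y y<x))
      ... | no ux≢0  = P.strictly x y x<y y<x (ℕₚ.n≢0⇒n>0 ux≢0)

  -- The weight `H` is arbitrary so that one recursion serves both the count of all partitions and
  -- the count with prescribed fibre sizes.
  ∑-partitions-suc : ∀ le₂ k {I} → Good I → (H : Vec ℕ n → ℤ) →
    ∑ (fillings (suc k) I) (λ v → χ (partition? le₂ (lookup v)) * H v)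
      ≡ ∑ (subsets n) (λ J → ζ le₂ I J * ∑ (fillings k J) (λ u → χ (partition? le₂ (lookup u)) * H (expand I u)))
  ∑-partitions-suc le₂ k {I} goodI H = trans (∑-fillings-suc k I _) (∑-cong (subsets n) (λ J → begin
    χ (I ⊆? J) * ∑ (fillings k J) (λ u → p (expand I u) * H (expand I u))
      ≡⟨ *-distribˡ-∑ (fillings k J) (χ (I ⊆? J)) (λ u → p (expand I u) * H (expand I u)) ⟩
    ∑ (fillings k J) (λ u → χ (I ⊆? J) * (p (expand I u) * H (expand I u)))
      ≡⟨ ∑-cong-All (All.map (λ {u} z → pointwise J u z) (fillings-sound k J)) ⟩
    ∑ (fillings k J) (λ u → ζ le₂ I J * (p u * H (expand I u)))
      ≡⟨ sym (*-distribˡ-∑ (fillings k J) (ζ le₂ I J) (λ u → p u * H (expand I u))) ⟩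
    ζ le₂ I J * ∑ (fillings k J) (λ u → p u * H (expand I u)) ∎))
    where
    p : Vec ℕ n → ℤ
    p u = χ (partition? le₂ (lookup u))
    pointwise : ∀ J u → ZerosAt J u →
      χ (I ⊆? J) * (p (expand I u) * H (expand I u)) ≡ ζ le₂ I J * (p u * H (expand I u))
    pointwise J u z = begin
      χ (I ⊆? J) * (p (expand I u) * H (expand I u))
        ≡⟨ sym (ℤₚ.*-assoc (χ (I ⊆? J)) (p (expand I u)) (H (expand I u))) ⟩
      χ (I ⊆? J) * p (expand I u) * H (expand I u)
        ≡⟨ cong (_* H (expand I u)) (begin
             χ (I ⊆? J) * p (expand I u)
               ≡⟨ sym (χ-× (I ⊆? J) (partition? le₂ (lookup (expand I u)))) ⟩
             χ ((I ⊆? J) ×-dec partition? le₂ (lookup (expand I u)))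
               ≡⟨ χ-⇔ ((I ⊆? J) ×-dec partition? le₂ (lookup (expand I u)))
                      (step? le₂ I J ×-dec partition? le₂ (lookup u))
                    (λ (s , P) → partition-expand⇒ goodI s z P)
                    (λ (S , P) → Step.sub S , ⇒partition-expand goodI (Step.sub S) z S P) ⟩
             χ (step? le₂ I J ×-dec partition? le₂ (lookup u))
               ≡⟨ χ-× (step? le₂ I J) (partition? le₂ (lookup u)) ⟩
             ζ le₂ I J * p u ∎) ⟩
      ζ le₂ I J * p u * H (expand I u)
        ≡⟨ ℤₚ.*-assoc (ζ le₂ I J) (p u) (H (expand I u)) ⟩
      ζ le₂ I J * (p u * H (expand I u)) ∎

  ∑-partitions-zero : ∀ le₂ I (H : Vec ℕ n → ℤ) → H (Vec.replicate n 0) ≡ 1ℤ →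
    ∑ (fillings 0 I) (λ v → χ (partition? le₂ (lookup v)) * H v) ≡ full I
  ∑-partitions-zero le₂ I H h = begin
    ∑ (fillings 0 I) (λ v → χ (partition? le₂ (lookup v)) * H v)
      ≡⟨ ∑-fillings-zero I _ ⟩
    full I * (χ (partition? le₂ (lookup (Vec.replicate n 0))) * H (Vec.replicate n 0))
      ≡⟨ cong (full I *_) (cong₂ _*_ (χ-true (partition? le₂ (lookup (Vec.replicate n 0))) constant) h) ⟩
    full I * 1ℤ
      ≡⟨ ℤₚ.*-identityʳ (full I) ⟩
    full I ∎
    where
    z : ∀ x → lookup (Vec.replicate n 0) x ≡ 0
    z x = Vecₚ.lookup-replicate x 0
    constant : Partition le₂ (lookup (Vec.replicate n 0))
    constant = record
      { invariant = λ x → trans (z (g ⟨$⟩ʳ x)) (sym (z x))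
      ; monotone = λ x y _ → ℕₚ.≤-reflexive (trans (z x) (sym (z y)))
      ; strictly = λ x y _ _ 1≤0 → ⊥-elim (ℕₚ.1+n≰n (subst (1 ℕ.≤_) (z x) 1≤0)) }

  power : BRel n → ℕ → (Vec Bool n → ℤ) → Vec Bool n → ℤ
  power le₂ zero    F I = F I
  power le₂ (suc m) F I = ∑ (subsets n) (λ J → ζ le₂ I J * power le₂ m F J)

  power-scale : ∀ le₂ m c F {G : Vec Bool n → ℤ} → (∀ J → G J ≡ c * F J) → ∀ I →
                power le₂ m G I ≡ c * power le₂ m F I
  power-scale le₂ zero    c F e I = e I
  power-scale le₂ (suc m) c F e I = trans
    (∑-cong (subsets n) (λ J → trans (cong (ζ le₂ I J *_) (power-scale le₂ m c F e J))
                                     (x∙yz≈y∙xz (ζ le₂ I J) c (power le₂ m F J))))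
    (sym (*-distribˡ-∑ (subsets n) c (λ J → ζ le₂ I J * power le₂ m F J)))

  ∑-partitions≡power : ∀ le₂ m I → Good I →
    ∑ (fillings m I) (λ v → χ (partition? le₂ (lookup v)) * 1ℤ) ≡ power le₂ m full I
  ∑-partitions≡power le₂ zero    I _ = ∑-partitions-zero le₂ I (λ _ → 1ℤ) refl
  ∑-partitions≡power le₂ (suc m) I G = trans (∑-partitions-suc le₂ m G (λ _ → 1ℤ))
    (∑-cong (subsets n) (λ J → χ-*-cong (step? le₂ I J) (λ S → ∑-partitions≡power le₂ m J (Step.target S))))

  -- Removing the smallest fibre splits the condition on the fibre sizes into the size of the first
  -- step and the condition on the tail.
  ∑-partitions≡chain : ∀ le₂ α I → Good I →
    ∑ (fillings (length α) I) (λ v → χ (partition? le₂ (lookup v)) * χ (valueCounts (length α) v ≟ᶜ α))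
      ≡ chain le₂ α full I
  ∑-partitions≡chain le₂ []      I _ = ∑-partitions-zero le₂ I (λ v → χ (valueCounts 0 v ≟ᶜ [])) refl
  ∑-partitions≡chain le₂ (a ∷ α) I G =
    trans (∑-partitions-suc le₂ (length α) G (λ v → χ (valueCounts (suc (length α)) v ≟ᶜ a ∷ α)))
          (∑-cong (subsets n) step)
    where
    p : Vec ℕ n → ℤ
    p u = χ (partition? le₂ (lookup u))
    q : Vec ℕ n → ℤ
    q u = χ (valueCounts (length α) u ≟ᶜ α)
    step : ∀ J → ζ le₂ I J * ∑ (fillings (length α) J) (λ u →
                   p u * χ (valueCounts (suc (length α)) (expand I u) ≟ᶜ a ∷ α))
               ≡ sizedζ le₂ a I J * chain le₂ α full J
    step J = begin
      ζ le₂ I J * ∑ (fillings (length α) J) (λ u → p u * χ (valueCounts (suc (length α)) (expand I u) ≟ᶜ a ∷ α))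
        ≡⟨ χ-*-cong (step? le₂ I J) (λ S → begin
             ∑ (fillings (length α) J) (λ u → p u * χ (valueCounts (suc (length α)) (expand I u) ≟ᶜ a ∷ α))
               ≡⟨ ∑-cong-All (All.map (λ {u} z → separate (Step.sub S) u z) (fillings-sound (length α) J)) ⟩
             ∑ (fillings (length α) J) (λ u → c * (p u * q u))
               ≡⟨ sym (*-distribˡ-∑ (fillings (length α) J) c (λ u → p u * q u)) ⟩
             c * ∑ (fillings (length α) J) (λ u → p u * q u)
               ≡⟨ cong (c *_) (∑-partitions≡chain le₂ α J (Step.target S)) ⟩
             c * chain le₂ α full J ∎) ⟩
      ζ le₂ I J * (c * chain le₂ α full J)
        ≡⟨ swap (ζ le₂ I J) c (chain le₂ α full J) ⟩
      sizedζ le₂ a I J * chain le₂ α full J ∎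
      where
      c = χ (∣ J ∣ ℕ.≟ ∣ I ∣ ℕ.+ a)
      swap : ∀ a b c → a * (b * c) ≡ b * a * c
      swap = solve-∀
      separate : I ⊆ J → ∀ u → ZerosAt J u →
        p u * χ (valueCounts (suc (length α)) (expand I u) ≟ᶜ a ∷ α) ≡ c * (p u * q u)
      separate s u z = begin
        p u * χ (valueCounts (suc (length α)) (expand I u) ≟ᶜ a ∷ α)
          ≡⟨ cong (p u *_) (trans
               (χ-⇔ (valueCounts (suc (length α)) (expand I u) ≟ᶜ a ∷ α)
                    ((∣ J ∣ ℕ.≟ ∣ I ∣ ℕ.+ a) ×-dec (valueCounts (length α) u ≟ᶜ α))
                 (λ e → let e′ = trans (sym vc) e in
                   trans (sym ones) (cong (∣ I ∣ ℕ.+_) (Listₚ.∷-injectiveˡ e′)) , Listₚ.∷-injectiveʳ e′)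
                 (λ (e , e′) → trans vc (cong₂ _∷_ (ℕₚ.+-cancelˡ-≡ ∣ I ∣ _ _ (trans ones e)) e′)))
               (χ-× (∣ J ∣ ℕ.≟ ∣ I ∣ ℕ.+ a) (valueCounts (length α) u ≟ᶜ α))) ⟩
        p u * (c * q u)
          ≡⟨ x∙yz≈y∙xz (p u) c (q u) ⟩
        c * (p u * q u) ∎
        where
        ones = count-one-expand I J u s z
        vc = valueCounts-expand (length α) I J u s z

  good-⊥ : Good ⊥
  good-⊥ = record
    { invariant = λ x → trans (Vecₚ.lookup-replicate (g ⟨$⟩ʳ x) false) (sym (Vecₚ.lookup-replicate x false))
    ; downward  = λ x y _ y∈⊥ → ⊥-elim (subst T (Vecₚ.lookup-replicate y false) y∈⊥) }

  χ-asMap : ∀ {k} le₂ (v : Vec (Fin k) n) →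
    χ (T? (isGInvDPartition le₁ le₂ g (asMap v))) ≡ χ (partition? le₂ (lookup (Vec.map (suc ∘ toℕ) v)))
  χ-asMap le₂ v = χ-isGInvDPartition le₂ (Vec.map (suc ∘ toℕ) v) (asMap v)
    (λ x → Vecₚ.lookup-map x (suc ∘ toℕ) v) (λ x → s≤s z≤n)

  orderCount≡power : ∀ le₂ m → + orderCount le₁ le₂ g m ≡ power le₂ m full ⊥
  orderCount≡power le₂ m = begin
    + orderCount le₁ le₂ g m
      ≡⟨ +count≡∑ _ (allMaps m n) ⟩
    ∑ (allMaps m n) (λ v → χ (T? (isGInvDPartition le₁ le₂ g (asMap v))))
      ≡⟨ ∑-cong (allMaps m n) (λ v → trans (χ-asMap le₂ v) (sym (ℤₚ.*-identityʳ _))) ⟩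
    ∑ (allMaps m n) (λ v → χ (partition? le₂ (lookup (Vec.map (suc ∘ toℕ) v))) * 1ℤ)
      ≡⟨ ∑-allMaps m n (λ u → χ (partition? le₂ (lookup u)) * 1ℤ) ⟩
    ∑ (fillings m ⊥) (λ u → χ (partition? le₂ (lookup u)) * 1ℤ)
      ≡⟨ ∑-partitions≡power le₂ m ⊥ good-⊥ ⟩
    power le₂ m full ⊥ ∎

  monoCoeff≡chain : ∀ le₂ α → + monoCoeff le₁ le₂ g α ≡ chain le₂ α full ⊥
  monoCoeff≡chain le₂ α = begin
    + monoCoeff le₁ le₂ g α
      ≡⟨ +count≡∑ _ (allMaps (length α) n) ⟩
    ∑ (allMaps (length α) n) (λ v →
      χ (T? (isGInvDPartition le₁ le₂ g (asMap v) ∧ does (fiberSizes v ≟ᶜ α))))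
      ≡⟨ ∑-cong (allMaps (length α) n) (λ v → trans
           (χ-× (T? (isGInvDPartition le₁ le₂ g (asMap v))) (fiberSizes v ≟ᶜ α))
           (cong₂ _*_ (χ-asMap le₂ v) (cong (λ l → χ (l ≟ᶜ α)) (fiberSizes≡valueCounts v)))) ⟩
    ∑ (allMaps (length α) n) (λ v → H (Vec.map (suc ∘ toℕ) v))
      ≡⟨ ∑-allMaps (length α) n H ⟩
    ∑ (fillings (length α) ⊥) H
      ≡⟨ ∑-partitions≡chain le₂ α ⊥ good-⊥ ⟩
    chain le₂ α full ⊥ ∎
    where
    H : Vec ℕ n → ℤ
    H u = χ (partition? le₂ (lookup u)) * χ (valueCounts (length α) u ≟ᶜ α)

-- Reversal of the values

tabulate-∷ʳ : ∀ {A : Set} {k} (h : Fin (suc k) → A) →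
              tabulate h ≡ tabulate (h ∘ Fin.inject₁) ++ h (Fin.fromℕ k) ∷ []
tabulate-∷ʳ {k = zero}  h = refl
tabulate-∷ʳ {k = suc k} h = cong (h zero ∷_) (tabulate-∷ʳ (h ∘ suc))

tabulate-opposite : ∀ {A : Set} {k} (h : Fin k → A) → tabulate (h ∘ Fin.opposite) ≡ reverse (tabulate h)
tabulate-opposite {k = zero}  h = refl
tabulate-opposite {k = suc k} h = begin
  h (Fin.fromℕ k) ∷ tabulate (h ∘ Fin.inject₁ ∘ Fin.opposite)
    ≡⟨ cong (h (Fin.fromℕ k) ∷_) (tabulate-opposite (h ∘ Fin.inject₁)) ⟩
  h (Fin.fromℕ k) ∷ reverse (tabulate (h ∘ Fin.inject₁))
    ≡⟨ sym (Listₚ.reverse-++ (tabulate (h ∘ Fin.inject₁)) (h (Fin.fromℕ k) ∷ [])) ⟩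
  reverse (tabulate (h ∘ Fin.inject₁) ++ h (Fin.fromℕ k) ∷ [])
    ≡⟨ cong reverse (sym (tabulate-∷ʳ h)) ⟩
  reverse (tabulate h) ∎

map-opposite-allFin : ∀ {A : Set} k (h : Fin k → A) →
                      map (h ∘ Fin.opposite) (allFin k) ≡ reverse (map h (allFin k))
map-opposite-allFin k h = begin
  map (h ∘ Fin.opposite) (allFin k)    ≡⟨ Listₚ.map-tabulate id (h ∘ Fin.opposite) ⟩
  tabulate (h ∘ Fin.opposite)          ≡⟨ tabulate-opposite h ⟩
  reverse (tabulate h)                 ≡⟨ cong reverse (sym (Listₚ.map-tabulate id h)) ⟩
  reverse (map h (allFin k))           ∎

∑-reverse : ∀ {A : Set} (xs : List A) (f : A → ℤ) → ∑ (reverse xs) f ≡ ∑ xs f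
∑-reverse []       f = refl
∑-reverse (x ∷ xs) f = begin
  ∑ (reverse (x ∷ xs)) f          ≡⟨ cong (λ l → ∑ l f) (Listₚ.unfold-reverse x xs) ⟩
  ∑ (reverse xs ++ x ∷ []) f      ≡⟨ ∑-++ (reverse xs) (x ∷ []) f ⟩
  ∑ (reverse xs) f + (f x + 0ℤ)   ≡⟨ cong₂ _+_ (∑-reverse xs f) (ℤₚ.+-identityʳ (f x)) ⟩
  ∑ xs f + f x                    ≡⟨ ℤₚ.+-comm (∑ xs f) (f x) ⟩
  f x + ∑ xs f                    ∎

∑-allFin-opposite : ∀ k (f : Fin k → ℤ) → ∑ (allFin k) (f ∘ Fin.opposite) ≡ ∑ (allFin k) f
∑-allFin-opposite k f = begin
  ∑ (allFin k) (f ∘ Fin.opposite)            ≡⟨ sym (∑-map Fin.opposite (allFin k) f) ⟩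
  ∑ (map Fin.opposite (allFin k)) f          ≡⟨ cong (λ l → ∑ l f) (map-opposite-allFin k id) ⟩
  ∑ (reverse (map id (allFin k))) f          ≡⟨ ∑-reverse (map id (allFin k)) f ⟩
  ∑ (map id (allFin k)) f                    ≡⟨ cong (λ l → ∑ l f) (Listₚ.map-id (allFin k)) ⟩
  ∑ (allFin k) f                             ∎

∑-allMaps-opposite : ∀ k n (F : Vec (Fin k) n → ℤ) →
  ∑ (allMaps k n) (F ∘ Vec.map Fin.opposite) ≡ ∑ (allMaps k n) F
∑-allMaps-opposite k zero    F = refl
∑-allMaps-opposite k (suc n) F = begin
  ∑ (allMaps k (suc n)) (F ∘ Vec.map Fin.opposite)
    ≡⟨ ∑-concatMap (λ c → map (c ∷_) (allMaps k n)) (allFin k) _ ⟩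
  ∑ (allFin k) (λ c → ∑ (map (c ∷_) (allMaps k n)) (F ∘ Vec.map Fin.opposite))
    ≡⟨ ∑-cong (allFin k) (λ c → trans (∑-map (c ∷_) (allMaps k n) _)
         (trans (∑-allMaps-opposite k n (λ v → F (Fin.opposite c ∷ v)))
                (sym (∑-map (Fin.opposite c ∷_) (allMaps k n) F)))) ⟩
  ∑ (allFin k) (λ c → ∑ (map (Fin.opposite c ∷_) (allMaps k n)) F)
    ≡⟨ ∑-allFin-opposite k (λ c → ∑ (map (c ∷_) (allMaps k n)) F) ⟩
  ∑ (allFin k) (λ c → ∑ (map (c ∷_) (allMaps k n)) F)
    ≡⟨ sym (∑-concatMap (λ c → map (c ∷_) (allMaps k n)) (allFin k) F) ⟩
  ∑ (allMaps k (suc n)) F ∎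

fiberSizes-opposite : ∀ {k n} (v : Vec (Fin k) n) → fiberSizes (Vec.map Fin.opposite v) ≡ reverse (fiberSizes v)
fiberSizes-opposite {k} v = trans
  (Listₚ.map-cong (λ c → same c v) (allFin k))
  (map-opposite-allFin k (λ c → count (λ x → does (x Fin.≟ c)) (Vec.toList v)))
  where
  same : ∀ {n} c (v : Vec (Fin k) n) → count (λ x → does (x Fin.≟ c)) (Vec.toList (Vec.map Fin.opposite v))
                                     ≡ count (λ x → does (x Fin.≟ Fin.opposite c)) (Vec.toList v)
  same c [] = refl
  same c (x ∷ v) with Fin.opposite x Fin.≟ c | x Fin.≟ Fin.opposite c
  ... | yes _    | yes _    = cong suc (same c v)
  ... | no _     | no _     = same c v
  ... | yes refl | no x≢    = ⊥-elim (x≢ (sym (Finₚ.opposite-involutive x)))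
  ... | no ≢c    | yes refl = ⊥-elim (≢c (Finₚ.opposite-involutive c))

opposite-≤ : ∀ {k} (a b : Fin k) → toℕ a ℕ.≤ toℕ b → toℕ (Fin.opposite b) ℕ.≤ toℕ (Fin.opposite a)
opposite-≤ {k} a b a≤b rewrite Finₚ.opposite-prop a | Finₚ.opposite-prop b = ℕₚ.∸-monoʳ-≤ k (s≤s a≤b)

opposite-< : ∀ {k} (a b : Fin k) → toℕ a ℕ.< toℕ b → toℕ (Fin.opposite b) ℕ.< toℕ (Fin.opposite a)
opposite-< a b a<b = ℕₚ.≰⇒> (λ h → ℕₚ.<⇒≱ a<b
  (subst (λ c → toℕ c ℕ.≤ toℕ a) (Finₚ.opposite-involutive b)
    (subst (λ c → toℕ (Fin.opposite (Fin.opposite b)) ℕ.≤ toℕ c) (Finₚ.opposite-involutive a)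
      (opposite-≤ (Fin.opposite a) (Fin.opposite b) h))))

positive : ∀ {k n} → Vec (Fin k) n → Vec ℕ n
positive = Vec.map (suc ∘ toℕ)

lookup-opposite : ∀ {k n} (v : Vec (Fin k) n) x →
  lookup (positive (Vec.map Fin.opposite v)) x ≡ suc (toℕ (Fin.opposite (lookup v x)))
lookup-opposite v x = trans (Vecₚ.lookup-map x (suc ∘ toℕ) (Vec.map Fin.opposite v))
                            (cong (suc ∘ toℕ) (Vecₚ.lookup-map x Fin.opposite v))

module _ {n} {le₁ le₂ : BRel n} {g : Permutation′ n} where
  open Partitions using (Partition; module Partition)

  -- Reversing the values reverses all inequalities, so `≤₁` must be reversed. Reversing `≤₂` too
  -- keeps the same pairs as the ones on which strictness is demanded.
  partition-opposite : ∀ {k} (v : Vec (Fin k) n) → Partition le₁ g le₂ (lookup (positive v)) →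
    Partition (flip le₁) g (flip le₂) (lookup (positive (Vec.map Fin.opposite v)))
  partition-opposite v P = record
    { invariant = λ x → trans (lookup-opposite v (g ⟨$⟩ʳ x)) (trans
        (cong (suc ∘ toℕ ∘ Fin.opposite) (Finₚ.toℕ-injective (ℕₚ.suc-injective
          (trans (sym (at (g ⟨$⟩ʳ x))) (trans (P.invariant x) (at x))))))
        (sym (lookup-opposite v x)))
    ; monotone = λ x y y≤x → reverse-order ℕ._≤_ x y
        (s≤s (opposite-≤ (lookup v y) (lookup v x) (ℕₚ.≤-pred (forward ℕ._≤_ y x (P.monotone y x y≤x)))))
    ; strictly = λ x y x<y y<x _ → reverse-order ℕ._<_ x y
        (s≤s (opposite-< (lookup v y) (lookup v x) (ℕₚ.≤-pred (forward ℕ._<_ y x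
          (P.strictly y x (strict-flip le₁ x<y) (strict-flip le₂ y<x)
            (subst (1 ℕ.≤_) (sym (at y)) (s≤s z≤n))))))) }
    where
    module P = Partition P
    at : ∀ x → lookup (positive v) x ≡ suc (toℕ (lookup v x))
    at x = Vecₚ.lookup-map x (suc ∘ toℕ) v
    forward : (_~_ : ℕ → ℕ → Set) → ∀ x y → lookup (positive v) x ~ lookup (positive v) y →
              suc (toℕ (lookup v x)) ~ suc (toℕ (lookup v y))
    forward _~_ x y r rewrite at x | at y = r
    reverse-order : (_~_ : ℕ → ℕ → Set) → ∀ x y →
      suc (toℕ (Fin.opposite (lookup v x))) ~ suc (toℕ (Fin.opposite (lookup v y))) →
      lookup (positive (Vec.map Fin.opposite v)) x ~ lookup (positive (Vec.map Fin.opposite v)) y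
    reverse-order _~_ x y r rewrite lookup-opposite v x | lookup-opposite v y = r

map-opposite-involutive : ∀ {k n} (v : Vec (Fin k) n) → Vec.map Fin.opposite (Vec.map Fin.opposite v) ≡ v
map-opposite-involutive v = trans (sym (Vecₚ.map-∘ Fin.opposite Fin.opposite v))
  (trans (Vecₚ.map-cong Finₚ.opposite-involutive v) (Vecₚ.map-id v))

module _ {n} (le₁ le₂ : BRel n) (g : Permutation′ n) where
  private
    module P  = Partitions le₁ g
    module P* = Partitions (dual₁ le₁) g

  χ-opposite : ∀ {k} (v : Vec (Fin k) n) →
    χ (T? (isGInvDPartition (dual₁ le₁) le₂ g (asMap v)))
      ≡ χ (T? (isGInvDPartition le₁ (flip le₂) g (asMap (Vec.map Fin.opposite v))))
  χ-opposite v = begin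
    χ (T? (isGInvDPartition (dual₁ le₁) le₂ g (asMap v)))
      ≡⟨ P*.χ-asMap le₂ v ⟩
    χ (P*.partition? le₂ (lookup (positive v)))
      ≡⟨ χ-⇔ (P*.partition? le₂ (lookup (positive v)))
             (P.partition? (flip le₂) (lookup (positive (Vec.map Fin.opposite v))))
             (partition-opposite v)
             (λ P → subst (P*.Partition le₂ ∘ lookup ∘ positive) (map-opposite-involutive v)
                          (partition-opposite (Vec.map Fin.opposite v) P)) ⟩
    χ (P.partition? (flip le₂) (lookup (positive (Vec.map Fin.opposite v))))
      ≡⟨ sym (P.χ-asMap (flip le₂) (Vec.map Fin.opposite v)) ⟩
    χ (T? (isGInvDPartition le₁ (flip le₂) g (asMap (Vec.map Fin.opposite v)))) ∎

  orderCount-dual : ∀ m → + orderCount (dual₁ le₁) le₂ g m ≡ P.power (flip le₂) m full ⊥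
  orderCount-dual m = begin
    + orderCount (dual₁ le₁) le₂ g m
      ≡⟨ +count≡∑ _ (allMaps m n) ⟩
    ∑ (allMaps m n) (λ v → χ (T? (isGInvDPartition (dual₁ le₁) le₂ g (asMap v))))
      ≡⟨ ∑-cong (allMaps m n) χ-opposite ⟩
    ∑ (allMaps m n) (λ v → χ (T? (isGInvDPartition le₁ (flip le₂) g (asMap (Vec.map Fin.opposite v)))))
      ≡⟨ ∑-allMaps-opposite m n (λ v → χ (T? (isGInvDPartition le₁ (flip le₂) g (asMap v)))) ⟩
    ∑ (allMaps m n) (λ v → χ (T? (isGInvDPartition le₁ (flip le₂) g (asMap v))))
      ≡⟨ sym (+count≡∑ _ (allMaps m n)) ⟩
    + orderCount le₁ (flip le₂) g m
      ≡⟨ P.orderCount≡power (flip le₂) m ⟩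
    P.power (flip le₂) m full ⊥ ∎

  -- Reversing the values reads the fibre sizes backwards. This reversal of `γ` is the one that the
  -- antipode performs on compositions.
  monoCoeff-dual : ∀ γ → + monoCoeff (dual₁ le₁) le₂ g γ ≡ Chains.chain le₁ g (flip le₂) (reverse γ) full ⊥
  monoCoeff-dual γ = begin
    + monoCoeff (dual₁ le₁) le₂ g γ
      ≡⟨ +count≡∑ _ (allMaps (length γ) n) ⟩
    ∑ (allMaps (length γ) n) (λ v →
      χ (T? (isGInvDPartition (dual₁ le₁) le₂ g (asMap v) ∧ does (fiberSizes v ≟ᶜ γ))))
      ≡⟨ ∑-cong (allMaps (length γ) n) pointwise ⟩
    ∑ (allMaps (length γ) n) (H ∘ Vec.map Fin.opposite)
      ≡⟨ ∑-allMaps-opposite (length γ) n H ⟩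
    ∑ (allMaps (length γ) n) H
      ≡⟨ cong (λ k → ∑ (allMaps k n) H) (sym (Listₚ.length-reverse γ)) ⟩
    ∑ (allMaps (length (reverse γ)) n) H
      ≡⟨ sym (+count≡∑ _ (allMaps (length (reverse γ)) n)) ⟩
    + monoCoeff le₁ (flip le₂) g (reverse γ)
      ≡⟨ P.monoCoeff≡chain (flip le₂) (reverse γ) ⟩
    Chains.chain le₁ g (flip le₂) (reverse γ) full ⊥ ∎
    where
    H : ∀ {k} → Vec (Fin k) n → ℤ
    H v = χ (T? (isGInvDPartition le₁ (flip le₂) g (asMap v) ∧ does (fiberSizes v ≟ᶜ reverse γ)))
    pointwise : ∀ {k} (v : Vec (Fin k) n) →
      χ (T? (isGInvDPartition (dual₁ le₁) le₂ g (asMap v) ∧ does (fiberSizes v ≟ᶜ γ)))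
        ≡ H (Vec.map Fin.opposite v)
    pointwise v = begin
      χ (T? (isGInvDPartition (dual₁ le₁) le₂ g (asMap v) ∧ does (fiberSizes v ≟ᶜ γ)))
        ≡⟨ χ-× (T? (isGInvDPartition (dual₁ le₁) le₂ g (asMap v))) (fiberSizes v ≟ᶜ γ) ⟩
      χ (T? (isGInvDPartition (dual₁ le₁) le₂ g (asMap v))) * χ (fiberSizes v ≟ᶜ γ)
        ≡⟨ cong₂ _*_ (χ-opposite v) (χ-⇔ (fiberSizes v ≟ᶜ γ) (fiberSizes w ≟ᶜ reverse γ)
             (λ e → trans (fiberSizes-opposite v) (cong reverse e))
             (λ e → Listₚ.reverse-injective (trans (sym (fiberSizes-opposite v)) e))) ⟩
      χ (T? (isGInvDPartition le₁ (flip le₂) g (asMap w))) * χ (fiberSizes w ≟ᶜ reverse γ)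
        ≡⟨ sym (χ-× (T? (isGInvDPartition le₁ (flip le₂) g (asMap w))) (fiberSizes w ≟ᶜ reverse γ)) ⟩
      H w ∎
      where w = Vec.map Fin.opposite v

-- Orbits and the sign of a permutation

-- `h` is `g` with `zero` cut out of its cycle and the other elements renumbered.
record CutsZero {n} (g : Permutation′ (suc n)) (h : Permutation′ n) : Set where
  field
    redirect : ∀ y → g ⟨$⟩ʳ suc y ≡ zero → suc (h ⟨$⟩ʳ y) ≡ g ⟨$⟩ʳ zero
    agree    : ∀ y → g ⟨$⟩ʳ suc y ≢ zero → suc (h ⟨$⟩ʳ y) ≡ g ⟨$⟩ʳ suc y

-- Following `g` by the transposition of `zero` and its image makes `zero` a fixed point, sends its
-- former preimage to its former image, and changes nothing else. The fixed point can then be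
-- removed.
cutZero : ∀ {n} (g : Permutation′ (suc n)) → ∃ (CutsZero g)
cutZero {n} g = remove zero π , record
  { redirect = λ y gy≡0 → trans (value y) (trans (cong (swap ⟨$⟩ʳ_) gy≡0) swap-zero)
  ; agree = λ y gy≢0 → trans (value y) (swap-other (g ⟨$⟩ʳ zero) (g ⟨$⟩ʳ suc y) gy≢0
      (λ e → case permutation-injective g e of λ ())) }
  where
  swap = transpose zero (g ⟨$⟩ʳ zero)
  π = g ∘ₚ swap
  swap-zero : swap ⟨$⟩ʳ zero ≡ g ⟨$⟩ʳ zero
  swap-zero = refl
  swap-back : ∀ {m} (r : Fin (suc m)) → transpose zero r ⟨$⟩ʳ r ≡ zero
  swap-back zero = refl
  swap-back (suc r) with r Fin.≟ r
  ... | yes _   = refl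
  ... | no r≢r  = ⊥-elim (r≢r refl)
  swap-other : ∀ {m} (r k : Fin (suc m)) → k ≢ zero → k ≢ r → transpose zero r ⟨$⟩ʳ k ≡ k
  swap-other r       zero    k≢0 k≢r = ⊥-elim (k≢0 refl)
  swap-other zero    (suc k) k≢0 k≢r = refl
  swap-other (suc r) (suc k) k≢0 k≢r with k Fin.≟ r
  ... | yes k≡r = ⊥-elim (k≢r (cong suc k≡r))
  ... | no _    = refl
  value : ∀ y → suc (remove zero π ⟨$⟩ʳ y) ≡ swap ⟨$⟩ʳ (g ⟨$⟩ʳ suc y)
  value y = sym (trans (punchIn-permute π zero y)
    (cong (λ z → Fin.punchIn z (remove zero π ⟨$⟩ʳ y)) (swap-back (g ⟨$⟩ʳ zero))))

∏ : ∀ {A : Set} → List A → (A → ℤ) → ℤ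
∏ []       f = 1ℤ
∏ (x ∷ xs) f = f x * ∏ xs f

∏-cong : ∀ {A : Set} (xs : List A) {f g : A → ℤ} → (∀ x → f x ≡ g x) → ∏ xs f ≡ ∏ xs g
∏-cong []       e = refl
∏-cong (x ∷ xs) e = cong₂ _*_ (e x) (∏-cong xs e)

∏-≡1 : ∀ {A : Set} (xs : List A) {f : A → ℤ} → (∀ x → f x ≡ 1ℤ) → ∏ xs f ≡ 1ℤ
∏-≡1 []       e = refl
∏-≡1 (x ∷ xs) e = cong₂ _*_ (e x) (∏-≡1 xs e)

∏-++ : ∀ {A : Set} (xs ys : List A) (f : A → ℤ) → ∏ (xs ++ ys) f ≡ ∏ xs f * ∏ ys f
∏-++ []       ys f = sym (ℤₚ.*-identityˡ (∏ ys f))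
∏-++ (x ∷ xs) ys f = trans (cong (f x *_) (∏-++ xs ys f)) (sym (ℤₚ.*-assoc (f x) (∏ xs f) (∏ ys f)))

∏-map : ∀ {A B : Set} (h : A → B) xs (f : B → ℤ) → ∏ (map h xs) f ≡ ∏ xs (f ∘ h)
∏-map h []       f = refl
∏-map h (x ∷ xs) f = cong (f (h x) *_) (∏-map h xs f)

∏-concatMap : ∀ {A B : Set} (h : A → List B) xs (f : B → ℤ) → ∏ (concatMap h xs) f ≡ ∏ xs (λ x → ∏ (h x) f)
∏-concatMap h []       f = refl
∏-concatMap h (x ∷ xs) f = trans (∏-++ (h x) (concatMap h xs) f) (cong (∏ (h x) f *_) (∏-concatMap h xs f))

∏-allFin-suc : ∀ n (f : Fin (suc n) → ℤ) → ∏ (allFin (suc n)) f ≡ f zero * ∏ (allFin n) (f ∘ suc)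
∏-allFin-suc n f = cong (f zero *_) (trans
  (cong (λ l → ∏ l f) (sym (Listₚ.map-tabulate id suc))) (∏-map suc (allFin n) f))

sign : Bool → ℤ
sign b = if b then - 1ℤ else 1ℤ

negOnePow-count : ∀ {A : Set} (p : A → Bool) xs → negOnePow (count p xs) ≡ ∏ xs (sign ∘ p)
negOnePow-count p []       = refl
negOnePow-count p (x ∷ xs) with p x
... | true  = trans (cong -_ (negOnePow-count p xs)) (sym (ℤₚ.-1*i≡-i (∏ xs (sign ∘ p))))
... | false = trans (negOnePow-count p xs) (sym (ℤₚ.*-identityˡ (∏ xs (sign ∘ p))))

below : ∀ {k} → ℕ → (Fin k → ℕ) → ℤ
below {k} a w = ∏ (allFin k) (λ j → sign (does (w j ℕ.<? a)))

-- The inversion sign of the one-line notation. It is defined for arbitrary words, since dropping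
-- the first letter of a permutation does not leave a permutation.
wordSign : ∀ k → (Fin k → ℕ) → ℤ
wordSign zero    w = 1ℤ
wordSign (suc k) w = below (w zero) (w ∘ suc) * wordSign k (w ∘ suc)

below-suc : ∀ {k} a (w : Fin (suc k) → ℕ) → below a w ≡ sign (does (w zero ℕ.<? a)) * below a (w ∘ suc)
below-suc {k} a w = ∏-allFin-suc k (λ j → sign (does (w j ℕ.<? a)))

below-cong : ∀ {k a b} {w v : Fin k → ℕ} → a ≡ b → (∀ j → w j ≡ v j) → below a w ≡ below b v
below-cong {k} {a} refl e = ∏-cong (allFin k) (λ j → cong (λ c → sign (does (c ℕ.<? a))) (e j))

wordSign-cong : ∀ k {w v : Fin k → ℕ} → (∀ j → w j ≡ v j) → wordSign k w ≡ wordSign k v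
wordSign-cong zero    e = refl
wordSign-cong (suc k) e = cong₂ _*_ (below-cong (e zero) (e ∘ suc)) (wordSign-cong k (e ∘ suc))

wordSign-suc : ∀ k (w : Fin k → ℕ) → wordSign k (suc ∘ w) ≡ wordSign k w
wordSign-suc zero    w = refl
wordSign-suc (suc k) w = cong (below (w zero) (w ∘ suc) *_) (wordSign-suc k (w ∘ suc))

sgn≡wordSign : ∀ {n} (g : Permutation′ n) → sgn g ≡ wordSign n (toℕ ∘ (g ⟨$⟩ʳ_))
sgn≡wordSign {n} g = begin
  sgn g
    ≡⟨ negOnePow-count
         (λ ij → does (proj₁ ij Fin.<? proj₂ ij) ∧ does ((g ⟨$⟩ʳ proj₂ ij) Fin.<? (g ⟨$⟩ʳ proj₁ ij)))
         (concatMap (λ i → map (λ j → (i , j)) (allFin n)) (allFin n)) ⟩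
  ∏ (concatMap (λ i → map (λ j → (i , j)) (allFin n)) (allFin n)) (λ ij → s (proj₁ ij) (proj₂ ij))
    ≡⟨ ∏-concatMap (λ i → map (λ j → (i , j)) (allFin n)) (allFin n) _ ⟩
  ∏ (allFin n) (λ i → ∏ (map (λ j → (i , j)) (allFin n)) (λ ij → s (proj₁ ij) (proj₂ ij)))
    ≡⟨ ∏-cong (allFin n) (λ i → ∏-map (λ j → (i , j)) (allFin n) _) ⟩
  ∏ (allFin n) (λ i → ∏ (allFin n) (s i))
    ≡⟨ pairs n (toℕ ∘ (g ⟨$⟩ʳ_)) ⟩
  wordSign n (toℕ ∘ (g ⟨$⟩ʳ_)) ∎
  where
  s : Fin n → Fin n → ℤ
  s i j = sign (does (i Fin.<? j) ∧ does ((g ⟨$⟩ʳ j) Fin.<? (g ⟨$⟩ʳ i)))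
  pairs : ∀ k (w : Fin k → ℕ) →
    ∏ (allFin k) (λ i → ∏ (allFin k) (λ j → sign (does (i Fin.<? j) ∧ does (w j ℕ.<? w i)))) ≡ wordSign k w
  pairs zero    w = refl
  pairs (suc k) w = trans
    (∏-allFin-suc k (λ i → ∏ (allFin (suc k)) (λ j → sign (does (i Fin.<? j) ∧ does (w j ℕ.<? w i))))) (cong₂ _*_
    (trans (∏-allFin-suc k (λ j → sign (does (Fin.zero {k} Fin.<? j) ∧ does (w j ℕ.<? w zero))))
           (ℤₚ.*-identityˡ (below (w zero) (w ∘ suc))))
    (trans (∏-cong (allFin k) (λ i → trans
             (∏-allFin-suc k (λ j → sign (does (suc i Fin.<? j) ∧ does (w j ℕ.<? w (suc i)))))
             (ℤₚ.*-identityˡ (∏ (allFin k) (λ j → sign (does (i Fin.<? j) ∧ does (w (suc j) ℕ.<? w (suc i))))))))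
           (pairs k (w ∘ suc))))

sign-true : ∀ {P : Set} (d : Dec P) → P → sign (does d) ≡ - 1ℤ
sign-true (yes _) p = refl
sign-true (no ¬p) p = ⊥-elim (¬p p)

sign-false : ∀ {P : Set} (d : Dec P) → ¬ P → sign (does d) ≡ 1ℤ
sign-false (yes p) ¬p = ⊥-elim (¬p p)
sign-false (no _)  ¬p = refl

sign-< : ∀ {a b} → a ℕ.< b → sign (does (a ℕ.<? b)) ≡ - 1ℤ
sign-< {a} {b} = sign-true (a ℕ.<? b)

sign-≮ : ∀ {a b} → ¬ a ℕ.< b → sign (does (a ℕ.<? b)) ≡ 1ℤ
sign-≮ {a} {b} = sign-false (a ℕ.<? b)

sign-flip : ∀ {a b} → a ≢ b → sign (does (a ℕ.<? b)) ≡ - sign (does (b ℕ.<? a))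
sign-flip {a} {b} a≢b with ℕₚ.<-cmp a b
... | Tri.tri< a<b _ b≮a = trans (sign-< a<b) (cong -_ (sym (sign-≮ b≮a)))
... | Tri.tri≈ _ a≡b _   = ⊥-elim (a≢b a≡b)
... | Tri.tri> a≮b _ b<a = trans (sign-≮ a≮b) (cong -_ (sym (sign-< b<a)))

below-zero : ∀ {k} (w : Fin k → ℕ) → below 0 w ≡ 1ℤ
below-zero {k} w = ∏-≡1 (allFin k) (λ j → sign-≮ {w j} {0} (λ ()))

-- The situation of `g` and `h` when `zero` is not fixed: `w` is the one-line notation of `g` after
-- its first letter `r`, and `v` is that of `h` raised by one.
record ReplacesZero {k} (r : ℕ) (w v : Fin k → ℕ) (q : Fin k) : Set where
  field
    old   : w q ≡ 0
    new   : v q ≡ r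
    same  : ∀ j → j ≢ q → v j ≡ w j
    other : ∀ j → j ≢ q → w j ≢ 0
    fresh : ∀ j → w j ≢ r

suc-≢ : ∀ {k} {i j : Fin k} → i ≢ j → Fin.suc i ≢ suc j
suc-≢ i≢j e = i≢j (Finₚ.suc-injective e)

replacesZero-tail : ∀ {k r} {w v : Fin (suc k) → ℕ} {q} →
                    ReplacesZero r w v (suc q) → ReplacesZero r (w ∘ suc) (v ∘ suc) q
replacesZero-tail ρ = record
  { old = old ; new = new ; same = λ j → same (suc j) ∘ suc-≢ ; other = λ j → other (suc j) ∘ suc-≢
  ; fresh = fresh ∘ suc }
  where open ReplacesZero ρ

-- The letter 0 is below `x`, and so is its replacement `r` unless `x < r`. The count of letters
-- below `x` thus changes parity exactly when `x < r`.
below-replace : ∀ {k r x} {w v : Fin k → ℕ} {q} → ReplacesZero r w v q → x ≢ 0 → x ≢ r →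
                below x v ≡ sign (does (x ℕ.<? r)) * below x w
below-replace {r = r} {x} {w} {v} {zero} ρ x≢0 x≢r = begin
  below x v
    ≡⟨ below-suc x v ⟩
  sign (does (v zero ℕ.<? x)) * below x (v ∘ suc)
    ≡⟨ cong₂ _*_ (trans (cong (λ c → sign (does (c ℕ.<? x))) new) (sign-flip (x≢r ∘ sym)))
                 (below-cong {a = x} refl (λ j → same (suc j) (λ ()))) ⟩
  - s * below x (w ∘ suc)
    ≡⟨ move s (below x (w ∘ suc)) ⟩
  s * (- 1ℤ * below x (w ∘ suc))
    ≡⟨ cong (λ c → s * (c * below x (w ∘ suc))) (sym (sign-< (subst (ℕ._< x) (sym old) (ℕₚ.n≢0⇒n>0 x≢0)))) ⟩
  s * (sign (does (w zero ℕ.<? x)) * below x (w ∘ suc))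
    ≡⟨ cong (s *_) (sym (below-suc x w)) ⟩
  s * below x w ∎
  where
  open ReplacesZero ρ
  s = sign (does (x ℕ.<? r))
  move : ∀ a b → - a * b ≡ a * (- 1ℤ * b)
  move = solve-∀
below-replace {r = r} {x} {w} {v} {suc q} ρ x≢0 x≢r = begin
  below x v
    ≡⟨ below-suc x v ⟩
  sign (does (v zero ℕ.<? x)) * below x (v ∘ suc)
    ≡⟨ cong₂ _*_ (cong (λ c → sign (does (c ℕ.<? x))) (same zero (λ ())))
                 (below-replace (replacesZero-tail ρ) x≢0 x≢r) ⟩
  t * (s * below x (w ∘ suc))
    ≡⟨ x∙yz≈y∙xz t s (below x (w ∘ suc)) ⟩
  s * (t * below x (w ∘ suc))
    ≡⟨ cong (s *_) (sym (below-suc x w)) ⟩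
  s * below x w ∎
  where
  open ReplacesZero ρ
  s = sign (does (x ℕ.<? r))
  t = sign (does (w zero ℕ.<? x))

-- Every letter below `r` other than the replaced zero changes the sign once: those before position
-- `q` by `below-replace`, those after it as inversions with the new letter `r`. Since `below r w`
-- counts the zero as well, a minus sign remains.
wordSign-replace : ∀ k {r} {w v : Fin k → ℕ} {q} → ReplacesZero r w v q →
                   wordSign k v ≡ - (below r w * wordSign k w)
wordSign-replace (suc k) {r} {w} {v} {zero} ρ = begin
  below (v zero) (v ∘ suc) * wordSign k (v ∘ suc)
    ≡⟨ cong₂ _*_ (below-cong new tails) (wordSign-cong k tails) ⟩
  b * u
    ≡⟨ move b u ⟩
  - (- 1ℤ * b * (1ℤ * u))
    ≡⟨ cong -_ (cong₂ _*_
         (sym (trans (below-suc r w) (cong (_* b) (sign-< {w zero} {r}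
           (subst (ℕ._< r) (sym old) (ℕₚ.n≢0⇒n>0 (λ r≡0 → fresh zero (trans old (sym r≡0)))))))))
         (cong (_* u) (sym (trans (cong (λ c → below c (w ∘ suc)) old) (below-zero (w ∘ suc)))))) ⟩
  - (below r w * wordSign (suc k) w) ∎
  where
  open ReplacesZero ρ
  tails = λ j → same (suc j) (λ ())
  b = below r (w ∘ suc)
  u = wordSign k (w ∘ suc)
  move : ∀ b u → b * u ≡ - (- 1ℤ * b * (1ℤ * u))
  move = solve-∀
wordSign-replace (suc k) {r} {w} {v} {suc q} ρ = begin
  below (v zero) (v ∘ suc) * wordSign k (v ∘ suc)
    ≡⟨ cong₂ _*_ (trans (cong (λ c → below c (v ∘ suc)) (same zero (λ ())))
                        (below-replace (replacesZero-tail ρ) (other zero (λ ())) (fresh zero)))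
                 (wordSign-replace k (replacesZero-tail ρ)) ⟩
  s * below (w zero) (w ∘ suc) * - (below r (w ∘ suc) * wordSign k (w ∘ suc))
    ≡⟨ move s (below (w zero) (w ∘ suc)) (below r (w ∘ suc)) (wordSign k (w ∘ suc)) ⟩
  - (s * below r (w ∘ suc) * wordSign (suc k) w)
    ≡⟨ cong (λ c → - (c * wordSign (suc k) w)) (sym (below-suc r w)) ⟩
  - (below r w * wordSign (suc k) w) ∎
  where
  open ReplacesZero ρ
  s = sign (does (w zero ℕ.<? r))
  move : ∀ s a b u → s * a * - (b * u) ≡ - (s * b * (a * u))
  move = solve-∀

isZero : ∀ {n} → Fin n → Bool
isZero zero    = true
isZero (suc _) = false

-- If `zero` is moved, its image as first letter contributes the factor `below`, the same factor
-- that the replacement of the zero produces; only the minus sign of `wordSign-replace` is left. If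
-- `zero` is fixed, the first letter has no inversions.
sgn-cutZero : ∀ {n} (g : Permutation′ (suc n)) h → CutsZero g h → sgn g ≡ - sign (isZero (g ⟨$⟩ʳ zero)) * sgn h
sgn-cutZero {n} g h cut with g ⟨$⟩ʳ zero in g0
... | zero = begin
  sgn g
    ≡⟨ sgn≡wordSign g ⟩
  below (toℕ (g ⟨$⟩ʳ zero)) (toℕ ∘ (g ⟨$⟩ʳ_) ∘ suc) * wordSign n (toℕ ∘ (g ⟨$⟩ʳ_) ∘ suc)
    ≡⟨ cong₂ _*_ (trans (cong (λ c → below (toℕ c) (toℕ ∘ (g ⟨$⟩ʳ_) ∘ suc)) g0)
                        (below-zero (toℕ ∘ (g ⟨$⟩ʳ_) ∘ suc)))
                 (wordSign-cong n (λ j → cong toℕ (sym (CutsZero.agree cut j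
                   (λ gj≡0 → case permutation-injective g (trans gj≡0 (sym g0)) of λ ()))))) ⟩
  1ℤ * wordSign n (suc ∘ toℕ ∘ (h ⟨$⟩ʳ_))
    ≡⟨ cong (1ℤ *_) (trans (wordSign-suc n (toℕ ∘ (h ⟨$⟩ʳ_))) (sym (sgn≡wordSign h))) ⟩
  1ℤ * sgn h ∎
... | suc r = begin
  sgn g
    ≡⟨ sgn≡wordSign g ⟩
  below (toℕ (g ⟨$⟩ʳ zero)) w * wordSign n w
    ≡⟨ cong (λ c → below (toℕ c) w * wordSign n w) g0 ⟩
  below (suc (toℕ r)) w * wordSign n w
    ≡⟨ sym (ℤₚ.neg-involutive (below (suc (toℕ r)) w * wordSign n w)) ⟩
  - - (below (suc (toℕ r)) w * wordSign n w)
    ≡⟨ cong -_ (sym (wordSign-replace n replaces)) ⟩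
  - wordSign n (suc ∘ toℕ ∘ (h ⟨$⟩ʳ_))
    ≡⟨ cong -_ (trans (wordSign-suc n (toℕ ∘ (h ⟨$⟩ʳ_))) (sym (sgn≡wordSign h))) ⟩
  - sgn h
    ≡⟨ sym (ℤₚ.-1*i≡-i (sgn h)) ⟩
  - 1ℤ * sgn h ∎
  where
  w : Fin n → ℕ
  w = toℕ ∘ (g ⟨$⟩ʳ_) ∘ suc
  preimage : ∀ x → g ⟨$⟩ʳ x ≡ zero → ∃ λ q → g ⟨$⟩ʳ suc q ≡ zero
  preimage zero    e = case trans (sym g0) e of λ ()
  preimage (suc q) e = q , e
  zero-at = preimage (g ⟨$⟩ˡ zero) (inverseʳ g)
  q = proj₁ zero-at
  gq≡0 = proj₂ zero-at
  nonzero : ∀ j → j ≢ q → g ⟨$⟩ʳ suc j ≢ zero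
  nonzero j j≢q gj≡0 = suc-≢ j≢q (permutation-injective g (trans gj≡0 (sym gq≡0)))
  replaces : ReplacesZero (suc (toℕ r)) w (suc ∘ toℕ ∘ (h ⟨$⟩ʳ_)) q
  replaces = record
    { old   = cong toℕ gq≡0
    ; new   = cong toℕ (trans (CutsZero.redirect cut q gq≡0) g0)
    ; same  = λ j j≢q → cong toℕ (CutsZero.agree cut j (nonzero j j≢q))
    ; other = λ j j≢q wj≡0 → nonzero j j≢q (Finₚ.toℕ-injective wj≡0)
    ; fresh = λ j wj≡r → case permutation-injective g (trans (Finₚ.toℕ-injective wj≡r) (sym g0)) of λ () }

isOrbit-image : ∀ {n} {g : Permutation′ n} {m O} → IsOrbit g (g ⟨$⟩ʳ m) O → IsOrbit g m O
isOrbit-image {m = m} orb = record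
  { point = subst T (invariant m) point
  ; invariant = invariant
  ; least = λ P f b Pm → least P f b (f m Pm) }
  where open IsOrbit orb

module _ {n} {g : Permutation′ (suc n)} {h : Permutation′ n} (cut : CutsZero g h) where
  open CutsZero cut

  -- The membership of `zero` in a lifted orbit is that of its image. When `zero` is fixed it forms
  -- an orbit of its own and belongs to no lifted one.
  headOf : Fin (suc n) → Vec Bool n → Bool
  headOf zero    O = false
  headOf (suc r) O = lookup O r

  isOrbit-lift : ∀ {y O} → IsOrbit h y O → IsOrbit g (suc y) (headOf (g ⟨$⟩ʳ zero) O ∷ O)
  isOrbit-lift {y} {O} orb = record { point = O.point ; invariant = inv ; least = least′ }
    where
    module O = IsOrbit orb
    O⁺ = headOf (g ⟨$⟩ʳ zero) O ∷ O
    inv : ∀ x → lookup O⁺ (g ⟨$⟩ʳ x) ≡ lookup O⁺ x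
    inv zero with g ⟨$⟩ʳ zero
    ... | zero  = refl
    ... | suc r = refl
    inv (suc z) with (g ⟨$⟩ʳ suc z) Fin.≟ zero
    ... | no gz≢0 = trans (cong (lookup O⁺) (sym (agree z gz≢0))) (O.invariant z)
    ... | yes gz≡0 = begin
      lookup O⁺ (g ⟨$⟩ʳ suc z)          ≡⟨ cong (lookup O⁺) gz≡0 ⟩
      headOf (g ⟨$⟩ʳ zero) O            ≡⟨ cong (λ c → headOf c O) (sym (redirect z gz≡0)) ⟩
      lookup O (h ⟨$⟩ʳ z)               ≡⟨ O.invariant z ⟩
      lookup O z                        ∎
    least′ : ∀ (P : Fin (suc n) → Set) → (∀ x → P x → P (g ⟨$⟩ʳ x)) → (∀ x → P (g ⟨$⟩ʳ x) → P x) →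
             P (suc y) → ∀ x → x ∈ O⁺ → P x
    least′ P f b Py = below′
      where
      -- One step of `h` is one step of `g`, or two when `g` passes through `zero`; a predicate
      -- closed under `g` is therefore closed under `h` on successors.
      forward : ∀ z → P (suc z) → P (suc (h ⟨$⟩ʳ z))
      forward z Pz with (g ⟨$⟩ʳ suc z) Fin.≟ zero
      ... | no gz≢0  = subst P (sym (agree z gz≢0)) (f (suc z) Pz)
      ... | yes gz≡0 = subst P (sym (redirect z gz≡0)) (f zero (subst P gz≡0 (f (suc z) Pz)))
      backward : ∀ z → P (suc (h ⟨$⟩ʳ z)) → P (suc z)
      backward z Phz with (g ⟨$⟩ʳ suc z) Fin.≟ zero
      ... | no gz≢0  = b (suc z) (subst P (agree z gz≢0) Phz)
      ... | yes gz≡0 = b (suc z) (subst P (sym gz≡0) (b zero (subst P (redirect z gz≡0) Phz)))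
      inner = O.least (P ∘ suc) forward backward Py
      below′ : ∀ x → x ∈ O⁺ → P x
      below′ (suc z) z∈O = inner z z∈O
      below′ zero    h∈ with g ⟨$⟩ʳ zero in g0
      ... | suc r = b zero (subst P (sym g0) (inner r h∈))

-- `R` marks the elements that have become fixed points once all smaller ones are cut out, that is,
-- the greatest element of every orbit. Cutting thus constructs the representatives, the orbits and
-- the sign in one induction.
∃-orbits : ∀ n (g : Permutation′ n) → ∃ λ R → ε R ⊤ ≡ negOnePow n * sgn g
             × (∀ m → ∃ λ O → IsOrbit g m O × ε R O ≡ - 1ℤ)
∃-orbits zero    g = [] , refl , λ ()
∃-orbits (suc n) g = isZero (g ⟨$⟩ʳ zero) ∷ R , total , orbits
  where
  h   = proj₁ (cutZero g)
  cut = proj₂ (cutZero g)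
  ih  = ∃-orbits n h
  R   = proj₁ ih
  s   = sign (isZero (g ⟨$⟩ʳ zero))

  total : sign (isZero (g ⟨$⟩ʳ zero) ∧ true) * ε R ⊤ ≡ - negOnePow n * sgn g
  total = begin
    sign (isZero (g ⟨$⟩ʳ zero) ∧ true) * ε R ⊤
      ≡⟨ cong₂ _*_ (cong sign (Boolₚ.∧-identityʳ (isZero (g ⟨$⟩ʳ zero)))) (proj₁ (proj₂ ih)) ⟩
    s * (negOnePow n * sgn h)
      ≡⟨ move s (negOnePow n) (sgn h) ⟩
    - negOnePow n * (- s * sgn h)
      ≡⟨ cong (- negOnePow n *_) (sym (sgn-cutZero g h cut)) ⟩
    - negOnePow n * sgn g ∎
    where
    move : ∀ a b c → a * (b * c) ≡ - b * (- a * c)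
    move = solve-∀

  lifted : ∀ y → ∃ λ O → IsOrbit g (suc y) O × ε (isZero (g ⟨$⟩ʳ zero) ∷ R) O ≡ - 1ℤ
  lifted y = _ , isOrbit-lift cut (proj₁ (proj₂ (proj₂ (proj₂ ih) y))) ,
    trans (cong (λ c → sign c * ε R O) (no-head (g ⟨$⟩ʳ zero)))
          (trans (ℤₚ.*-identityˡ (ε R O)) (proj₂ (proj₂ (proj₂ (proj₂ ih) y))))
    where
    O = proj₁ (proj₂ (proj₂ ih) y)
    -- `zero` is in the new `R` only if it is fixed, and then it is in no lifted orbit; so lifting
    -- preserves the sign.
    no-head : ∀ c → isZero c ∧ headOf cut c O ≡ false
    no-head zero    = refl
    no-head (suc _) = refl

  orbits : ∀ m → ∃ λ O → IsOrbit g m O × ε (isZero (g ⟨$⟩ʳ zero) ∷ R) O ≡ - 1ℤ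
  orbits (suc y) = lifted y
  orbits zero = from-image (g ⟨$⟩ʳ zero) refl
    where
    from-image : ∀ c → g ⟨$⟩ʳ zero ≡ c → ∃ λ O → IsOrbit g zero O × ε (isZero (g ⟨$⟩ʳ zero) ∷ R) O ≡ - 1ℤ
    from-image (suc r) g0 = let (O , orb , e) = lifted r in
      O , isOrbit-image (subst (λ c → IsOrbit g c O) (sym g0) orb) , e
    from-image zero g0 = true ∷ ⊥ , record
      { point = tt
      ; invariant = inv
      ; least = λ { P f b P0 zero _ → P0
                  ; P f b P0 (suc z) z∈⊥ → ⊥-elim (subst T (Vecₚ.lookup-replicate z false) z∈⊥) } } ,
      trans (cong (λ c → sign (isZero c ∧ true) * ε R ⊥) g0) (cong (- 1ℤ *_) (ε-⊥ R))
      where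
      inv : ∀ x → lookup (true ∷ ⊥) (g ⟨$⟩ʳ x) ≡ lookup (true ∷ ⊥) x
      inv zero    = cong (lookup (true ∷ ⊥)) g0
      inv (suc z) with g ⟨$⟩ʳ suc z in gz
      ... | zero  = case permutation-injective g (trans gz (sym g0)) of λ ()
      ... | suc y = trans (Vecₚ.lookup-replicate y false) (sym (Vecₚ.lookup-replicate z false))

-- Newton series

binomial⁺ : ℕ → ℕ → ℤ
binomial⁺ zero    zero    = 1ℤ
binomial⁺ zero    (suc j) = 0ℤ
binomial⁺ (suc m) zero    = 1ℤ
binomial⁺ (suc m) (suc j) = binomial⁺ m (suc j) + binomial⁺ m j

-- binomial⁻ m j is the binomial coefficient of -m over j.
binomial⁻ : ℕ → ℕ → ℤ
binomial⁻ zero    j       = binomial⁺ zero j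
binomial⁻ (suc m) zero    = 1ℤ
binomial⁻ (suc m) (suc j) = binomial⁻ m (suc j) + - binomial⁻ (suc m) j

-- `b` and `b′` stand for the binomial coefficients with upper argument `x` and `x + 1`. The
-- instances are `x = m` and `x = -(m + 1)`, which lets one lemma treat both signs.
Pascal : (ℕ → ℤ) → (ℕ → ℤ) → Set
Pascal b′ b = b′ 0 ≡ b 0 × (∀ j → b′ (suc j) ≡ b (suc j) + b j)

binomial⁺-pascal : ∀ m → Pascal (binomial⁺ (suc m)) (binomial⁺ m)
binomial⁺-pascal zero    = refl , λ j → refl
binomial⁺-pascal (suc m) = refl , λ j → refl

binomial⁻-pascal : ∀ m → Pascal (binomial⁻ m) (binomial⁻ (suc m))
binomial⁻-pascal m = head m , λ j → cancel (binomial⁻ m (suc j)) (binomial⁻ (suc m) j)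
  where
  head : ∀ m → binomial⁻ m 0 ≡ 1ℤ
  head zero    = refl
  head (suc m) = refl
  cancel : ∀ a b → a ≡ a + - b + b
  cancel = solve-∀

∑-allFin-snoc : ∀ N (f : ℕ → ℤ) → ∑ (allFin (suc N)) (f ∘ toℕ) ≡ ∑ (allFin N) (f ∘ toℕ) + f N
∑-allFin-snoc zero    f = trans (ℤₚ.+-identityʳ (f 0)) (sym (ℤₚ.+-identityˡ (f 0)))
∑-allFin-snoc (suc N) f = begin
  ∑ (allFin (suc (suc N))) (f ∘ toℕ)
    ≡⟨ ∑-allFin-suc (suc N) (f ∘ toℕ) ⟩
  f 0 + ∑ (allFin (suc N)) (f ∘ suc ∘ toℕ)
    ≡⟨ cong (_+_ (f 0)) (∑-allFin-snoc N (f ∘ suc)) ⟩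
  f 0 + (∑ (allFin N) (f ∘ suc ∘ toℕ) + f (suc N))
    ≡⟨ sym (ℤₚ.+-assoc (f 0) (∑ (allFin N) (f ∘ suc ∘ toℕ)) (f (suc N))) ⟩
  f 0 + ∑ (allFin N) (f ∘ suc ∘ toℕ) + f (suc N)
    ≡⟨ cong (λ z → z + f (suc N)) (sym (∑-allFin-suc N (f ∘ toℕ))) ⟩
  ∑ (allFin (suc N)) (f ∘ toℕ) + f (suc N) ∎

module Newton {n} (le₁ le₂ : BRel n) (g : Permutation′ n) where
  open Partitions le₁ g
  open Chains le₁ g
  private Ss = subsets n

  -- η is nilpotent, so ζᵐ = (1 + η)ᵐ is the Newton series below, a polynomial in m.
  difference : ℕ → Vec Bool n → ℤ
  difference zero    I = full I
  difference (suc j) I = ∑ Ss (λ K → η le₂ I K * difference j K)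

  newton : (ℕ → ℤ) → Vec Bool n → ℤ
  newton b I = ∑ (allFin (suc n)) (λ j → b (toℕ j) * difference (toℕ j) I)

  η-cong : ∀ {I K x y} → (∣ I ∣ ℕ.< ∣ K ∣ → x ≡ y) → η le₂ I K * x ≡ η le₂ I K * y
  η-cong {I} {K} {x} {y} e = begin
    η le₂ I K * x
      ≡⟨ cong (_* x) (sym (χ-× (¬? (K ≟ˢ I)) (step? le₂ I K))) ⟩
    χ (¬? (K ≟ˢ I) ×-dec step? le₂ I K) * x
      ≡⟨ χ-*-cong (¬? (K ≟ˢ I) ×-dec step? le₂ I K) (λ (K≢I , S) →
           e (ℕₚ.≤∧≢⇒< (⊆⇒∣∣≤ I K (Step.sub S)) (K≢I ∘ sym ∘ ⊆∧∣∣≡⇒≡ I K (Step.sub S)))) ⟩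
    χ (¬? (K ≟ˢ I) ×-dec step? le₂ I K) * y
      ≡⟨ cong (_* y) (χ-× (¬? (K ≟ˢ I)) (step? le₂ I K)) ⟩
    η le₂ I K * y ∎

  -- Every strict step adds an element, so `j` of them starting from `I` need room for `∣ I ∣ + j`
  -- elements. This is why `newton` may stop at index `n`.
  difference-vanishes : ∀ j I → n ℕ.< ∣ I ∣ ℕ.+ j → difference j I ≡ 0ℤ
  difference-vanishes zero    I h =
    ⊥-elim (ℕₚ.<⇒≱ (subst (n ℕ.<_) (ℕₚ.+-identityʳ ∣ I ∣) h) (∣p∣≤n I))
  difference-vanishes (suc j) I h = ∑-≡0 Ss (λ K → trans
    (η-cong {I} {K} (λ I<K → difference-vanishes j K (ℕₚ.<-≤-trans h
      (ℕₚ.≤-trans (ℕₚ.≤-reflexive (ℕₚ.+-suc ∣ I ∣ j)) (ℕₚ.+-monoˡ-≤ j I<K)))))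
    (ℤₚ.*-zeroʳ (η le₂ I K)))

  -- Pascal's rule is multiplication of the Newton series by `1 + η`, which is `ζ` on the rows of
  -- good sets.
  newton-pascal : ∀ b′ b → Pascal b′ b → ∀ I → Good I →
                  newton b′ I ≡ ∑ Ss (λ K → ζ le₂ I K * newton b K)
  newton-pascal b′ b (e₀ , e) I G = begin
    newton b′ I
      ≡⟨ ∑-allFin-suc n (λ j → b′ (toℕ j) * difference (toℕ j) I) ⟩
    b′ 0 * full I + ∑ Fs (λ j → b′ (suc (toℕ j)) * difference (suc (toℕ j)) I)
      ≡⟨ cong₂ _+_ (cong (_* full I) e₀) (trans
           (∑-cong Fs (λ j → trans (cong (_* difference (suc (toℕ j)) I) (e (toℕ j)))
             (ℤₚ.*-distribʳ-+ (difference (suc (toℕ j)) I) (b (suc (toℕ j))) (b (toℕ j)))))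
           (∑-distrib-+ Fs _ _)) ⟩
    b 0 * full I + (∑ Fs (λ j → b (suc (toℕ j)) * difference (suc (toℕ j)) I) + rest)
      ≡⟨ sym (ℤₚ.+-assoc (b 0 * full I) _ rest) ⟩
    b 0 * full I + ∑ Fs (λ j → b (suc (toℕ j)) * difference (suc (toℕ j)) I) + rest
      ≡⟨ cong₂ _+_ (sym (∑-allFin-suc n (λ j → b (toℕ j) * difference (toℕ j) I))) shift ⟩
    newton b I + ∑ Ss (λ K → η le₂ I K * newton b K)
      ≡⟨ sym (∑-ζ-split le₂ G (newton b)) ⟩
    ∑ Ss (λ K → ζ le₂ I K * newton b K) ∎
    where
    Fs = allFin n
    rest = ∑ Fs (λ j → b (toℕ j) * difference (suc (toℕ j)) I)
    -- The index shift loses the top term of the series at `K`. It is 0, because `K` strictly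
    -- contains a set and so is nonempty.
    truncate : ∀ K → ∣ I ∣ ℕ.< ∣ K ∣ → ∑ Fs (λ j → b (toℕ j) * difference (toℕ j) K) ≡ newton b K
    truncate K I<K = begin
      ∑ Fs (λ j → b (toℕ j) * difference (toℕ j) K)
        ≡⟨ sym (ℤₚ.+-identityʳ _) ⟩
      ∑ Fs (λ j → b (toℕ j) * difference (toℕ j) K) + 0ℤ
        ≡⟨ cong (_+_ (∑ Fs (λ j → b (toℕ j) * difference (toℕ j) K)))
             (sym (trans (cong (b n *_) (difference-vanishes n K (ℕₚ.m<n+m n (ℕₚ.≤-<-trans z≤n I<K))))
                         (ℤₚ.*-zeroʳ (b n)))) ⟩
      ∑ Fs (λ j → b (toℕ j) * difference (toℕ j) K) + b n * difference n K
        ≡⟨ sym (∑-allFin-snoc n (λ j → b j * difference j K)) ⟩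
      newton b K ∎
    shift : rest ≡ ∑ Ss (λ K → η le₂ I K * newton b K)
    shift = begin
      rest
        ≡⟨ ∑-cong Fs (λ j → trans (*-distribˡ-∑ Ss (b (toℕ j)) (λ K → η le₂ I K * difference (toℕ j) K))
             (∑-cong Ss (λ K → x∙yz≈y∙xz (b (toℕ j)) (η le₂ I K) (difference (toℕ j) K)))) ⟩
      ∑ Fs (λ j → ∑ Ss (λ K → η le₂ I K * (b (toℕ j) * difference (toℕ j) K)))
        ≡⟨ ∑-swap Fs Ss _ ⟩
      ∑ Ss (λ K → ∑ Fs (λ j → η le₂ I K * (b (toℕ j) * difference (toℕ j) K)))
        ≡⟨ ∑-cong Ss (λ K → trans
             (sym (*-distribˡ-∑ Fs (η le₂ I K) (λ j → b (toℕ j) * difference (toℕ j) K)))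
             (η-cong {I} {K} (truncate K))) ⟩
      ∑ Ss (λ K → η le₂ I K * newton b K) ∎

  newton-zero : ∀ I → newton (binomial⁺ 0) I ≡ full I
  newton-zero I = begin
    newton (binomial⁺ 0) I
      ≡⟨ ∑-allFin-suc n (λ j → binomial⁺ 0 (toℕ j) * difference (toℕ j) I) ⟩
    1ℤ * full I + ∑ (allFin n) (λ j → 0ℤ * difference (suc (toℕ j)) I)
      ≡⟨ cong₂ _+_ (ℤₚ.*-identityˡ (full I)) (∑-≡0 (allFin n) (λ j → refl)) ⟩
    full I + 0ℤ
      ≡⟨ ℤₚ.+-identityʳ (full I) ⟩
    full I ∎

  newton-binomial⁺ : ∀ m I → Good I → newton (binomial⁺ m) I ≡ power le₂ m full I
  newton-binomial⁺ zero    I G = newton-zero I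
  newton-binomial⁺ (suc m) I G = trans (newton-pascal (binomial⁺ (suc m)) (binomial⁺ m) (binomial⁺-pascal m) I G)
    (∑-cong Ss (λ K → χ-*-cong (step? le₂ I K) (λ S → newton-binomial⁺ m K (Step.target S))))

  module _ (R : Vec Bool n)
    (convolution : ∀ I J → I ≢ J → ∑ Ss (λ K → ε R K * (ζ (flip le₂) I K * ζ le₂ K J)) ≡ 0ℤ) where
    open Inversion le₁ (flip le₂) g R convolution using (ζ-inverse)

    -- `newton-pascal` says that `ζ` takes the series at `-(m + 1)` to the one at `-m`. To solve for
    -- the former, `ζ` has to be cancelled from the left; hence the convolution is required with
    -- `flip le₂` as its first factor.
    newton-binomial⁻ : ∀ m I → Good I →
      newton (binomial⁻ m) I ≡ ε R I * power (flip le₂) m (λ J → ε R J * full J) I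
    newton-binomial⁻ zero I G = begin
      newton (binomial⁺ 0) I           ≡⟨ newton-zero I ⟩
      full I                           ≡⟨ sym (ℤₚ.*-identityˡ (full I)) ⟩
      1ℤ * full I                      ≡⟨ cong (_* full I) (sym (ε-square R I)) ⟩
      ε R I * ε R I * full I           ≡⟨ ℤₚ.*-assoc (ε R I) (ε R I) (full I) ⟩
      ε R I * (ε R I * full I)         ∎
    newton-binomial⁻ (suc m) I G = begin
      F I
        ≡⟨ sym (ℤₚ.*-identityˡ (F I)) ⟩
      1ℤ * F I
        ≡⟨ cong (_* F I) (sym (ε-square R I)) ⟩
      ε R I * ε R I * F I
        ≡⟨ ℤₚ.*-assoc (ε R I) (ε R I) (F I) ⟩
      ε R I * (ε R I * F I)
        ≡⟨ cong (ε R I *_) (sym (ζ-inverse I G F)) ⟩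
      ε R I * ∑ Ss (λ K → ζ (flip le₂) I K * (ε R K * ∑ Ss (λ J → ζ le₂ K J * F J)))
        ≡⟨ cong (ε R I *_) (∑-cong Ss (λ K → χ-*-cong (step? (flip le₂) I K) (λ S → begin
             ε R K * ∑ Ss (λ J → ζ le₂ K J * F J)
               ≡⟨ cong (ε R K *_) (sym (newton-pascal (binomial⁻ m) (binomial⁻ (suc m)) (binomial⁻-pascal m) K (Step.target S))) ⟩
             ε R K * newton (binomial⁻ m) K
               ≡⟨ cong (ε R K *_) (newton-binomial⁻ m K (Step.target S)) ⟩
             ε R K * (ε R K * p K)
               ≡⟨ sym (ℤₚ.*-assoc (ε R K) (ε R K) (p K)) ⟩
             ε R K * ε R K * p K
               ≡⟨ cong (_* p K) (ε-square R K) ⟩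
             1ℤ * p K
               ≡⟨ ℤₚ.*-identityˡ (p K) ⟩
             p K ∎))) ⟩
      ε R I * power (flip le₂) (suc m) (λ J → ε R J * full J) I ∎
      where
      F = newton (binomial⁻ (suc m))
      p = power (flip le₂) m (λ J → ε R J * full J)

-- Polynomials over ℚ

toℚᵘ-ℤtoℚ : ∀ z → ℚ.toℚᵘ (ℤtoℚ z) ℚᵘ.≃ ℚᵘ.mkℚᵘ z 0
toℚᵘ-ℤtoℚ z = ℚₚ.toℚᵘ-fromℚᵘ (ℚᵘ.mkℚᵘ z 0)

ℤtoℚ-+ : ∀ a b → ℤtoℚ (a + b) ≡ ℤtoℚ a ℚ.+ ℤtoℚ b
ℤtoℚ-+ a b = ℚₚ.toℚᵘ-injective (ℚᵘₚ.≃-trans (toℚᵘ-ℤtoℚ (a + b)) (ℚᵘₚ.≃-trans (ℚᵘ.*≡* (normalise a b))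
  (ℚᵘₚ.≃-sym (ℚᵘₚ.≃-trans (ℚₚ.toℚᵘ-homo-+ (ℤtoℚ a) (ℤtoℚ b)) (ℚᵘₚ.+-cong (toℚᵘ-ℤtoℚ a) (toℚᵘ-ℤtoℚ b))))))
  where
  normalise : ∀ a b → (a + b) * 1ℤ ≡ (a * 1ℤ + b * 1ℤ) * 1ℤ
  normalise = solve-∀

ℤtoℚ-* : ∀ a b → ℤtoℚ (a * b) ≡ ℤtoℚ a ℚ.* ℤtoℚ b
ℤtoℚ-* a b = ℚₚ.toℚᵘ-injective (ℚᵘₚ.≃-trans (toℚᵘ-ℤtoℚ (a * b)) (ℚᵘₚ.≃-trans (ℚᵘ.*≡* refl)
  (ℚᵘₚ.≃-sym (ℚᵘₚ.≃-trans (ℚₚ.toℚᵘ-homo-* (ℤtoℚ a) (ℤtoℚ b)) (ℚᵘₚ.*-cong (toℚᵘ-ℤtoℚ a) (toℚᵘ-ℤtoℚ b))))))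

ℤtoℚ-neg : ∀ a → ℤtoℚ (- a) ≡ ℚ.- ℤtoℚ a
ℤtoℚ-neg a = ℚₚ.toℚᵘ-injective (ℚᵘₚ.≃-trans (toℚᵘ-ℤtoℚ (- a))
  (ℚᵘₚ.≃-sym (ℚᵘₚ.≃-trans (ℚₚ.toℚᵘ-homo‿- (ℤtoℚ a)) (ℚᵘₚ.-‿cong (toℚᵘ-ℤtoℚ a)))))

ℕtoℚ-suc : ∀ m → ℕtoℚ (suc m) ≡ ℕtoℚ m ℚ.+ 1ℚ
ℕtoℚ-suc m = trans (cong (ℤtoℚ ∘ +_) (ℕₚ.+-comm 1 m)) (trans (cong ℤtoℚ (ℤₚ.pos-+ m 1)) (ℤtoℚ-+ (+ m) 1ℤ))

1/suc : ℕ → ℚ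
1/suc j = 1ℤ ℚ./ suc j

1/suc-* : ∀ j → 1/suc j ℚ.* ℕtoℚ (suc j) ≡ 1ℚ
1/suc-* j = ℚₚ.toℚᵘ-injective (ℚᵘₚ.≃-trans (ℚₚ.toℚᵘ-homo-* (1/suc j) (ℕtoℚ (suc j)))
  (ℚᵘₚ.≃-trans (ℚᵘₚ.*-cong (ℚₚ.toℚᵘ-fromℚᵘ (ℚᵘ.mkℚᵘ 1ℤ j)) (toℚᵘ-ℤtoℚ (+ suc j)))
               (ℚᵘ.*≡* (normalise (+ suc j)))))
  where
  normalise : ∀ a → 1ℤ * a * 1ℤ ≡ 1ℤ * (a * 1ℤ)
  normalise = solve-∀

suc-cancel : ∀ j {a b} → ℕtoℚ (suc j) ℚ.* a ≡ ℕtoℚ (suc j) ℚ.* b → a ≡ b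
suc-cancel j {a} {b} e = trans (sym (undo a)) (trans (cong (1/suc j ℚ.*_) e) (undo b))
  where
  undo : ∀ c → 1/suc j ℚ.* (ℕtoℚ (suc j) ℚ.* c) ≡ c
  undo c = trans (sym (ℚₚ.*-assoc (1/suc j) (ℕtoℚ (suc j)) c))
                 (trans (cong (ℚ._* c) (1/suc-* j)) (ℚₚ.*-identityˡ c))

_+ᵖ_ : Poly → Poly → Poly
[]      +ᵖ q       = q
(c ∷ p) +ᵖ []      = c ∷ p
(c ∷ p) +ᵖ (d ∷ q) = (c ℚ.+ d) ∷ (p +ᵖ q)

_·ᵖ_ : ℚ → Poly → Poly
a ·ᵖ p = map (a ℚ.*_) p

reflect : Poly → Poly
reflect []      = []
reflect (c ∷ p) = c ∷ ((ℚ.- 1ℚ) ·ᵖ reflect p)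

open +-*-Solver using (solve; _:=_; _:+_; _:*_; :-_; con)

eval-+ᵖ : ∀ p q x → eval (p +ᵖ q) x ≡ eval p x ℚ.+ eval q x
eval-+ᵖ []      q       x = sym (ℚₚ.+-identityˡ (eval q x))
eval-+ᵖ (c ∷ p) []      x = sym (ℚₚ.+-identityʳ (eval (c ∷ p) x))
eval-+ᵖ (c ∷ p) (d ∷ q) x = trans (cong (λ e → (c ℚ.+ d) ℚ.+ x ℚ.* e) (eval-+ᵖ p q x))
  (solve 5 (λ c d x P Q → (c :+ d) :+ x :* (P :+ Q) := (c :+ x :* P) :+ (d :+ x :* Q)) refl
         c d x (eval p x) (eval q x))

eval-·ᵖ : ∀ a p x → eval (a ·ᵖ p) x ≡ a ℚ.* eval p x
eval-·ᵖ a []      x = sym (ℚₚ.*-zeroʳ a)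
eval-·ᵖ a (c ∷ p) x = trans (cong (λ e → a ℚ.* c ℚ.+ x ℚ.* e) (eval-·ᵖ a p x))
  (solve 4 (λ a c x P → a :* c :+ x :* (a :* P) := a :* (c :+ x :* P)) refl a c x (eval p x))

eval-reflect : ∀ p x → eval (reflect p) x ≡ eval p (ℚ.- x)
eval-reflect []      x = refl
eval-reflect (c ∷ p) x = trans
  (cong (λ e → c ℚ.+ x ℚ.* e) (trans (eval-·ᵖ (ℚ.- 1ℚ) (reflect p) x) (cong (ℚ.- 1ℚ ℚ.*_) (eval-reflect p x))))
  (solve 3 (λ c x P → c :+ x :* ((:- con 1ℚ) :* P) := c :+ (:- x) :* P) refl c x (eval p (ℚ.- x)))

quotient : ℚ → Poly → Poly
quotient a []      = []
quotient a (c ∷ p) = eval (c ∷ p) a ∷ quotient a p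

length-quotient : ∀ a p → length (quotient a p) ≡ length p
length-quotient a []      = refl
length-quotient a (c ∷ p) = cong suc (length-quotient a p)

-- Division of c + x p by x - a.
factor-theorem : ∀ a c p x → eval (c ∷ p) x ≡ eval (c ∷ p) a ℚ.+ (x ℚ.+ ℚ.- a) ℚ.* eval (quotient a p) x
factor-theorem a c []      x =
  solve 3 (λ a c x → c :+ x :* con 0ℚ := (c :+ a :* con 0ℚ) :+ (x :+ :- a) :* con 0ℚ) refl a c x
factor-theorem a c (d ∷ p) x = trans (cong (λ e → c ℚ.+ x ℚ.* e) (factor-theorem a d p x))
  (solve 5 (λ a c x E q → c :+ x :* (E :+ (x :+ :- a) :* q) := (c :+ a :* E) :+ (x :+ :- a) :* (E :+ x :* q))
         refl a c x (eval (d ∷ p) a) (eval (quotient a p) x))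

-- Dividing by the root at `s` leaves a quotient that vanishes at all later integers, where the
-- linear factor is invertible. The quotient is not a sublist, so the induction is on the bound `L`
-- of the length.
vanishes : ∀ L p → length p ℕ.≤ L → ∀ s → (∀ m → s ℕ.≤ m → eval p (ℕtoℚ m) ≡ 0ℚ) → ∀ x → eval p x ≡ 0ℚ
vanishes L       []      _        s h x = refl
vanishes (suc L) (c ∷ p) (s≤s len) s h x = begin
  eval (c ∷ p) x
    ≡⟨ factor-theorem a c p x ⟩
  eval (c ∷ p) a ℚ.+ (x ℚ.+ ℚ.- a) ℚ.* eval (quotient a p) x
    ≡⟨ cong₂ (λ u v → u ℚ.+ (x ℚ.+ ℚ.- a) ℚ.* v) (h s ℕₚ.≤-refl)
         (vanishes L (quotient a p) (subst (ℕ._≤ L) (sym (length-quotient a p)) len) (suc s) quotient-vanishes x) ⟩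
  0ℚ ℚ.+ (x ℚ.+ ℚ.- a) ℚ.* 0ℚ
    ≡⟨ trans (ℚₚ.+-identityˡ _) (ℚₚ.*-zeroʳ (x ℚ.+ ℚ.- a)) ⟩
  0ℚ ∎
  where
  a = ℕtoℚ s
  quotient-vanishes : ∀ m → suc s ℕ.≤ m → eval (quotient a p) (ℕtoℚ m) ≡ 0ℚ
  quotient-vanishes m s<m = suc-cancel k (begin
    ℕtoℚ (suc k) ℚ.* q
      ≡⟨ solve 3 (λ d a q → d :* q := con 0ℚ :+ ((d :+ a) :+ :- a) :* q) refl (ℕtoℚ (suc k)) a q ⟩
    0ℚ ℚ.+ ((ℕtoℚ (suc k) ℚ.+ a) ℚ.+ ℚ.- a) ℚ.* q
      ≡⟨ cong₂ (λ u v → u ℚ.+ (v ℚ.+ ℚ.- a) ℚ.* q) (sym (h s ℕₚ.≤-refl))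
           (trans (sym (ℤtoℚ-+ (+ suc k) (+ s))) (cong (ℤtoℚ ∘ +_) sum≡m)) ⟩
    eval (c ∷ p) a ℚ.+ (ℕtoℚ m ℚ.+ ℚ.- a) ℚ.* q
      ≡⟨ sym (factor-theorem a c p (ℕtoℚ m)) ⟩
    eval (c ∷ p) (ℕtoℚ m)
      ≡⟨ h m (ℕₚ.<⇒≤ s<m) ⟩
    0ℚ
      ≡⟨ sym (ℚₚ.*-zeroʳ (ℕtoℚ (suc k))) ⟩
    ℕtoℚ (suc k) ℚ.* 0ℚ ∎)
    where
    k = m ℕ.∸ suc s
    q = eval (quotient a p) (ℕtoℚ m)
    sum≡m : suc k ℕ.+ s ≡ m
    sum≡m = trans (sym (ℕₚ.+-suc k s)) (ℕₚ.m∸n+n≡m s<m)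

poly-unique : ∀ p q → (∀ m → 1 ℕ.≤ m → eval p (ℕtoℚ m) ≡ eval q (ℕtoℚ m)) → ∀ x → eval p x ≡ eval q x
poly-unique p q h x = begin
  eval p x
    ≡⟨ solve 2 (λ P Q → P := (P :+ (:- con 1ℚ) :* Q) :+ Q) refl (eval p x) (eval q x) ⟩
  (eval p x ℚ.+ (ℚ.- 1ℚ) ℚ.* eval q x) ℚ.+ eval q x
    ≡⟨ cong (ℚ._+ eval q x) (trans (sym (eval-difference x)) (vanishes (length d) d ℕₚ.≤-refl 1
         (λ m 1≤m → trans (eval-difference (ℕtoℚ m)) (trans
           (cong (λ e → e ℚ.+ (ℚ.- 1ℚ) ℚ.* eval q (ℕtoℚ m)) (h m 1≤m))
           (solve 1 (λ Q → Q :+ (:- con 1ℚ) :* Q := con 0ℚ) refl (eval q (ℕtoℚ m))))) x)) ⟩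
  0ℚ ℚ.+ eval q x
    ≡⟨ ℚₚ.+-identityˡ (eval q x) ⟩
  eval q x ∎
  where
  d = p +ᵖ ((ℚ.- 1ℚ) ·ᵖ q)
  eval-difference : ∀ x → eval d x ≡ eval p x ℚ.+ (ℚ.- 1ℚ) ℚ.* eval q x
  eval-difference x = trans (eval-+ᵖ p ((ℚ.- 1ℚ) ·ᵖ q) x) (cong (eval p x ℚ.+_) (eval-·ᵖ (ℚ.- 1ℚ) q x))

-- The polynomial `x (x - 1) ⋯ (x - j + 1) / j!`, built by `(j + 1) C(x, j + 1) = (x - j) C(x, j)`;
-- prefixing 0 multiplies by `x`.
binomialPoly : ℕ → Poly
binomialPoly zero    = 1ℚ ∷ []
binomialPoly (suc j) = 1/suc j ·ᵖ ((0ℚ ∷ binomialPoly j) +ᵖ ((ℚ.- ℕtoℚ j) ·ᵖ binomialPoly j))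

eval-binomialPoly-suc : ∀ j x →
  ℕtoℚ (suc j) ℚ.* eval (binomialPoly (suc j)) x ≡ (x ℚ.+ ℚ.- ℕtoℚ j) ℚ.* eval (binomialPoly j) x
eval-binomialPoly-suc j x = begin
  ℕtoℚ (suc j) ℚ.* eval (binomialPoly (suc j)) x
    ≡⟨ cong (ℕtoℚ (suc j) ℚ.*_) (trans (eval-·ᵖ (1/suc j) ((0ℚ ∷ B) +ᵖ ((ℚ.- ℕtoℚ j) ·ᵖ B)) x) (cong (1/suc j ℚ.*_)
         (trans (eval-+ᵖ (0ℚ ∷ B) ((ℚ.- ℕtoℚ j) ·ᵖ B) x) (cong ((0ℚ ℚ.+ x ℚ.* b) ℚ.+_) (eval-·ᵖ (ℚ.- ℕtoℚ j) B x))))) ⟩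
  ℕtoℚ (suc j) ℚ.* (1/suc j ℚ.* ((0ℚ ℚ.+ x ℚ.* b) ℚ.+ (ℚ.- ℕtoℚ j) ℚ.* b))
    ≡⟨ solve 5 (λ s i x b J → s :* (i :* ((con 0ℚ :+ x :* b) :+ (:- J) :* b)) := (i :* s) :* ((x :+ :- J) :* b))
         refl (ℕtoℚ (suc j)) (1/suc j) x b (ℕtoℚ j) ⟩
  (1/suc j ℚ.* ℕtoℚ (suc j)) ℚ.* ((x ℚ.+ ℚ.- ℕtoℚ j) ℚ.* b)
    ≡⟨ trans (cong (ℚ._* ((x ℚ.+ ℚ.- ℕtoℚ j) ℚ.* b)) (1/suc-* j)) (ℚₚ.*-identityˡ _) ⟩
  (x ℚ.+ ℚ.- ℕtoℚ j) ℚ.* b ∎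
  where
  B = binomialPoly j
  b = eval B x

eval-binomialPoly-0 : ∀ x → eval (binomialPoly 0) x ≡ 1ℚ
eval-binomialPoly-0 x = solve 1 (λ x → con 1ℚ :+ x :* con 0ℚ := con 1ℚ) refl x

-- After clearing the denominator, induction expresses both sides by `b₁` and `b₀`, and the defining
-- recursion replaces `(x - j) b₀` by `(j + 1) b₁`.
eval-binomialPoly-pascal : ∀ j x →
  eval (binomialPoly (suc j)) (x ℚ.+ 1ℚ) ≡ eval (binomialPoly (suc j)) x ℚ.+ eval (binomialPoly j) x
eval-binomialPoly-pascal zero x = suc-cancel 0 (begin
  1ℚ ℚ.* eval (binomialPoly 1) (x ℚ.+ 1ℚ)
    ≡⟨ eval-binomialPoly-suc 0 (x ℚ.+ 1ℚ) ⟩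
  ((x ℚ.+ 1ℚ) ℚ.+ ℚ.- 0ℚ) ℚ.* eval (binomialPoly 0) (x ℚ.+ 1ℚ)
    ≡⟨ cong (((x ℚ.+ 1ℚ) ℚ.+ ℚ.- 0ℚ) ℚ.*_) (trans (eval-binomialPoly-0 (x ℚ.+ 1ℚ)) (sym (eval-binomialPoly-0 x))) ⟩
  ((x ℚ.+ 1ℚ) ℚ.+ ℚ.- 0ℚ) ℚ.* b
    ≡⟨ solve 2 (λ x b → ((x :+ con 1ℚ) :+ :- con 0ℚ) :* b := (x :+ :- con 0ℚ) :* b :+ con 1ℚ :* b) refl x b ⟩
  (x ℚ.+ ℚ.- 0ℚ) ℚ.* b ℚ.+ 1ℚ ℚ.* b
    ≡⟨ cong (ℚ._+ 1ℚ ℚ.* b) (sym (eval-binomialPoly-suc 0 x)) ⟩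
  1ℚ ℚ.* eval (binomialPoly 1) x ℚ.+ 1ℚ ℚ.* b
    ≡⟨ sym (ℚₚ.*-distribˡ-+ 1ℚ (eval (binomialPoly 1) x) b) ⟩
  1ℚ ℚ.* (eval (binomialPoly 1) x ℚ.+ b) ∎)
  where b = eval (binomialPoly 0) x
eval-binomialPoly-pascal (suc j) x = suc-cancel (suc j) (begin
  ℕtoℚ (suc (suc j)) ℚ.* eval (binomialPoly (suc (suc j))) (x ℚ.+ 1ℚ)
    ≡⟨ eval-binomialPoly-suc (suc j) (x ℚ.+ 1ℚ) ⟩
  ((x ℚ.+ 1ℚ) ℚ.+ ℚ.- ℕtoℚ (suc j)) ℚ.* eval (binomialPoly (suc j)) (x ℚ.+ 1ℚ)
    ≡⟨ cong₂ (λ u v → ((x ℚ.+ 1ℚ) ℚ.+ ℚ.- u) ℚ.* v) (ℕtoℚ-suc j) (eval-binomialPoly-pascal j x) ⟩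
  ((x ℚ.+ 1ℚ) ℚ.+ ℚ.- (J ℚ.+ 1ℚ)) ℚ.* (b₁ ℚ.+ b₀)
    ≡⟨ solve 4 (λ x J b₁ b₀ → ((x :+ con 1ℚ) :+ :- (J :+ con 1ℚ)) :* (b₁ :+ b₀)
                           := (x :+ :- J) :* b₁ :+ (x :+ :- J) :* b₀) refl x J b₁ b₀ ⟩
  (x ℚ.+ ℚ.- J) ℚ.* b₁ ℚ.+ (x ℚ.+ ℚ.- J) ℚ.* b₀
    ≡⟨ cong ((x ℚ.+ ℚ.- J) ℚ.* b₁ ℚ.+_) (trans (sym (eval-binomialPoly-suc j x)) (cong (ℚ._* b₁) (ℕtoℚ-suc j))) ⟩
  (x ℚ.+ ℚ.- J) ℚ.* b₁ ℚ.+ (J ℚ.+ 1ℚ) ℚ.* b₁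
    ≡⟨ solve 3 (λ x J b₁ → (x :+ :- J) :* b₁ :+ (J :+ con 1ℚ) :* b₁
                         := (x :+ :- (J :+ con 1ℚ)) :* b₁ :+ ((J :+ con 1ℚ) :+ con 1ℚ) :* b₁) refl x J b₁ ⟩
  (x ℚ.+ ℚ.- (J ℚ.+ 1ℚ)) ℚ.* b₁ ℚ.+ ((J ℚ.+ 1ℚ) ℚ.+ 1ℚ) ℚ.* b₁
    ≡⟨ cong₂ (λ u v → (x ℚ.+ ℚ.- u) ℚ.* b₁ ℚ.+ v ℚ.* b₁) (sym (ℕtoℚ-suc j))
         (trans (cong (ℚ._+ 1ℚ) (sym (ℕtoℚ-suc j))) (sym (ℕtoℚ-suc (suc j)))) ⟩
  (x ℚ.+ ℚ.- ℕtoℚ (suc j)) ℚ.* b₁ ℚ.+ ℕtoℚ (suc (suc j)) ℚ.* b₁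
    ≡⟨ cong (ℚ._+ ℕtoℚ (suc (suc j)) ℚ.* b₁) (sym (eval-binomialPoly-suc (suc j) x)) ⟩
  ℕtoℚ (suc (suc j)) ℚ.* eval (binomialPoly (suc (suc j))) x ℚ.+ ℕtoℚ (suc (suc j)) ℚ.* b₁
    ≡⟨ sym (ℚₚ.*-distribˡ-+ (ℕtoℚ (suc (suc j))) _ b₁) ⟩
  ℕtoℚ (suc (suc j)) ℚ.* (eval (binomialPoly (suc (suc j))) x ℚ.+ b₁) ∎)
  where
  J  = ℕtoℚ j
  b₁ = eval (binomialPoly (suc j)) x
  b₀ = eval (binomialPoly j) x

eval-binomial⁺ : ∀ m j → eval (binomialPoly j) (ℕtoℚ m) ≡ ℤtoℚ (binomial⁺ m j)
eval-binomial⁺ zero    zero    = refl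
eval-binomial⁺ (suc m) zero    = eval-binomialPoly-0 (ℕtoℚ (suc m))
eval-binomial⁺ zero (suc zero) = refl
eval-binomial⁺ zero (suc (suc j)) = suc-cancel (suc j) (begin
  ℕtoℚ (suc (suc j)) ℚ.* eval (binomialPoly (suc (suc j))) 0ℚ
    ≡⟨ eval-binomialPoly-suc (suc j) 0ℚ ⟩
  (0ℚ ℚ.+ ℚ.- ℕtoℚ (suc j)) ℚ.* eval (binomialPoly (suc j)) 0ℚ
    ≡⟨ cong ((0ℚ ℚ.+ ℚ.- ℕtoℚ (suc j)) ℚ.*_) (eval-binomial⁺ zero (suc j)) ⟩
  (0ℚ ℚ.+ ℚ.- ℕtoℚ (suc j)) ℚ.* 0ℚ
    ≡⟨ trans (ℚₚ.*-zeroʳ (0ℚ ℚ.+ ℚ.- ℕtoℚ (suc j))) (sym (ℚₚ.*-zeroʳ (ℕtoℚ (suc (suc j))))) ⟩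
  ℕtoℚ (suc (suc j)) ℚ.* 0ℚ ∎)
eval-binomial⁺ (suc m) (suc j) = begin
  eval (binomialPoly (suc j)) (ℕtoℚ (suc m))
    ≡⟨ cong (eval (binomialPoly (suc j))) (ℕtoℚ-suc m) ⟩
  eval (binomialPoly (suc j)) (ℕtoℚ m ℚ.+ 1ℚ)
    ≡⟨ eval-binomialPoly-pascal j (ℕtoℚ m) ⟩
  eval (binomialPoly (suc j)) (ℕtoℚ m) ℚ.+ eval (binomialPoly j) (ℕtoℚ m)
    ≡⟨ cong₂ ℚ._+_ (eval-binomial⁺ m (suc j)) (eval-binomial⁺ m j) ⟩
  ℤtoℚ (binomial⁺ m (suc j)) ℚ.+ ℤtoℚ (binomial⁺ m j)
    ≡⟨ sym (ℤtoℚ-+ (binomial⁺ m (suc j)) (binomial⁺ m j)) ⟩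
  ℤtoℚ (binomial⁺ (suc m) (suc j)) ∎

eval-binomial⁻ : ∀ m j → eval (binomialPoly j) (ℚ.- ℕtoℚ m) ≡ ℤtoℚ (binomial⁻ m j)
eval-binomial⁻ zero    j       = eval-binomial⁺ zero j
eval-binomial⁻ (suc m) zero    = eval-binomialPoly-0 (ℚ.- ℕtoℚ (suc m))
eval-binomial⁻ (suc m) (suc j) = begin
  eval (binomialPoly (suc j)) x
    ≡⟨ solve 2 (λ a b → a := (a :+ b) :+ :- b) refl (eval (binomialPoly (suc j)) x) (eval (binomialPoly j) x) ⟩
  (eval (binomialPoly (suc j)) x ℚ.+ eval (binomialPoly j) x) ℚ.+ ℚ.- eval (binomialPoly j) x
    ≡⟨ cong (ℚ._+ ℚ.- eval (binomialPoly j) x) (sym (eval-binomialPoly-pascal j x)) ⟩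
  eval (binomialPoly (suc j)) (x ℚ.+ 1ℚ) ℚ.+ ℚ.- eval (binomialPoly j) x
    ≡⟨ cong₂ (λ y z → eval (binomialPoly (suc j)) y ℚ.+ ℚ.- z) x+1 (eval-binomial⁻ (suc m) j) ⟩
  eval (binomialPoly (suc j)) (ℚ.- ℕtoℚ m) ℚ.+ ℚ.- ℤtoℚ (binomial⁻ (suc m) j)
    ≡⟨ cong₂ ℚ._+_ (eval-binomial⁻ m (suc j)) (sym (ℤtoℚ-neg (binomial⁻ (suc m) j))) ⟩
  ℤtoℚ (binomial⁻ m (suc j)) ℚ.+ ℤtoℚ (- binomial⁻ (suc m) j)
    ≡⟨ sym (ℤtoℚ-+ (binomial⁻ m (suc j)) (- binomial⁻ (suc m) j)) ⟩
  ℤtoℚ (binomial⁻ (suc m) (suc j)) ∎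
  where
  x = ℚ.- ℕtoℚ (suc m)
  x+1 : x ℚ.+ 1ℚ ≡ ℚ.- ℕtoℚ m
  x+1 = trans (cong (λ y → ℚ.- y ℚ.+ 1ℚ) (ℕtoℚ-suc m))
              (solve 1 (λ a → (:- (a :+ con 1ℚ)) :+ con 1ℚ := :- a) refl (ℕtoℚ m))

combination : ∀ {A : Set} → List A → (A → ℤ) → (A → Poly) → Poly
combination []       c p = []
combination (i ∷ is) c p = (ℤtoℚ (c i) ·ᵖ p i) +ᵖ combination is c p

eval-combination : ∀ {A : Set} (is : List A) c (p : A → Poly) x (b : A → ℤ) →
  (∀ i → eval (p i) x ≡ ℤtoℚ (b i)) → eval (combination is c p) x ≡ ℤtoℚ (∑ is (λ i → b i * c i))
eval-combination []       c p x b e = refl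
eval-combination (i ∷ is) c p x b e = begin
  eval ((ℤtoℚ (c i) ·ᵖ p i) +ᵖ combination is c p) x
    ≡⟨ eval-+ᵖ (ℤtoℚ (c i) ·ᵖ p i) (combination is c p) x ⟩
  eval (ℤtoℚ (c i) ·ᵖ p i) x ℚ.+ eval (combination is c p) x
    ≡⟨ cong₂ ℚ._+_ (trans (eval-·ᵖ (ℤtoℚ (c i)) (p i) x) (trans (cong (ℤtoℚ (c i) ℚ.*_) (e i))
         (trans (sym (ℤtoℚ-* (c i) (b i))) (cong ℤtoℚ (ℤₚ.*-comm (c i) (b i))))))
         (eval-combination is c p x b e) ⟩
  ℤtoℚ (b i * c i) ℚ.+ ℤtoℚ (∑ is (λ i → b i * c i))
    ≡⟨ sym (ℤtoℚ-+ (b i * c i) (∑ is (λ i → b i * c i))) ⟩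
  ℤtoℚ (∑ (i ∷ is) (λ i → b i * c i)) ∎

-- Coefficients of the antipode

reverse-isComposition : ∀ {n} γ → IsComposition n γ → IsComposition n (reverse γ)
reverse-isComposition γ (p , e) = All-reverse , trans (sum-↭ (↭-reverse γ)) e
  where
  All-reverse = All-resp-↭ (↭-sym (↭-reverse γ)) p

coeff≡∑ : ∀ γ ts → coeff γ ts ≡ ∑ ts (λ t → χ (proj₂ t ≟ᶜ γ) * proj₁ t)
coeff≡∑ γ []             = refl
coeff≡∑ γ ((z , α) ∷ ts) = cong₂ _+_ (select (does (α ≟ᶜ γ))) (coeff≡∑ γ ts)
  where
  select : ∀ b → (if b then z else 0ℤ) ≡ (if b then 1ℤ else 0ℤ) * z
  select true  = sym (ℤₚ.*-identityˡ z)
  select false = refl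

-- The reversal that the antipode applies to each coarsening is moved to `γ`, since reversal is an
-- involution. What remains is a sum over the refinements of `reverse γ`.
coeff-antipode : ∀ γ (cs : List Composition) (f : Composition → ℤ) →
  coeff γ (antipode (map (λ α → f α , α) cs))
    ≡ ∑ cs (λ α → refinements α (reverse γ) * (negOnePow (length α) * f α))
coeff-antipode γ cs f = begin
  coeff γ (antipode (map (λ α → f α , α) cs))
    ≡⟨ coeff≡∑ γ (antipode (map (λ α → f α , α) cs)) ⟩
  ∑ (antipode (map (λ α → f α , α) cs)) w
    ≡⟨ ∑-concatMap terms (map (λ α → f α , α) cs) w ⟩
  ∑ (map (λ α → f α , α) cs) (λ t → ∑ (terms t) w)
    ≡⟨ ∑-map (λ α → f α , α) cs (λ t → ∑ (terms t) w) ⟩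
  ∑ cs (λ α → ∑ (terms (f α , α)) w)
    ≡⟨ ∑-cong cs (λ α → trans
         (∑-map (λ β → negOnePow (length α) * f α , reverse β) (coarsenings α) w) (trans
         (∑-cong (coarsenings α) (λ β → cong (_* (negOnePow (length α) * f α))
           (χ-⇔ (reverse β ≟ᶜ γ) (β ≟ᶜ reverse γ)
             (λ e → trans (sym (Listₚ.reverse-involutive β)) (cong reverse e))
             (λ e → trans (cong reverse e) (Listₚ.reverse-involutive γ)))))
         (sym (*-distribʳ-∑ (coarsenings α) (negOnePow (length α) * f α) (λ β → χ (β ≟ᶜ reverse γ)))))) ⟩
  ∑ cs (λ α → refinements α (reverse γ) * (negOnePow (length α) * f α)) ∎
  where
  w : ℤ × Composition → ℤ
  w t = χ (proj₂ t ≟ᶜ γ) * proj₁ t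
  terms : ℤ × Composition → QSymElt
  terms t = map (λ β → negOnePow (length (proj₂ t)) * proj₁ t , reverse β) (coarsenings (proj₂ t))

-- Reciprocity for quasisymmetric functions and for polynomials

module Reciprocity {n} (le₁ le₂ : BRel n) (po₁ : IsPoset le₁) (po₂ : IsPoset le₂)
  (special : LocallySpecial le₁ le₂) (g : Permutation′ n) (aut : IsAut le₁ le₂ g) where
  open Partitions le₁ g using (power; power-scale; good-⊥; monoCoeff≡chain; orderCount≡power)
  open Chains le₁ g using (chain; chain-scale)
  private
    R     = proj₁ (∃-orbits n g)
    ε-⊤   = proj₁ (proj₂ (∃-orbits n g))
    orbit = proj₂ (proj₂ (∃-orbits n g))
    module C₊ = Convolution le₁ le₂ g po₁ po₂ special aut R orbit

    special-flip : LocallySpecial le₁ (flip le₂)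
    special-flip x y x<y cover = Sum.swap (special x y x<y cover)

    aut-flip : IsAut le₁ (flip le₂) g
    aut-flip i j = proj₁ (aut i j) , proj₂ (aut j i)

    -- Comparability and automorphisms do not see the direction of `≤₂`, so the cancellation also
    -- holds with the two factors exchanged. This is the left inverse required at negative
    -- arguments.
    module C₋ = Convolution le₁ (flip le₂) g po₁ (flip-IsPoset po₂) special-flip aut-flip R orbit
    module N₊ = Newton le₁ le₂ g
    module N₋ = Newton le₁ (flip le₂) g
    σ = negOnePow n * sgn g

  -- Only chains that end in the whole set count, so the sign at the end is the constant `σ`;
  -- `σ-cancel` uses that `σ` squares to 1, being the value of `ε` there.
  ε-full : ∀ J → ε R J * full J ≡ σ * full J
  ε-full J = trans (ℤₚ.*-comm (ε R J) (full J)) (trans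
    (χ-*-cong (J ≟ˢ ⊤) (λ { refl → ε-⊤ })) (ℤₚ.*-comm (full J) σ))

  σ-cancel : ∀ x → σ * (ε R ⊥ * (σ * x)) ≡ x
  σ-cancel x = begin
    σ * (ε R ⊥ * (σ * x))        ≡⟨ cong (λ e → σ * (e * (σ * x))) (ε-⊥ R) ⟩
    σ * (1ℤ * (σ * x))           ≡⟨ move σ x ⟩
    σ * σ * x                    ≡⟨ cong (λ e → e * e * x) (sym ε-⊤) ⟩
    ε R ⊤ * ε R ⊤ * x            ≡⟨ cong (_* x) (ε-square R ⊤) ⟩
    1ℤ * x                       ≡⟨ ℤₚ.*-identityˡ x ⟩
    x                            ∎
    where
    move : ∀ s x → s * (1ℤ * (s * x)) ≡ s * s * x
    move = solve-∀

  coeff-reciprocity : ∀ γ → σ * coeff γ (antipode (Ω le₁ le₂ g)) ≡ coeff γ (Ω (dual₁ le₁) le₂ g)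
  coeff-reciprocity γ = begin
    σ * coeff γ (antipode (Ω le₁ le₂ g))
      ≡⟨ cong (σ *_) (trans (coeff-antipode γ (compositions n) (λ α → + monoCoeff le₁ le₂ g α))
           (∑-cong (compositions n) (λ α → cong (λ c → refinements α (reverse γ) * (negOnePow (length α) * c))
             (monoCoeff≡chain le₂ α)))) ⟩
    σ * ∑ᶜ-refinements n (reverse γ) (λ α → negOnePow (length α) * chain le₂ α full ⊥)
      ≡⟨ compare (isComposition? n (reverse γ)) ⟩
    ∑ (compositions n) (λ α → χ (α ≟ᶜ γ) * + monoCoeff (dual₁ le₁) le₂ g α)
      ≡⟨ sym (trans (coeff≡∑ γ (Ω (dual₁ le₁) le₂ g))
           (∑-map (λ α → (+ monoCoeff (dual₁ le₁) le₂ g α , α)) (compositions n)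
                  (λ t → χ (proj₂ t ≟ᶜ γ) * proj₁ t))) ⟩
    coeff γ (Ω (dual₁ le₁) le₂ g) ∎
    where
    signed : Composition → ℤ
    signed α = negOnePow (length α) * chain le₂ α full ⊥
    -- `γ` is any list of numbers. If its reverse is not a composition of `n`, neither side has a
    -- term at `γ`, and both coefficients are 0.
    compare : Dec (IsComposition n (reverse γ)) →
      σ * ∑ᶜ-refinements n (reverse γ) signed
        ≡ ∑ (compositions n) (λ α → χ (α ≟ᶜ γ) * + monoCoeff (dual₁ le₁) le₂ g α)
    compare (no ¬c) = begin
      σ * ∑ᶜ-refinements n (reverse γ) signed
        ≡⟨ cong (σ *_) (∑-refinements-¬composition n (reverse γ) signed ¬c) ⟩
      σ * 0ℤ
        ≡⟨ ℤₚ.*-zeroʳ σ ⟩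
      0ℤ
        ≡⟨ sym (∑-compositions-¬composition n γ (λ α → + monoCoeff (dual₁ le₁) le₂ g α)
             (¬c ∘ reverse-isComposition γ)) ⟩
      ∑ (compositions n) (λ α → χ (α ≟ᶜ γ) * + monoCoeff (dual₁ le₁) le₂ g α) ∎
    compare (yes c) = begin
      σ * ∑ᶜ-refinements n (reverse γ) signed
        ≡⟨ cong (σ *_) (Inversion.signedSum-refinements le₁ le₂ g R C₊.ζ*εζ≡0 n (reverse γ) c full ⊥ good-⊥) ⟩
      σ * (ε R ⊥ * chain (flip le₂) (reverse γ) (λ J → ε R J * full J) ⊥)
        ≡⟨ cong (λ x → σ * (ε R ⊥ * x)) (chain-scale (flip le₂) (reverse γ) σ full ε-full ⊥) ⟩
      σ * (ε R ⊥ * (σ * chain (flip le₂) (reverse γ) full ⊥))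
        ≡⟨ σ-cancel (chain (flip le₂) (reverse γ) full ⊥) ⟩
      chain (flip le₂) (reverse γ) full ⊥
        ≡⟨ sym (monoCoeff-dual le₁ le₂ g γ) ⟩
      + monoCoeff (dual₁ le₁) le₂ g γ
        ≡⟨ sym (∑-compositions-δ n γ (λ α → + monoCoeff (dual₁ le₁) le₂ g α)
             (subst (IsComposition n) (Listₚ.reverse-involutive γ) (reverse-isComposition (reverse γ) c))) ⟩
      ∑ (compositions n) (λ α → χ (α ≟ᶜ γ) * + monoCoeff (dual₁ le₁) le₂ g α) ∎

  -- The Newton series at the empty set with its binomial coefficients replaced by polynomials, so
  -- that the argument may be any rational number.
  orderPoly : (ℕ → Vec Bool n → ℤ) → Poly
  orderPoly d = combination (allFin (suc n)) (λ j → d (toℕ j) ⊥) (λ j → binomialPoly (toℕ j))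

  P₀ Q₀ : Poly
  P₀ = orderPoly N₊.difference
  Q₀ = orderPoly N₋.difference

  P₀-isOrderPoly : IsOrderPoly le₁ le₂ g P₀
  P₀-isOrderPoly m _ = begin
    eval P₀ (ℕtoℚ m)
      ≡⟨ eval-combination (allFin (suc n)) (λ j → N₊.difference (toℕ j) ⊥) (λ j → binomialPoly (toℕ j)) (ℕtoℚ m)
           (λ j → binomial⁺ m (toℕ j)) (λ j → eval-binomial⁺ m (toℕ j)) ⟩
    ℤtoℚ (N₊.newton (binomial⁺ m) ⊥)
      ≡⟨ cong ℤtoℚ (trans (N₊.newton-binomial⁺ m ⊥ good-⊥) (sym (orderCount≡power le₂ m))) ⟩
    ℕtoℚ (orderCount le₁ le₂ g m) ∎

  Q₀-isOrderPoly : IsOrderPoly (dual₁ le₁) le₂ g Q₀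
  Q₀-isOrderPoly m _ = begin
    eval Q₀ (ℕtoℚ m)
      ≡⟨ eval-combination (allFin (suc n)) (λ j → N₋.difference (toℕ j) ⊥) (λ j → binomialPoly (toℕ j)) (ℕtoℚ m)
           (λ j → binomial⁺ m (toℕ j)) (λ j → eval-binomial⁺ m (toℕ j)) ⟩
    ℤtoℚ (N₋.newton (binomial⁺ m) ⊥)
      ≡⟨ cong ℤtoℚ (trans (N₋.newton-binomial⁺ m ⊥ good-⊥) (sym (orderCount-dual le₁ le₂ g m))) ⟩
    ℕtoℚ (orderCount (dual₁ le₁) le₂ g m) ∎

  P₀-reflect : ∀ m → ℤtoℚ σ ℚ.* eval P₀ (ℚ.- ℕtoℚ m) ≡ ℕtoℚ (orderCount (dual₁ le₁) le₂ g m)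
  P₀-reflect m = begin
    ℤtoℚ σ ℚ.* eval P₀ (ℚ.- ℕtoℚ m)
      ≡⟨ cong (ℤtoℚ σ ℚ.*_) (eval-combination (allFin (suc n)) (λ j → N₊.difference (toℕ j) ⊥)
           (λ j → binomialPoly (toℕ j)) (ℚ.- ℕtoℚ m)
           (λ j → binomial⁻ m (toℕ j)) (λ j → eval-binomial⁻ m (toℕ j))) ⟩
    ℤtoℚ σ ℚ.* ℤtoℚ (N₊.newton (binomial⁻ m) ⊥)
      ≡⟨ sym (ℤtoℚ-* σ (N₊.newton (binomial⁻ m) ⊥)) ⟩
    ℤtoℚ (σ * N₊.newton (binomial⁻ m) ⊥)
      ≡⟨ cong ℤtoℚ (begin
           σ * N₊.newton (binomial⁻ m) ⊥
             ≡⟨ cong (σ *_) (N₊.newton-binomial⁻ R C₋.ζ*εζ≡0 m ⊥ good-⊥) ⟩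
           σ * (ε R ⊥ * power (flip le₂) m (λ J → ε R J * full J) ⊥)
             ≡⟨ cong (λ x → σ * (ε R ⊥ * x)) (power-scale (flip le₂) m σ full ε-full ⊥) ⟩
           σ * (ε R ⊥ * (σ * power (flip le₂) m full ⊥))
             ≡⟨ σ-cancel (power (flip le₂) m full ⊥) ⟩
           power (flip le₂) m full ⊥
             ≡⟨ sym (orderCount-dual le₁ le₂ g m) ⟩
           + orderCount (dual₁ le₁) le₂ g m ∎) ⟩
    ℕtoℚ (orderCount (dual₁ le₁) le₂ g m) ∎

  -- Values at positive integers determine a polynomial function. So `P` may be replaced by `P₀`,
  -- whose values at negative integers are known; reflecting `P₀` makes these values at positive
  -- integers, where they can be compared with those of `Q`.
  poly-reciprocity : ∀ P Q → IsOrderPoly le₁ le₂ g P → IsOrderPoly (dual₁ le₁) le₂ g Q →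
    ∀ x → ℤtoℚ σ ℚ.* eval P (ℚ.- x) ≡ eval Q x
  poly-reciprocity P Q hP hQ x = begin
    ℤtoℚ σ ℚ.* eval P (ℚ.- x)
      ≡⟨ cong (ℤtoℚ σ ℚ.*_) (poly-unique P P₀ (λ m h → trans (hP m h) (sym (P₀-isOrderPoly m h))) (ℚ.- x)) ⟩
    ℤtoℚ σ ℚ.* eval P₀ (ℚ.- x)
      ≡⟨ sym (eval-A x) ⟩
    eval A x
      ≡⟨ poly-unique A Q (λ m h → trans (eval-A (ℕtoℚ m)) (trans (P₀-reflect m) (sym (hQ m h)))) x ⟩
    eval Q x ∎
    where
    A = ℤtoℚ σ ·ᵖ reflect P₀
    eval-A : ∀ x → eval A x ≡ ℤtoℚ σ ℚ.* eval P₀ (ℚ.- x)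
    eval-A x = trans (eval-·ᵖ (ℤtoℚ σ) (reflect P₀) x) (cong (ℤtoℚ σ ℚ.*_) (eval-reflect P₀ x))

theorem5p1 : ∀ (n : ℕ) (le₁ le₂ : BRel n) → IsDoublePoset le₁ le₂ → LocallySpecial le₁ le₂ →
    (𝔊 : Permutation′ n → Set) → (∀ g → 𝔊 g → IsAut le₁ le₂ g) →
    ∀ (g : Permutation′ n) → 𝔊 g →
      (∀ (γ : Composition) →
         negOnePow n ℤ.* sgn g ℤ.* coeff γ (antipode (Ω le₁ le₂ g))
           ≡ coeff γ (Ω (dual₁ le₁) le₂ g))
      × (∃ λ P → IsOrderPoly le₁ le₂ g P)
      × (∃ λ Q → IsOrderPoly (dual₁ le₁) le₂ g Q)
      × (∀ (P Q : Poly) → IsOrderPoly le₁ le₂ g P → IsOrderPoly (dual₁ le₁) le₂ g Q →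
           ∀ (x : ℚ) → ℤtoℚ (negOnePow n ℤ.* sgn g) ℚ.* eval P (ℚ.- x) ≡ eval Q x)
theorem5p1 n le₁ le₂ (po₁ , po₂) special 𝔊 aut g g∈𝔊 =
  coeff-reciprocity , (P₀ , P₀-isOrderPoly) , (Q₀ , Q₀-isOrderPoly) , poly-reciprocity
  where open Reciprocity le₁ le₂ po₁ po₂ special g (aut g g∈𝔊)
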